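{- Let $n\ge 3$ and $2\le k\le n-1$ be integers. Then the $k$-uniform hypercycle $C_n^{[k]}$ on $n$ vertices is integral if and only if $k=n-1$ or $(n,k)\in\{(4,2),(6,2),(6,3),(6,4)\}$.
   Context: A hypergraph $\mathcal H=(V,E)$ consists of a finite vertex set $V$ and a set $E$ of subsets of $V$, called edges. For a hypergraph on $n$ vertices $v_1,\dots,v_n$, its adjacency matrix $A(\mathcal H)=(a_{ij})$ is the $n\times n$ symmetric matrix with zero diagonal and, for $i\neq j$, $a_{ij}=|\{e\in E: v_i,v_j\in e\}|$. A hypergraph is integral if all eigenvalues of its adjacency matrix are integers. For integers $2\le k\le n-1$, the $k$-uniform hypercycle $C_n^{[k]}$ is the hypergraph with vertex set $V=\mathbb Z_n=\{0,1,\dots,n-1\}$ (integers modulo $n$) and edge set $E=\{e_j: j\in \mathbb Z_n\}$, where $e_j=\{j,j+1,\dots,j+k-1\}$ with all additions taken modulo $n$. -}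

module Defs where

open import Algebra.Bundles.Raw using (RawMonoid)
import Algebra.Definitions.RawMonoid as RawMonoidDefinitions
import Data.Bool.Properties as Bool
open import Data.Fin.Base using (Fin; toℕ)
open import Data.Fin.Properties using (nonZeroIndex)
import Data.Fin.Properties as Fin
open import Data.Fin.Subset using (Subset; ⁅_⁆; ⋃)
open import Data.Fin.Subset.Properties using (_∈?_)
open import Data.Integer.Base as ℤ using (ℤ)
open import Data.List.Base using (List; map; filter; length; upTo; allFin; deduplicate)
open import Data.List.Relation.Unary.Unique.Propositional using (Unique)
import Data.List.Relation.Unary.Unique.DecPropositional.Properties as UniqueDec
open import Data.Nat.Base as ℕ using (ℕ)
open import Data.Nat.DivMod using (_mod_)
import Data.Nat.Properties as ℕ
open import Data.Product.Base using (∃-syntax; _×_; _,_; proj₁; proj₂)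
open import Data.Rational.Base as ℚ using (ℚ; 0ℚ; 1ℚ; ½; ∣_∣; _-_; 1/_)
import Data.Rational.Properties as ℚ
open import Data.Rational.Solver using (module +-*-Solver)
open import Data.Vec.Functional using (Vector)
import Data.Vec.Properties as Vec
open import Level using (0ℓ)
open import Relation.Binary.Definitions using (DecidableEquality)
open import Relation.Binary.PropositionalEquality
  using (_≡_; refl; sym; trans; cong; subst)
open import Relation.Nullary using (¬_; yes; no)
open import Relation.Nullary.Decidable using (_×-dec_)

-- The real numbers, as Cauchy sequences of rationals; two sequences represent
-- the same real when their difference tends to 0.

IsCauchy : (ℕ → ℚ) → Set
IsCauchy x = ∀ ε → 0ℚ ℚ.< ε →
  ∃[ N ] (∀ m n → N ℕ.≤ m → N ℕ.≤ n → ∣ x m - x n ∣ ℚ.< ε)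

record ℝ : Set where
  constructor mkℝ
  field
    seq    : ℕ → ℚ
    cauchy : IsCauchy seq

open ℝ public

infix  4 _≃_
infixl 6 _+_
infixl 7 _*_

_≃_ : ℝ → ℝ → Set
x ≃ y = ∀ ε → 0ℚ ℚ.< ε →
  ∃[ N ] (∀ n → N ℕ.≤ n → ∣ seq x n - seq y n ∣ ℚ.< ε)

private

  +-cauchy : ∀ x y → IsCauchy x → IsCauchy y → IsCauchy (λ n → x n ℚ.+ y n)
  +-cauchy x y cx cy ε 0<ε = M ℕ.⊔ N , λ m n M⊔N≤m M⊔N≤n → begin-strict
      ∣ (x m ℚ.+ y m) - (x n ℚ.+ y n) ∣
        ≡⟨ cong ∣_∣ (regroup (x m) (y m) (x n) (y n)) ⟩
      ∣ (x m - x n) ℚ.+ (y m - y n) ∣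
        ≤⟨ ℚ.∣p+q∣≤∣p∣+∣q∣ (x m - x n) (y m - y n) ⟩
      ∣ x m - x n ∣ ℚ.+ ∣ y m - y n ∣
        <⟨ ℚ.+-mono-<
             (proj₂ (cx δ 0<δ) m n (ℕ.m⊔n≤o⇒m≤o M N M⊔N≤m) (ℕ.m⊔n≤o⇒m≤o M N M⊔N≤n))
             (proj₂ (cy δ 0<δ) m n (ℕ.m⊔n≤o⇒n≤o M N M⊔N≤m) (ℕ.m⊔n≤o⇒n≤o M N M⊔N≤n)) ⟩
      δ ℚ.+ δ
        ≡⟨ solve 1 (λ e → con ½ :* e :+ con ½ :* e := e) refl ε ⟩
      ε ∎
    where
    open ℚ.≤-Reasoning
    open +-*-Solver
    regroup : ∀ a b c d → (a ℚ.+ b) - (c ℚ.+ d) ≡ (a - c) ℚ.+ (b - d)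
    regroup = solve 4 (λ a b c d → (a :+ b) :- (c :+ d) := (a :- c) :+ (b :- d)) refl
    δ = ½ ℚ.* ε
    0<δ : 0ℚ ℚ.< δ
    0<δ = subst (ℚ._< δ) (ℚ.*-zeroʳ ½) (ℚ.*-monoʳ-<-pos ½ 0<ε)
    M = proj₁ (cx δ 0<δ)
    N = proj₁ (cy δ 0<δ)

  0<1 : 0ℚ ℚ.< 1ℚ
  0<1 = ℚ.positive⁻¹ 1ℚ

  eventually-bounded : ∀ x → IsCauchy x →
    ∃[ B ] (0ℚ ℚ.< B × ∃[ N ] (∀ n → N ℕ.≤ n → ∣ x n ∣ ℚ.≤ B))
  eventually-bounded x cx = ∣ x N ∣ ℚ.+ 1ℚ , 0<B , N , λ n N≤n → begin
      ∣ x n ∣                          ≡⟨ cong ∣_∣ (split (x n) (x N)) ⟩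
      ∣ x N ℚ.+ (x n - x N) ∣          ≤⟨ ℚ.∣p+q∣≤∣p∣+∣q∣ (x N) (x n - x N) ⟩
      ∣ x N ∣ ℚ.+ ∣ x n - x N ∣
        ≤⟨ ℚ.+-monoʳ-≤ ∣ x N ∣ (ℚ.<⇒≤ (proj₂ (cx 1ℚ 0<1) n N N≤n ℕ.≤-refl)) ⟩
      ∣ x N ∣ ℚ.+ 1ℚ                   ∎
    where
    open ℚ.≤-Reasoning
    open +-*-Solver
    split : ∀ a b → a ≡ b ℚ.+ (a - b)
    split = solve 2 (λ a b → a := b :+ (a :- b)) refl
    N = proj₁ (cx 1ℚ 0<1)
    0<B : 0ℚ ℚ.< ∣ x N ∣ ℚ.+ 1ℚ
    0<B = ℚ.+-mono-≤-< (ℚ.0≤∣p∣ (x N)) 0<1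

  divide : ∀ {C ε} → 0ℚ ℚ.< C → 0ℚ ℚ.< ε → ∃[ δ ] (0ℚ ℚ.< δ × C ℚ.* δ ≡ ε)
  divide {C} {ε} 0<C 0<ε = C⁻¹ ℚ.* ε
    , subst (ℚ._< C⁻¹ ℚ.* ε) (ℚ.*-zeroʳ C⁻¹) (ℚ.*-monoʳ-<-pos C⁻¹ {{C⁻¹-positive}} 0<ε)
    , trans (sym (ℚ.*-assoc C C⁻¹ ε))
        (trans (cong (ℚ._* ε) (ℚ.*-inverseʳ C {{C-nonZero}})) (ℚ.*-identityˡ ε))
    where
    C-positive = ℚ.positive 0<C
    C-nonZero = ℚ.pos⇒nonZero C {{C-positive}}
    C⁻¹ = (1/ C) {{C-nonZero}}
    C⁻¹-positive = ℚ.1/pos⇒pos C {{C-positive}}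

  product-bound : ∀ {C p q e} → 0ℚ ℚ.< C → ∣ p ∣ ℚ.≤ C → ∣ q ∣ ℚ.< e → ∣ p ℚ.* q ∣ ℚ.< C ℚ.* e
  product-bound {C} {p} {q} {e} 0<C p≤C q<e = begin-strict
    ∣ p ℚ.* q ∣       ≡⟨ ℚ.∣p*q∣≡∣p∣*∣q∣ p q ⟩
    ∣ p ∣ ℚ.* ∣ q ∣   ≤⟨ ℚ.*-monoʳ-≤-nonNeg ∣ q ∣ {{ℚ.nonNegative (ℚ.0≤∣p∣ q)}} p≤C ⟩
    C ℚ.* ∣ q ∣       <⟨ ℚ.*-monoʳ-<-pos C {{ℚ.positive 0<C}} q<e ⟩
    C ℚ.* e           ∎
    where open ℚ.≤-Reasoning

  *-cauchy : ∀ x y → IsCauchy x → IsCauchy y → IsCauchy (λ n → x n ℚ.* y n)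
  *-cauchy x y cx cy ε 0<ε =
    let A , 0<A , K , x≤A = eventually-bounded x cx
        B , 0<B , L , y≤B = eventually-bounded y cy
        δ , 0<δ , [A+B]δ≡ε = divide (ℚ.+-mono-< 0<A 0<B) 0<ε
        M , close-x = cx δ 0<δ
        N , close-y = cy δ 0<δ
    in (K ℕ.⊔ L) ℕ.⊔ (M ℕ.⊔ N) , λ m n ≤m ≤n →
      let K≤m   = ℕ.m⊔n≤o⇒m≤o K L (ℕ.m⊔n≤o⇒m≤o (K ℕ.⊔ L) (M ℕ.⊔ N) ≤m)
          L≤n   = ℕ.m⊔n≤o⇒n≤o K L (ℕ.m⊔n≤o⇒m≤o (K ℕ.⊔ L) (M ℕ.⊔ N) ≤n)
          M⊔N≤m = ℕ.m⊔n≤o⇒n≤o (K ℕ.⊔ L) (M ℕ.⊔ N) ≤m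
          M⊔N≤n = ℕ.m⊔n≤o⇒n≤o (K ℕ.⊔ L) (M ℕ.⊔ N) ≤n
          dx = close-x m n (ℕ.m⊔n≤o⇒m≤o M N M⊔N≤m) (ℕ.m⊔n≤o⇒m≤o M N M⊔N≤n)
          dy = close-y m n (ℕ.m⊔n≤o⇒n≤o M N M⊔N≤m) (ℕ.m⊔n≤o⇒n≤o M N M⊔N≤n)
      in begin-strict
      ∣ x m ℚ.* y m - x n ℚ.* y n ∣
        ≡⟨ cong ∣_∣ (regroup (x m) (y m) (x n) (y n)) ⟩
      ∣ x m ℚ.* (y m - y n) ℚ.+ y n ℚ.* (x m - x n) ∣
        ≤⟨ ℚ.∣p+q∣≤∣p∣+∣q∣ (x m ℚ.* (y m - y n)) (y n ℚ.* (x m - x n)) ⟩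
      ∣ x m ℚ.* (y m - y n) ∣ ℚ.+ ∣ y n ℚ.* (x m - x n) ∣
        <⟨ ℚ.+-mono-< (product-bound {p = x m} {q = y m - y n} 0<A (x≤A m K≤m) dy)
                      (product-bound {p = y n} {q = x m - x n} 0<B (y≤B n L≤n) dx) ⟩
      A ℚ.* δ ℚ.+ B ℚ.* δ
        ≡⟨ sym (ℚ.*-distribʳ-+ δ A B) ⟩
      (A ℚ.+ B) ℚ.* δ
        ≡⟨ [A+B]δ≡ε ⟩
      ε ∎
    where
    open ℚ.≤-Reasoning
    open +-*-Solver
    regroup : ∀ a b c d → a ℚ.* b - c ℚ.* d ≡ a ℚ.* (b - d) ℚ.+ d ℚ.* (a - c)
    regroup = solve 4 (λ a b c d → a :* b :- c :* d := a :* (b :- d) :+ d :* (a :- c)) refl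

_+_ : ℝ → ℝ → ℝ
x + y = mkℝ (λ n → seq x n ℚ.+ seq y n) (+-cauchy (seq x) (seq y) (cauchy x) (cauchy y))

_*_ : ℝ → ℝ → ℝ
x * y = mkℝ (λ n → seq x n ℚ.* seq y n) (*-cauchy (seq x) (seq y) (cauchy x) (cauchy y))

fromℚ : ℚ → ℝ
fromℚ p = mkℝ (λ _ → p) λ ε 0<ε →
  0 , λ _ _ _ _ → subst (λ d → ∣ d ∣ ℚ.< ε) (sym (ℚ.+-inverseʳ p)) 0<ε

fromℤ : ℤ → ℝ
fromℤ m = fromℚ (m ℚ./ 1)

fromℕ : ℕ → ℝ
fromℕ m = fromℤ (ℤ.+ m)

0ℝ : ℝ
0ℝ = fromℚ 0ℚ

+-0-rawMonoid : RawMonoid 0ℓ 0ℓ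
+-0-rawMonoid = record { Carrier = ℝ ; _≈_ = _≃_ ; _∙_ = _+_ ; ε = 0ℝ }

open RawMonoidDefinitions +-0-rawMonoid public using (sum)

Matrix : Set → ℕ → Set
Matrix A n = Fin n → Fin n → A

infixr 7 _*ᵥ_

_*ᵥ_ : ∀ {n} → Matrix ℝ n → Vector ℝ n → Vector ℝ n
(A *ᵥ v) i = sum λ j → A i j * v j

IsEigenvalue : ∀ {n} → Matrix ℝ n → ℝ → Set
IsEigenvalue {n} A μ = ∃[ v ] (¬ (∀ i → v i ≃ 0ℝ) × (∀ i → (A *ᵥ v) i ≃ μ * v i))

-- Hypergraphs on the vertex set Fin n. The edges form a set of subsets, so
-- the list enumerating them has no repetitions.

record Hypergraph (n : ℕ) : Set where
  field
    edges    : List (Subset n)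
    distinct : Unique edges

open Hypergraph public

adjacency : ∀ {n} → Hypergraph n → Matrix ℕ n
adjacency H i j with i Fin.≟ j
... | yes _ = 0
... | no  _ = length (filter (λ e → (i ∈? e) ×-dec (j ∈? e)) (edges H))

-- The adjacency matrix is symmetric, so all its eigenvalues are real.

Integral : ∀ {n} → Hypergraph n → Set
Integral H = ∀ μ → IsEigenvalue (λ i j → fromℕ (adjacency H i j)) μ →
  ∃[ m ] (μ ≃ fromℤ m)

-- The cyclic interval {j, j+1, …, j+k−1} of ℤ/n.

interval : ∀ {n} → ℕ → Fin n → Subset n
interval {n} k j = ⋃ (map (λ t → ⁅ (toℕ j ℕ.+ t) mod n ⁆) (upTo k))
  where instance _ = nonZeroIndex j

_≟ˢ_ : ∀ {n} → DecidableEquality (Subset n)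
_≟ˢ_ = Vec.≡-dec Bool._≟_

hypercycle : (n k : ℕ) → Hypergraph n
hypercycle n k = record
  { edges    = deduplicate _≟ˢ_ (map (interval k) (allFin n))
  ; distinct = UniqueDec.deduplicate-! _≟ˢ_ (map (interval k) (allFin n))
  }

{-# OPTIONS --safe #-}
module Submission where

-- Write A for the adjacency matrix of C_n^[k]. Then A + kI = ∑ₑ 1ₑ 1ₑᵀ is a product
-- of two truncated shift sums, and for every j the vector i ↦ sin (2πij/n) is an
-- eigenvector with eigenvalue N = sin² (πjk/n) / sin² (πj/n). Choose j coprime to n and
-- so close to n/2 that 2 sin² (πj/n) > 1, which is possible for n ≥ 3 unless n is 4 or 6.
-- If N is an integer, then 0 < N < 2, hence N = 1 and
--   0 = sin² (πjk/n) − sin² (πj/n) = sin (πj(k−1)/n) sin (πj(k+1)/n),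
-- so n divides k − 1 or k + 1, that is, k = n − 1.
--
-- Trigonometry is replaced by S i = sin (iπ/n) / sin (π/n), a Chebyshev polynomial in
-- 2 cos (π/n); this number is constructed by bisection as the largest root of the n-th
-- polynomial, on which the earlier polynomials are positive.
--
-- Conversely, if a polynomial with integer roots annihilates A + kI, then every real
-- eigenvalue is one of these roots. Constructively: w is apart from all integers but at
-- most one candidate m, and if it were apart from m too, the eigenvector would vanish;
-- tightness of apartness then gives w = m.

open import Defs
open import Data.Nat.Base using (ℕ; _≤_; _∸_)
open import Data.List.Base using ([]; _∷_)
open import Data.List.Membership.Propositional using (_∈_)
open import Data.Product.Base using (_,_)
open import Data.Sum.Base using (_⊎_)
open import Function.Bundles using (_⇔_)
open import Relation.Binary.PropositionalEquality using (_≡_)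

open import Algebra.Bundles using (CommutativeMonoid; CommutativeRing)
import Algebra.Properties.CommutativeMonoid.Sum as Sum
import Algebra.Properties.Semiring.Sum as SemiringSum
open import Algebra.Structures using (IsCommutativeRing)
open import Data.Empty using (⊥; ⊥-elim)
open import Data.Fin.Base as Fin using (Fin; toℕ; fromℕ<)
import Data.Fin.Permutation as Perm
import Data.Fin.Properties as Fin
open import Data.Fin.Subset using (Subset; ⁅_⁆; ⋃) renaming (_∈_ to _∈ˢ_)
open import Data.Fin.Subset.Properties using (_∈?_; x∈p∪q⁺; x∈p∪q⁻; x∈⁅x⁆; x∈⁅y⁆⇒x≡y; ∉⊥)
open import Data.Integer.Base as ℤ using (ℤ)
import Data.Integer.Properties as ℤ
open import Data.List.Base using (List; map; filter; length; upTo; deduplicate; tabulate)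
open import Data.List.Membership.Propositional.Properties using (∈-upTo⁺; ∈-upTo⁻)
open import Data.List.Properties using (filter-all; map-tabulate)
open import Data.List.Relation.Unary.All as All using (All; []; _∷_)
open import Data.List.Relation.Unary.AllPairs using ([]; _∷_)
open import Data.List.Relation.Unary.Any using (here; there)
open import Data.List.Relation.Unary.Unique.Propositional using (Unique)
import Data.List.Relation.Unary.Unique.Propositional.Properties as Unique
open import Data.Nat.Base using (zero; suc)
import Data.Nat.Base as ℕ
import Data.Nat.Coprimality as Coprimality
open import Data.Nat.Divisibility using (_∣_)
import Data.Nat.Divisibility as ℕ
open import Data.Nat.DivMod using (_mod_; _%_; m%n<n; m<n⇒m%n≡m; m%n%n≡m%n; [m+n]%n≡m%n; %-distribˡ-+)
import Data.Nat.DivMod as ℕ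
import Data.Nat.Properties as ℕ
open import Data.Nat.Solver using () renaming (module +-*-Solver to ℕSolver)
open import Data.Product.Base using (∃-syntax; _×_; proj₁; proj₂)
open import Data.Rational.Base as ℚ using (ℚ; 0ℚ; 1ℚ; ½; ∣_∣; 1/_)
import Data.Rational.Properties as ℚ
open import Data.Rational.Solver using () renaming (module +-*-Solver to ℚSolver)
import Data.Rational.Unnormalised.Base as ℚᵘ
import Data.Rational.Unnormalised.Properties as ℚᵘ
open import Data.Sum.Base using (inj₁; inj₂)
import Data.Sum.Base as ⊎
open import Data.Vec.Base using (Vec; []; _∷_; lookup)
open import Data.Vec.Functional using (Vector)
open import Function.Base using (_∘_)
open import Function.Bundles using (mk⇔)
open import Level using (0ℓ)
open import Relation.Binary.Definitions using (tri<; tri≈; tri>)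
open import Relation.Binary.PropositionalEquality
  using (_≢_; refl; sym; trans; cong; cong₂; subst; subst₂)
import Relation.Binary.Reasoning.Setoid as SetoidReasoning
open import Relation.Nullary using (¬_; Dec; yes; no)
open import Relation.Nullary.Decidable using (_×-dec_; ¬?; True; toWitness; from-yes; from-no)

-- Coprimality of j and n keeps sin (πji/n) nonzero whenever n does not divide i. This gives N > 0,
-- and it makes both factors of the final product nonzero unless n divides k - 1 or k + 1. The bound
-- N < 2 comes from sin² ≤ 1 < 2 sin² (πj/n). For n = 4 and n = 6 the only residues coprime to n are
-- ±1, and sin² (π/n) is 1/2 and 1/4, too small. All trigonometry is drawn from one identity,
-- `S-product`: periodicity, reflection and sums over arithmetic progressions are consequences of
-- it. Order on Cauchy reals is undecidable, so nonvanishing is recorded as a positive rational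
-- lower bound, usually on a square, and quotients such as N are handled by cancelling a positive
-- factor.

≤-difference : ∀ {p q} d → 0ℚ ℚ.≤ d → p ℚ.+ d ≡ q → p ℚ.≤ q
≤-difference {p} {q} d 0≤d p+d≡q = subst₂ ℚ._≤_ (ℚ.+-identityʳ p) p+d≡q (ℚ.+-monoʳ-≤ p 0≤d)

-- As with `≤-difference`, an order goal is split into a sign condition on an explicit difference
-- and a ring identity for the solver.
<-difference : ∀ {p q} d → 0ℚ ℚ.< d → p ℚ.+ d ≡ q → p ℚ.< q
<-difference {p} {q} d 0<d p+d≡q = subst₂ ℚ._<_ (ℚ.+-identityʳ p) p+d≡q (ℚ.+-monoʳ-< p 0<d)

p≤q⇒0≤q-p : ∀ {p q} → p ℚ.≤ q → 0ℚ ℚ.≤ q ℚ.- p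
p≤q⇒0≤q-p {p} {q} p≤q = subst (ℚ._≤ q ℚ.- p) (ℚ.+-inverseʳ p) (ℚ.+-monoˡ-≤ (ℚ.- p) p≤q)

p<q⇒0<q-p : ∀ {p q} → p ℚ.< q → 0ℚ ℚ.< q ℚ.- p
p<q⇒0<q-p {p} {q} p<q = subst (ℚ._< q ℚ.- p) (ℚ.+-inverseʳ p) (ℚ.+-monoˡ-< (ℚ.- p) p<q)

0<p*q : ∀ {p q} → 0ℚ ℚ.< p → 0ℚ ℚ.< q → 0ℚ ℚ.< p ℚ.* q
0<p*q {p} {q} 0<p 0<q =
  ℚ.positive⁻¹ (p ℚ.* q) {{ℚ.pos*pos⇒pos p {{ℚ.positive 0<p}} q {{ℚ.positive 0<q}}}}

0≤p*q : ∀ {p q} → 0ℚ ℚ.≤ p → 0ℚ ℚ.≤ q → 0ℚ ℚ.≤ p ℚ.* q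
0≤p*q {p} {q} 0≤p 0≤q =
  ℚ.nonNegative⁻¹ (p ℚ.* q) {{ℚ.nonNeg*nonNeg⇒nonNeg p {{ℚ.nonNegative 0≤p}} q {{ℚ.nonNegative 0≤q}}}}

0<½ : 0ℚ ℚ.< ½
0<½ = ℚ.positive⁻¹ ½

0<1 : 0ℚ ℚ.< 1ℚ
0<1 = ℚ.positive⁻¹ 1ℚ

½p+½p : ∀ p → ½ ℚ.* p ℚ.+ ½ ℚ.* p ≡ p
½p+½p = solve 1 (λ p → con ½ :* p :+ con ½ :* p := p) refl where open ℚSolver

p≤∣p∣ : ∀ p → p ℚ.≤ ∣ p ∣
p≤∣p∣ p with ℚ.≤-total 0ℚ p
... | inj₁ 0≤p = ℚ.≤-reflexive (sym (ℚ.0≤p⇒∣p∣≡p 0≤p))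
... | inj₂ p≤0 = ℚ.≤-trans p≤0 (ℚ.0≤∣p∣ p)

-∣p∣≤p : ∀ p → ℚ.- ∣ p ∣ ℚ.≤ p
-∣p∣≤p p = subst (ℚ.- ∣ p ∣ ℚ.≤_) (neg-involutive p)
  (ℚ.neg-antimono-≤ (subst (ℚ.- p ℚ.≤_) (ℚ.∣-p∣≡∣p∣ p) (p≤∣p∣ (ℚ.- p))))
  where
  open ℚSolver
  neg-involutive : ∀ p → ℚ.- (ℚ.- p) ≡ p
  neg-involutive = solve 1 (λ p → :- (:- p) := p) refl

∣-∣-bound : ∀ {p r} → p ℚ.≤ r → ℚ.- p ℚ.≤ r → ∣ p ∣ ℚ.≤ r
∣-∣-bound {p} p≤r -p≤r with ℚ.∣p∣≡p∨∣p∣≡-p p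
... | inj₁ eq = subst (ℚ._≤ _) (sym eq) p≤r
... | inj₂ eq = subst (ℚ._≤ _) (sym eq) -p≤r

∣p-q∣≡∣q-p∣ : ∀ p q → ∣ p ℚ.- q ∣ ≡ ∣ q ℚ.- p ∣
∣p-q∣≡∣q-p∣ p q = trans (sym (ℚ.∣-p∣≡∣p∣ (p ℚ.- q)))
  (cong ∣_∣ (solve 2 (λ p q → :- (p :- q) := q :- p) refl p q))
  where open ℚSolver

∣p-q∣<ε⇒q-ε<p : ∀ {p q ε} → ∣ p ℚ.- q ∣ ℚ.< ε → q ℚ.- ε ℚ.< p
∣p-q∣<ε⇒q-ε<p {p} {q} {ε} close = <-difference ((ε ℚ.- ∣ p ℚ.- q ∣) ℚ.+ ((p ℚ.- q) ℚ.- (ℚ.- ∣ p ℚ.- q ∣)))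
  (ℚ.+-mono-<-≤ (p<q⇒0<q-p close) (p≤q⇒0≤q-p (-∣p∣≤p (p ℚ.- q))))
  (solve 4 (λ p q ε a → (q :- ε) :+ ((ε :- a) :+ ((p :- q) :- (:- a))) := p) refl p q ε ∣ p ℚ.- q ∣)
  where open ℚSolver

∣p-q∣<ε⇒p<q+ε : ∀ {p q ε} → ∣ p ℚ.- q ∣ ℚ.< ε → p ℚ.< q ℚ.+ ε
∣p-q∣<ε⇒p<q+ε {p} {q} {ε} close = <-difference ((ε ℚ.- ∣ p ℚ.- q ∣) ℚ.+ (∣ p ℚ.- q ∣ ℚ.- (p ℚ.- q)))
  (ℚ.+-mono-<-≤ (p<q⇒0<q-p close) (p≤q⇒0≤q-p (p≤∣p∣ (p ℚ.- q))))
  (solve 4 (λ p q ε a → p :+ ((ε :- a) :+ (a :- (p :- q))) := q :+ ε) refl p q ε ∣ p ℚ.- q ∣)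
  where open ℚSolver

-- The ring of Cauchy reals

-- `x ≃ y` unfolds to `Null` of the termwise difference, so closure of null sequences under sums,
-- negation and bounded factors yields the equivalence and congruence laws.
Null : (ℕ → ℚ) → Set
Null f = ∀ ε → 0ℚ ℚ.< ε → ∃[ N ] (∀ n → N ≤ n → ∣ f n ∣ ℚ.< ε)

Null-resp : ∀ {f g} → (∀ n → f n ≡ g n) → Null f → Null g
Null-resp f≗g null ε 0<ε = let N , small = null ε 0<ε in
  N , λ n N≤n → subst (λ p → ∣ p ∣ ℚ.< ε) (f≗g n) (small n N≤n)

Null-0 : Null (λ _ → 0ℚ)
Null-0 ε 0<ε = 0 , λ _ _ → 0<ε

Null-+ : ∀ {f g} → Null f → Null g → Null (λ n → f n ℚ.+ g n)
Null-+ {f} {g} null-f null-g ε 0<ε =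
  let δ = ½ ℚ.* ε
      0<δ = 0<p*q 0<½ 0<ε
      M , small-f = null-f δ 0<δ
      N , small-g = null-g δ 0<δ
  in M ℕ.⊔ N , λ n ≤n → subst (∣ f n ℚ.+ g n ∣ ℚ.<_) (½p+½p ε)
    (ℚ.≤-<-trans (ℚ.∣p+q∣≤∣p∣+∣q∣ (f n) (g n))
      (ℚ.+-mono-< (small-f n (ℕ.m⊔n≤o⇒m≤o M N ≤n)) (small-g n (ℕ.m⊔n≤o⇒n≤o M N ≤n))))

Null-neg : ∀ {f} → Null f → Null (λ n → ℚ.- f n)
Null-neg {f} null ε 0<ε = let N , small = null ε 0<ε in
  N , λ n N≤n → subst (ℚ._< ε) (sym (ℚ.∣-p∣≡∣p∣ (f n))) (small n N≤n)

Bounded : (ℕ → ℚ) → Set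
Bounded f = ∃[ B ] (0ℚ ℚ.< B × ∃[ N ] (∀ n → N ≤ n → ∣ f n ∣ ℚ.≤ B))

cauchy⇒bounded : ∀ x → Bounded (seq x)
cauchy⇒bounded x = ∣ seq x N ∣ ℚ.+ 1ℚ , ℚ.+-mono-≤-< (ℚ.0≤∣p∣ (seq x N)) 0<1 , N , λ n N≤n → begin
    ∣ seq x n ∣                                 ≡⟨ cong ∣_∣ (split (seq x n) (seq x N)) ⟩
    ∣ seq x N ℚ.+ (seq x n ℚ.- seq x N) ∣       ≤⟨ ℚ.∣p+q∣≤∣p∣+∣q∣ (seq x N) (seq x n ℚ.- seq x N) ⟩
    ∣ seq x N ∣ ℚ.+ ∣ seq x n ℚ.- seq x N ∣     ≤⟨ ℚ.+-monoʳ-≤ ∣ seq x N ∣ (ℚ.<⇒≤ (close n N N≤n ℕ.≤-refl)) ⟩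
    ∣ seq x N ∣ ℚ.+ 1ℚ                          ∎
  where
  open ℚ.≤-Reasoning
  open ℚSolver
  split : ∀ a b → a ≡ b ℚ.+ (a ℚ.- b)
  split = solve 2 (λ a b → a := b :+ (a :- b)) refl
  N = proj₁ (cauchy x 1ℚ 0<1)
  close = proj₂ (cauchy x 1ℚ 0<1)

divide : ∀ {C ε} → 0ℚ ℚ.< C → 0ℚ ℚ.< ε → ∃[ δ ] (0ℚ ℚ.< δ × C ℚ.* δ ≡ ε)
divide {C} {ε} 0<C 0<ε = C⁻¹ ℚ.* ε
  , 0<p*q (ℚ.positive⁻¹ C⁻¹ {{ℚ.1/pos⇒pos C {{C-positive}}}}) 0<ε
  , trans (sym (ℚ.*-assoc C C⁻¹ ε))
      (trans (cong (ℚ._* ε) (ℚ.*-inverseʳ C {{C-nonZero}})) (ℚ.*-identityˡ ε))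
  where
  C-positive = ℚ.positive 0<C
  C-nonZero = ℚ.pos⇒nonZero C {{C-positive}}
  C⁻¹ = (1/ C) {{C-nonZero}}

Null-* : ∀ {f g} → Bounded f → Null g → Null (λ n → f n ℚ.* g n)
Null-* {f} {g} (B , 0<B , M , f≤B) null ε 0<ε =
  let δ , 0<δ , Bδ≡ε = divide 0<B 0<ε
      N , small = null δ 0<δ
  in M ℕ.⊔ N , λ n ≤n → begin-strict
    ∣ f n ℚ.* g n ∣       ≡⟨ ℚ.∣p*q∣≡∣p∣*∣q∣ (f n) (g n) ⟩
    ∣ f n ∣ ℚ.* ∣ g n ∣   ≤⟨ ℚ.*-monoʳ-≤-nonNeg ∣ g n ∣ {{ℚ.nonNegative (ℚ.0≤∣p∣ (g n))}} (f≤B n (ℕ.m⊔n≤o⇒m≤o M N ≤n)) ⟩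
    B ℚ.* ∣ g n ∣         <⟨ ℚ.*-monoʳ-<-pos B {{ℚ.positive 0<B}} (small n (ℕ.m⊔n≤o⇒n≤o M N ≤n)) ⟩
    B ℚ.* δ               ≡⟨ Bδ≡ε ⟩
    ε                     ∎
  where open ℚ.≤-Reasoning

infix 4 _≈_

-- A record, so that the endpoints of an equation can be inferred from its type.
record _≈_ (x y : ℝ) : Set where
  constructor equal
  field null-difference : x ≃ y

open _≈_

pointwise : ∀ {x y} → (∀ n → seq x n ≡ seq y n) → x ≈ y
pointwise {x} {y} x≗y = equal (Null-resp
  (λ n → sym (trans (cong (ℚ._- seq y n) (x≗y n)) (ℚ.+-inverseʳ (seq y n)))) Null-0)

infixl 6 _⊕_
infixl 7 _⊗_
infix  8 ⊖_

-- The operations of Defs, made opaque: otherwise the conversion checker compares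
-- the proofs of the Cauchy property.
opaque

  _⊕_ : ℝ → ℝ → ℝ
  _⊕_ = _+_

  _⊗_ : ℝ → ℝ → ℝ
  _⊗_ = _*_

  𝟘 : ℝ
  𝟘 = 0ℝ

  𝟙 : ℝ
  𝟙 = fromℚ 1ℚ

  ⊖_ : ℝ → ℝ
  ⊖ x = mkℝ (λ n → ℚ.- seq x n) λ ε 0<ε → let N , close = cauchy x ε 0<ε in
    N , λ m n N≤m N≤n → subst (ℚ._< ε)
      (trans (sym (ℚ.∣-p∣≡∣p∣ (seq x m ℚ.- seq x n))) (cong ∣_∣ (negate (seq x m) (seq x n))))
      (close m n N≤m N≤n)
    where
    open ℚSolver
    negate : ∀ a b → ℚ.- (a ℚ.- b) ≡ ℚ.- a ℚ.- (ℚ.- b)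
    negate = solve 2 (λ a b → :- (a :- b) := :- a :- (:- b)) refl

  seq-⊕ : ∀ x y n → seq (x ⊕ y) n ≡ seq x n ℚ.+ seq y n
  seq-⊕ x y n = refl

  seq-⊗ : ∀ x y n → seq (x ⊗ y) n ≡ seq x n ℚ.* seq y n
  seq-⊗ x y n = refl

  seq-⊖ : ∀ x n → seq (⊖ x) n ≡ ℚ.- seq x n
  seq-⊖ x n = refl

  seq-𝟘 : ∀ n → seq 𝟘 n ≡ 0ℚ
  seq-𝟘 n = refl

  seq-𝟙 : ∀ n → seq 𝟙 n ≡ 1ℚ
  seq-𝟙 n = refl

opaque
  unfolding _⊕_

  ℝ-isCommutativeRing : IsCommutativeRing _≈_ _⊕_ _⊗_ ⊖_ 𝟘 𝟙
  ℝ-isCommutativeRing = record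
    { isRing = record
      { +-isAbelianGroup = record
        { isGroup = record
          { isMonoid = record
            { isSemigroup = record
              { isMagma = record
                { isEquivalence = record
                  { refl = λ {x} → pointwise (λ _ → refl)
                  ; sym = λ {x} {y} (equal x≈y) → equal (Null-resp (λ n → negate (seq x n) (seq y n)) (Null-neg x≈y))
                  ; trans = λ {x} {y} {z} (equal x≈y) (equal y≈z) →
                      equal (Null-resp (λ n → chain (seq x n) (seq y n) (seq z n)) (Null-+ x≈y y≈z))
                  }
                ; ∙-cong = λ {x} {x′} {y} {y′} (equal x≈x′) (equal y≈y′) → equal (Null-resp
                    (λ n → +-split (seq x n) (seq x′ n) (seq y n) (seq y′ n)) (Null-+ x≈x′ y≈y′))
                }
              ; assoc = λ x y z → pointwise
                  λ n → ℚ.+-assoc (seq x n) (seq y n) (seq z n)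
              }
            ; identity = (λ x → pointwise λ n → ℚ.+-identityˡ (seq x n))
                       , (λ x → pointwise λ n → ℚ.+-identityʳ (seq x n))
            }
          ; inverse = (λ x → pointwise λ n → ℚ.+-inverseˡ (seq x n))
                    , (λ x → pointwise λ n → ℚ.+-inverseʳ (seq x n))
          ; ⁻¹-cong = λ {x} {y} (equal x≈y) → equal (Null-resp (λ n → negate′ (seq x n) (seq y n)) (Null-neg x≈y))
          }
        ; comm = λ x y → pointwise λ n → ℚ.+-comm (seq x n) (seq y n)
        }
      ; *-cong = λ {x} {x′} {y} {y′} (equal x≈x′) (equal y≈y′) → equal (Null-resp
          (λ n → *-split (seq x n) (seq x′ n) (seq y n) (seq y′ n))
          (Null-+ (Null-* (cauchy⇒bounded y) x≈x′) (Null-* (cauchy⇒bounded x′) y≈y′)))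
      ; *-assoc = λ x y z → pointwise
          λ n → ℚ.*-assoc (seq x n) (seq y n) (seq z n)
      ; *-identity = (λ x → pointwise λ n → ℚ.*-identityˡ (seq x n))
                   , (λ x → pointwise λ n → ℚ.*-identityʳ (seq x n))
      ; distrib = (λ x y z → pointwise
                    λ n → ℚ.*-distribˡ-+ (seq x n) (seq y n) (seq z n))
                , (λ x y z → pointwise
                    λ n → ℚ.*-distribʳ-+ (seq x n) (seq y n) (seq z n))
      }
    ; *-comm = λ x y → pointwise λ n → ℚ.*-comm (seq x n) (seq y n)
    }
    where
    open ℚSolver
    negate : ∀ a b → ℚ.- (a ℚ.- b) ≡ b ℚ.- a
    negate = solve 2 (λ a b → :- (a :- b) := b :- a) refl
    negate′ : ∀ a b → ℚ.- (a ℚ.- b) ≡ ℚ.- a ℚ.- (ℚ.- b)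
    negate′ = solve 2 (λ a b → :- (a :- b) := :- a :- (:- b)) refl
    chain : ∀ a b c → (a ℚ.- b) ℚ.+ (b ℚ.- c) ≡ a ℚ.- c
    chain = solve 3 (λ a b c → (a :- b) :+ (b :- c) := a :- c) refl
    +-split : ∀ a a′ b b′ → (a ℚ.- a′) ℚ.+ (b ℚ.- b′) ≡ (a ℚ.+ b) ℚ.- (a′ ℚ.+ b′)
    +-split = solve 4 (λ a a′ b b′ → (a :- a′) :+ (b :- b′) := (a :+ b) :- (a′ :+ b′)) refl
    *-split : ∀ a a′ b b′ → b ℚ.* (a ℚ.- a′) ℚ.+ a′ ℚ.* (b ℚ.- b′) ≡ a ℚ.* b ℚ.- a′ ℚ.* b′
    *-split = solve 4 (λ a a′ b b′ → b :* (a :- a′) :+ a′ :* (b :- b′) := a :* b :- a′ :* b′) refl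

ℝ-commutativeRing : CommutativeRing 0ℓ 0ℓ
ℝ-commutativeRing = record { isCommutativeRing = ℝ-isCommutativeRing }

open CommutativeRing ℝ-commutativeRing using (semiring; setoid)
  renaming ( -‿cong to ⊖-cong; refl to ≈-refl; sym to ≈-sym; trans to ≈-trans; +-cong to ⊕-cong; +-congˡ to ⊕-congˡ; +-congʳ to ⊕-congʳ
           ; *-cong to ⊗-cong; *-congˡ to ⊗-congˡ; *-congʳ to ⊗-congʳ; zeroˡ to ⊗-zeroˡ; zeroʳ to ⊗-zeroʳ
           ; +-assoc to ⊕-assoc; +-comm to ⊕-comm; *-assoc to ⊗-assoc; *-comm to ⊗-comm
           ; +-identityˡ to ⊕-identityˡ; +-identityʳ to ⊕-identityʳ
           ; *-identityˡ to ⊗-identityˡ; *-identityʳ to ⊗-identityʳ )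

⊗-swap : ∀ x y z → x ⊗ (y ⊗ z) ≈ y ⊗ (x ⊗ z)
⊗-swap x y z = ≈-trans (≈-sym (⊗-assoc x y z)) (≈-trans (⊗-congʳ (⊗-comm x y)) (⊗-assoc y x z))

-- Strict positivity carries a rational lower bound for a tail of the sequence; cancellation divides
-- by this bound.
record Pos (x : ℝ) : Set where
  constructor eventually
  field
    bound          : ℚ
    bound-positive : 0ℚ ℚ.< bound
    start          : ℕ
    bounded-below  : ∀ n → start ≤ n → bound ℚ.≤ seq x n

pos-resp-≈ : ∀ {x y} → x ≈ y → Pos x → Pos y
pos-resp-≈ {x} {y} (equal x≃y) (eventually ε 0<ε M ε≤x) =
  let δ = ½ ℚ.* ε
      0<δ = 0<p*q 0<½ 0<ε
      N , close = x≃y δ 0<δ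
  in eventually δ 0<δ (M ℕ.⊔ N) λ n ≤n → ≤-difference
    ((seq x n ℚ.- ε) ℚ.+ ((seq y n ℚ.+ δ) ℚ.- seq x n))
    (ℚ.+-mono-≤ (p≤q⇒0≤q-p (ε≤x n (ℕ.m⊔n≤o⇒m≤o M N ≤n)))
                (p≤q⇒0≤q-p (ℚ.<⇒≤ (∣p-q∣<ε⇒p<q+ε {seq x n} {seq y n} (close n (ℕ.m⊔n≤o⇒n≤o M N ≤n))))))
    (collect (seq x n) (seq y n) ε)
  where
  open ℚSolver
  collect : ∀ a b ε → ½ ℚ.* ε ℚ.+ ((a ℚ.- ε) ℚ.+ ((b ℚ.+ ½ ℚ.* ε) ℚ.- a)) ≡ b
  collect = solve 3 (λ a b ε → con ½ :* ε :+ ((a :- ε) :+ ((b :+ con ½ :* ε) :- a)) := b) refl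

opaque
  unfolding _⊕_

  pos-+ : ∀ {x y} → Pos x → Pos y → Pos (x ⊕ y)
  pos-+ (eventually ε 0<ε M ε≤x) (eventually δ 0<δ N δ≤y) =
    eventually (ε ℚ.+ δ) (ℚ.+-mono-< 0<ε 0<δ) (M ℕ.⊔ N)
      λ n ≤n → ℚ.+-mono-≤ (ε≤x n (ℕ.m⊔n≤o⇒m≤o M N ≤n)) (δ≤y n (ℕ.m⊔n≤o⇒n≤o M N ≤n))

  pos-* : ∀ {x y} → Pos x → Pos y → Pos (x ⊗ y)
  pos-* {x} {y} (eventually ε 0<ε M ε≤x) (eventually δ 0<δ N δ≤y) =
    eventually (ε ℚ.* δ) (0<p*q 0<ε 0<δ) (M ℕ.⊔ N) λ n ≤n → ℚ.≤-trans
      (ℚ.*-monoʳ-≤-nonNeg δ {{ℚ.nonNegative (ℚ.<⇒≤ 0<δ)}} (ε≤x n (ℕ.m⊔n≤o⇒m≤o M N ≤n)))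
      (ℚ.*-monoˡ-≤-nonNeg (seq x n)
         {{ℚ.nonNegative (ℚ.≤-trans (ℚ.<⇒≤ 0<ε) (ε≤x n (ℕ.m⊔n≤o⇒m≤o M N ≤n)))}}
         (δ≤y n (ℕ.m⊔n≤o⇒n≤o M N ≤n)))

  ¬pos-0 : ∀ {x} → x ≈ 𝟘 → ¬ Pos x
  ¬pos-0 x≈0 pos-x = let eventually ε 0<ε N ε≤0 = pos-resp-≈ x≈0 pos-x in
    ℚ.<-irrefl refl (ℚ.<-≤-trans 0<ε (ε≤0 N ℕ.≤-refl))

  -- At an index where both tails have begun, the claim is an inequality between rationals, so a
  -- sign can be read off a statement about reals.
  pos-fromℚ-factor : ∀ {p y} → Pos y → Pos (fromℚ p ⊗ y) → 0ℚ ℚ.< p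
  pos-fromℚ-factor {p} {y} (eventually δ 0<δ M δ≤y) (eventually ε 0<ε N ε≤py) =
    ℚ.*-cancelʳ-<-nonNeg (seq y n) {{ℚ.nonNegative (ℚ.≤-trans (ℚ.<⇒≤ 0<δ) (δ≤y n (ℕ.m≤m⊔n M N)))}}
      (subst (ℚ._< p ℚ.* seq y n) (sym (ℚ.*-zeroˡ (seq y n)))
        (ℚ.<-≤-trans 0<ε (ε≤py n (ℕ.m≤n⊔m M N))))
    where
    n : ℕ
    n = M ℕ.⊔ N

  -- No inverse of `x` is constructed: once `x` is at least δ, a difference of the products below δε
  -- forces `y` and `z` to within ε.
  pos-cancel-≈ : ∀ {x y z} → Pos x → x ⊗ y ≈ x ⊗ z → y ≈ z
  pos-cancel-≈ {x} {y} {z} (eventually δ 0<δ M δ≤x) (equal xy≃xz) = equal λ ε 0<ε →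
    let N , small = xy≃xz (δ ℚ.* ε) (0<p*q 0<δ 0<ε)
    in M ℕ.⊔ N , λ n ≤n → ℚ.*-cancelˡ-<-nonNeg δ {{ℚ.nonNegative (ℚ.<⇒≤ 0<δ)}} (begin-strict
      δ ℚ.* ∣ seq y n ℚ.- seq z n ∣
        ≤⟨ ℚ.*-monoʳ-≤-nonNeg ∣ seq y n ℚ.- seq z n ∣ {{ℚ.nonNegative (ℚ.0≤∣p∣ (seq y n ℚ.- seq z n))}}
             (ℚ.≤-trans (δ≤x n (ℕ.m⊔n≤o⇒m≤o M N ≤n)) (p≤∣p∣ (seq x n))) ⟩
      ∣ seq x n ∣ ℚ.* ∣ seq y n ℚ.- seq z n ∣
        ≡⟨ sym (ℚ.∣p*q∣≡∣p∣*∣q∣ (seq x n) (seq y n ℚ.- seq z n)) ⟩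
      ∣ seq x n ℚ.* (seq y n ℚ.- seq z n) ∣
        ≡⟨ cong ∣_∣ (distrib (seq x n) (seq y n) (seq z n)) ⟩
      ∣ seq x n ℚ.* seq y n ℚ.- seq x n ℚ.* seq z n ∣
        <⟨ small n (ℕ.m⊔n≤o⇒n≤o M N ≤n) ⟩
      δ ℚ.* ε ∎)
    where
    open ℚ.≤-Reasoning
    open ℚSolver
    distrib : ∀ a b c → a ℚ.* (b ℚ.- c) ≡ a ℚ.* b ℚ.- a ℚ.* c
    distrib = solve 3 (λ a b c → a :* (b :- c) := a :* b :- a :* c) refl

0≤p² : ∀ p → 0ℚ ℚ.≤ p ℚ.* p
0≤p² p with ℚ.≤-total 0ℚ p
... | inj₁ 0≤p = 0≤p*q 0≤p 0≤p
... | inj₂ p≤0 = ℚ.nonNegative⁻¹ (p ℚ.* p)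
  {{ℚ.nonPos*nonPos⇒nonPos p {{ℚ.nonPositive p≤0}} p {{ℚ.nonPositive p≤0}}}}

opaque
  unfolding _⊕_

  pos-² : ∀ {x δ N} → 0ℚ ℚ.< δ → (∀ n → N ≤ n → δ ℚ.≤ ∣ seq x n ∣) → Pos (x ⊗ x)
  pos-² {x} {δ} {N} 0<δ δ≤∣x∣ = eventually (δ ℚ.* δ) (0<p*q 0<δ 0<δ) N λ n N≤n → begin
      δ ℚ.* δ
        ≤⟨ ℚ.*-monoʳ-≤-nonNeg δ {{ℚ.nonNegative (ℚ.<⇒≤ 0<δ)}} (δ≤∣x∣ n N≤n) ⟩
      ∣ seq x n ∣ ℚ.* δ
        ≤⟨ ℚ.*-monoˡ-≤-nonNeg ∣ seq x n ∣ {{ℚ.nonNegative (ℚ.0≤∣p∣ (seq x n))}} (δ≤∣x∣ n N≤n) ⟩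
      ∣ seq x n ∣ ℚ.* ∣ seq x n ∣
        ≡⟨ sym (ℚ.∣p*q∣≡∣p∣*∣q∣ (seq x n) (seq x n)) ⟩
      ∣ seq x n ℚ.* seq x n ∣
        ≡⟨ ℚ.0≤p⇒∣p∣≡p (0≤p² (seq x n)) ⟩
      seq x n ℚ.* seq x n ∎
    where open ℚ.≤-Reasoning

  -- Equality of Cauchy reals is tight with respect to apartness, here expressed by x² > 0.
  tight : ∀ {x} → ¬ Pos (x ⊗ x) → x ≈ 𝟘
  tight {x} ¬pos = equal x-small
    where
    open ℚSolver
    split : ∀ a b → a ℚ.- 0ℚ ≡ b ℚ.+ (a ℚ.- b)
    split = solve 2 (λ a b → a :- con 0ℚ := b :+ (a :- b)) refl
    three-quarters : ∀ ε → ½ ℚ.* ε ℚ.+ ½ ℚ.* (½ ℚ.* ε) ℚ.+ ½ ℚ.* (½ ℚ.* ε) ≡ ε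
    three-quarters = solve 1 (λ ε → con ½ :* ε :+ con ½ :* (con ½ :* ε) :+ con ½ :* (con ½ :* ε) := ε) refl
    collect : ∀ ε a b c → ½ ℚ.* (½ ℚ.* ε) ℚ.+
      (((a ℚ.+ c) ℚ.- b) ℚ.+ ((½ ℚ.* (½ ℚ.* ε) ℚ.- c) ℚ.+ (b ℚ.- ½ ℚ.* ε))) ≡ a
    collect = solve 4 (λ ε a b c → con ½ :* (con ½ :* ε) :+
      (((a :+ c) :- b) :+ ((con ½ :* (con ½ :* ε) :- c) :+ (b :- con ½ :* ε))) := a) refl
    away : ∀ ε a b c → b ℚ.≤ a ℚ.+ c → c ℚ.≤ ½ ℚ.* (½ ℚ.* ε) → ½ ℚ.* ε ℚ.≤ b → ½ ℚ.* (½ ℚ.* ε) ℚ.≤ a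
    away ε a b c b≤a+c c≤ ≤b = ≤-difference
      (((a ℚ.+ c) ℚ.- b) ℚ.+ ((½ ℚ.* (½ ℚ.* ε) ℚ.- c) ℚ.+ (b ℚ.- ½ ℚ.* ε)))
      (ℚ.+-mono-≤ (p≤q⇒0≤q-p b≤a+c) (ℚ.+-mono-≤ (p≤q⇒0≤q-p c≤) (p≤q⇒0≤q-p ≤b)))
      (collect ε a b c)
    join : ∀ a b → a ℚ.+ (b ℚ.- a) ≡ b
    join = solve 2 (λ a b → a :+ (b :- a) := b) refl
    triangle : ∀ m n → ∣ seq x m ∣ ℚ.≤ ∣ seq x n ∣ ℚ.+ ∣ seq x m ℚ.- seq x n ∣
    triangle m n = subst (λ p → ∣ p ∣ ℚ.≤ ∣ seq x n ∣ ℚ.+ ∣ seq x m ℚ.- seq x n ∣)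
      (join (seq x n) (seq x m)) (ℚ.∣p+q∣≤∣p∣+∣q∣ (seq x n) (seq x m ℚ.- seq x n))
    x-small : ∀ ε → 0ℚ ℚ.< ε → ∃[ N ] (∀ n → N ≤ n → ∣ seq x n ℚ.- seq 𝟘 n ∣ ℚ.< ε)
    -- From `N` on the sequence varies by less than ε/4. Comparing a single term with ε/2 leaves
    -- either a tail below 3ε/4 or a tail of absolute value at least ε/4; the latter would make the
    -- square positive.
    x-small ε 0<ε = decide (∣ seq x N ∣ ℚ.<? ½ ℚ.* ε)
      where
      0<δ : 0ℚ ℚ.< ½ ℚ.* (½ ℚ.* ε)
      0<δ = 0<p*q {½} {½ ℚ.* ε} 0<½ (0<p*q {½} {ε} 0<½ 0<ε)
      N : ℕ
      N = proj₁ (cauchy x (½ ℚ.* (½ ℚ.* ε)) 0<δ)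
      close : ∀ m n → N ≤ m → N ≤ n → ∣ seq x m ℚ.- seq x n ∣ ℚ.< ½ ℚ.* (½ ℚ.* ε)
      close = proj₂ (cauchy x (½ ℚ.* (½ ℚ.* ε)) 0<δ)
      decide : Dec (∣ seq x N ∣ ℚ.< ½ ℚ.* ε) → ∃[ N ] (∀ n → N ≤ n → ∣ seq x n ℚ.- seq 𝟘 n ∣ ℚ.< ε)
      decide (yes small) = N , λ n N≤n → begin-strict
        ∣ seq x n ℚ.- 0ℚ ∣
          ≡⟨ cong ∣_∣ (split (seq x n) (seq x N)) ⟩
        ∣ seq x N ℚ.+ (seq x n ℚ.- seq x N) ∣
          ≤⟨ ℚ.∣p+q∣≤∣p∣+∣q∣ (seq x N) (seq x n ℚ.- seq x N) ⟩
        ∣ seq x N ∣ ℚ.+ ∣ seq x n ℚ.- seq x N ∣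
          <⟨ ℚ.+-mono-< small (close n N N≤n ℕ.≤-refl) ⟩
        ½ ℚ.* ε ℚ.+ ½ ℚ.* (½ ℚ.* ε)
          ≤⟨ ≤-difference (½ ℚ.* (½ ℚ.* ε)) (ℚ.<⇒≤ 0<δ) (three-quarters ε) ⟩
        ε ∎
        where open ℚ.≤-Reasoning
      decide (no large) = ⊥-elim (¬pos (pos-² {x} {½ ℚ.* (½ ℚ.* ε)} {N} 0<δ λ n N≤n →
        away ε (∣ seq x n ∣) (∣ seq x N ∣) (∣ seq x N ℚ.- seq x n ∣)
          (triangle N n) (ℚ.<⇒≤ (close N n ℕ.≤-refl N≤n)) (ℚ.≮⇒≥ large)))

pos-cancel : ∀ {x y} → Pos x → x ⊗ y ≈ 𝟘 → y ≈ 𝟘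
pos-cancel {x} pos-x xy≈0 = pos-cancel-≈ pos-x (≈-trans xy≈0 (≈-sym (⊗-zeroʳ x)))

-- Chebyshev polynomials

2ℚ : ℚ
2ℚ = 1ℚ ℚ.+ 1ℚ

-- Chebyshev polynomials: S i (2 cos θ) = sin (iθ) / sin θ.
S : ℕ → ℚ → ℚ
S zero x = 0ℚ
S (suc zero) x = 1ℚ
S (suc (suc i)) x = x ℚ.* S (suc i) x ℚ.- S i x

private

  -- The case a = b = 1 of `S-product`, from which the inductions on `b` and then on `a` start.
  cassini : ∀ m x → S (suc m) x ℚ.* S (suc m) x ≡ S m x ℚ.* S (suc (suc m)) x ℚ.+ 1ℚ
  cassini zero x = sym (trans (cong (ℚ._+ 1ℚ) (ℚ.*-zeroˡ (x ℚ.* 1ℚ ℚ.- 0ℚ))) (ℚ.+-identityˡ 1ℚ))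
  cassini (suc m) x = trans (expand x (S m x) (S (suc m) x))
    (trans (cong (λ u → (u ℚ.+ (x ℚ.* q ℚ.- p) ℚ.* (x ℚ.* q ℚ.- p)) ℚ.- q ℚ.* q) (cassini m x))
           (collect x (S m x) (S (suc m) x)))
    where
    open ℚSolver
    p = S m x
    q = S (suc m) x
    expand : ∀ x p q → (x ℚ.* q ℚ.- p) ℚ.* (x ℚ.* q ℚ.- p) ≡ (q ℚ.* q ℚ.+ (x ℚ.* q ℚ.- p) ℚ.* (x ℚ.* q ℚ.- p)) ℚ.- q ℚ.* q
    expand = solve 3 (λ x p q → (x :* q :- p) :* (x :* q :- p) := (q :* q :+ (x :* q :- p) :* (x :* q :- p)) :- q :* q) refl
    collect : ∀ x p q → ((p ℚ.* (x ℚ.* q ℚ.- p) ℚ.+ 1ℚ) ℚ.+ (x ℚ.* q ℚ.- p) ℚ.* (x ℚ.* q ℚ.- p)) ℚ.- q ℚ.* q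
                      ≡ q ℚ.* (x ℚ.* (x ℚ.* q ℚ.- p) ℚ.- q) ℚ.+ 1ℚ
    collect = solve 3 (λ x p q → ((p :* (x :* q :- p) :+ con 1ℚ) :+ (x :* q :- p) :* (x :* q :- p)) :- q :* q
                      := q :* (x :* (x :* q :- p) :- q) :+ con 1ℚ) refl

  -- Both sides are linear in sequences that obey the same three-term recurrence, so an identity at
  -- two consecutive indices passes to the next one.
  recurrence : ∀ x u u₀ u₁ w w₀ w₁ z z₀ z₁ → u ℚ.* u₁ ≡ w ℚ.* w₁ ℚ.+ z ℚ.* z₁ → u ℚ.* u₀ ≡ w ℚ.* w₀ ℚ.+ z ℚ.* z₀ →
    u ℚ.* (x ℚ.* u₁ ℚ.- u₀) ≡ w ℚ.* (x ℚ.* w₁ ℚ.- w₀) ℚ.+ z ℚ.* (x ℚ.* z₁ ℚ.- z₀)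
  recurrence x u u₀ u₁ w w₀ w₁ z z₀ z₁ h₁ h₀ = trans (expand x u u₀ u₁)
    (trans (cong₂ (λ a b → x ℚ.* a ℚ.- b) h₁ h₀) (collect x w w₀ w₁ z z₀ z₁))
    where
    open ℚSolver
    expand : ∀ x u u₀ u₁ → u ℚ.* (x ℚ.* u₁ ℚ.- u₀) ≡ x ℚ.* (u ℚ.* u₁) ℚ.- u ℚ.* u₀
    expand = solve 4 (λ x u u₀ u₁ → u :* (x :* u₁ :- u₀) := x :* (u :* u₁) :- u :* u₀) refl
    collect : ∀ x w w₀ w₁ z z₀ z₁ → x ℚ.* (w ℚ.* w₁ ℚ.+ z ℚ.* z₁) ℚ.- (w ℚ.* w₀ ℚ.+ z ℚ.* z₀)
      ≡ w ℚ.* (x ℚ.* w₁ ℚ.- w₀) ℚ.+ z ℚ.* (x ℚ.* z₁ ℚ.- z₀)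
    collect = solve 7 (λ x w w₀ w₁ z z₀ z₁ → x :* (w :* w₁ :+ z :* z₁) :- (w :* w₀ :+ z :* z₀)
      := w :* (x :* w₁ :- w₀) :+ z :* (x :* z₁ :- z₀)) refl

  -- The case a = 1 of `S-product`. The factor `1ℚ` stands for `S 1 x` and is kept so that
  -- `recurrence` applies literally.
  addition₁ : ∀ b m x → S (suc m) x ℚ.* S (b ℕ.+ m) x ≡ S m x ℚ.* S (suc (b ℕ.+ m)) x ℚ.+ 1ℚ ℚ.* S b x
  addition₁ zero m x = trans (ℚ.*-comm (S (suc m) x) (S m x)) (sym (ℚ.+-identityʳ (S m x ℚ.* S (suc m) x)))
  addition₁ (suc zero) m x = cassini m x
  addition₁ (suc (suc b)) m x = recurrence x (S (suc m) x) (S (b ℕ.+ m) x) (S (suc (b ℕ.+ m)) x)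
    (S m x) (S (suc (b ℕ.+ m)) x) (S (suc (suc (b ℕ.+ m))) x) 1ℚ (S b x) (S (suc b) x)
    (addition₁ (suc b) m x) (addition₁ b m x)

-- With sines in place of S: sin(a+m) sin(b+m) = sin m sin(a+b+m) + sin a sin b.
S-product : ∀ a b m x → S (b ℕ.+ m) x ℚ.* S (a ℕ.+ m) x ≡ S m x ℚ.* S (a ℕ.+ (b ℕ.+ m)) x ℚ.+ S b x ℚ.* S a x
S-product zero b m x = trans (ℚ.*-comm (S (b ℕ.+ m) x) (S m x))
  (sym (trans (cong (S m x ℚ.* S (b ℕ.+ m) x ℚ.+_) (ℚ.*-zeroʳ (S b x))) (ℚ.+-identityʳ (S m x ℚ.* S (b ℕ.+ m) x))))
S-product (suc zero) b m x = trans (ℚ.*-comm (S (b ℕ.+ m) x) (S (suc m) x))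
  (trans (addition₁ b m x) (cong (S m x ℚ.* S (suc (b ℕ.+ m)) x ℚ.+_) (ℚ.*-comm 1ℚ (S b x))))
S-product (suc (suc a)) b m x = recurrence x (S (b ℕ.+ m) x) (S (a ℕ.+ m) x) (S (suc (a ℕ.+ m)) x)
  (S m x) (S (a ℕ.+ (b ℕ.+ m)) x) (S (suc (a ℕ.+ (b ℕ.+ m))) x) (S b x) (S a x) (S (suc a) x)
  (S-product (suc a) b m x) (S-product a b m x)

-- The second component is the Christoffel–Darboux inequality.
S-mono : ∀ {x y} → x ℚ.≤ y → ∀ i → (∀ l → l ≤ i → 0ℚ ℚ.< S (suc l) x) →
  S (suc i) x ℚ.≤ S (suc i) y × S i y ℚ.* S (suc i) x ℚ.≤ S (suc i) y ℚ.* S i x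
S-mono {x} {y} x≤y zero pos = ℚ.≤-refl , ℚ.≤-reflexive (trans (ℚ.*-zeroˡ 1ℚ) (sym (ℚ.*-zeroʳ 1ℚ)))
S-mono {x} {y} x≤y (suc i) pos = S₂x≤S₂y , darboux
  where
  open ℚSolver
  ih = S-mono x≤y i (λ l l≤i → pos l (ℕ.m≤n⇒m≤1+n l≤i))
  0<S₁x : 0ℚ ℚ.< S (suc i) x
  0<S₁x = pos i (ℕ.n≤1+n i)
  0<S₂x : 0ℚ ℚ.< S (suc (suc i)) x
  0<S₂x = pos (suc i) ℕ.≤-refl
  0<S₁y : 0ℚ ℚ.< S (suc i) y
  0<S₁y = ℚ.<-≤-trans 0<S₁x (proj₁ ih)
  collect : ∀ x y p q p′ q′ → q′ ℚ.* (x ℚ.* q ℚ.- p) ℚ.+ ((y ℚ.- x) ℚ.* (q′ ℚ.* q) ℚ.+ (q′ ℚ.* p ℚ.- p′ ℚ.* q))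
                            ≡ (y ℚ.* q′ ℚ.- p′) ℚ.* q
  collect = solve 6 (λ x y p q p′ q′ → q′ :* (x :* q :- p) :+ ((y :- x) :* (q′ :* q) :+ (q′ :* p :- p′ :* q))
                            := (y :* q′ :- p′) :* q) refl
  darboux : S (suc i) y ℚ.* S (suc (suc i)) x ℚ.≤ S (suc (suc i)) y ℚ.* S (suc i) x
  -- The difference of the two sides is the one for the previous index plus (y - x) S_{i+1}(y)
  -- S_{i+1}(x), and both summands are nonnegative.
  darboux = ≤-difference
    ((y ℚ.- x) ℚ.* (S (suc i) y ℚ.* S (suc i) x) ℚ.+ (S (suc i) y ℚ.* S i x ℚ.- S i y ℚ.* S (suc i) x))
    (ℚ.+-mono-≤ {0ℚ} {(y ℚ.- x) ℚ.* (S (suc i) y ℚ.* S (suc i) x)} {0ℚ} {S (suc i) y ℚ.* S i x ℚ.- S i y ℚ.* S (suc i) x}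
      (0≤p*q {y ℚ.- x} {S (suc i) y ℚ.* S (suc i) x} (p≤q⇒0≤q-p x≤y)
        (ℚ.<⇒≤ (0<p*q {S (suc i) y} {S (suc i) x} 0<S₁y 0<S₁x)))
      (p≤q⇒0≤q-p {S i y ℚ.* S (suc i) x} {S (suc i) y ℚ.* S i x} (proj₂ ih)))
    (collect x y (S i x) (S (suc i) x) (S i y) (S (suc i) y))
  S₂x≤S₂y : S (suc (suc i)) x ℚ.≤ S (suc (suc i)) y
  -- Multiplied by S_{i+1}(x) > 0, the claim is monotonicity at index i + 1 followed by `darboux`.
  S₂x≤S₂y = ℚ.*-cancelʳ-≤-pos (S (suc i) x) {{ℚ.positive 0<S₁x}}
    (ℚ.≤-trans (subst (ℚ._≤ S (suc i) y ℚ.* S (suc (suc i)) x) (ℚ.*-comm (S (suc i) x) (S (suc (suc i)) x))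
                  (ℚ.*-monoʳ-≤-nonNeg (S (suc (suc i)) x) {{ℚ.nonNegative (ℚ.<⇒≤ 0<S₂x)}} (proj₁ ih)))
               darboux)

-- At 2 = 2 cos 0 the value of `S i` is `i`, so 2 can serve as right endpoint for all the
-- bisections.
S-2 : ∀ i → S (suc i) 2ℚ ≡ S i 2ℚ ℚ.+ 1ℚ
S-2 zero = refl
S-2 (suc i) = trans (cong (λ u → 2ℚ ℚ.* u ℚ.- S i 2ℚ) (S-2 i)) (trans (collect (S i 2ℚ)) (cong (ℚ._+ 1ℚ) (sym (S-2 i))))
  where
  open ℚSolver
  collect : ∀ u → 2ℚ ℚ.* (u ℚ.+ 1ℚ) ℚ.- u ≡ (u ℚ.+ 1ℚ) ℚ.+ 1ℚ
  collect = solve 1 (λ u → (con 1ℚ :+ con 1ℚ) :* (u :+ con 1ℚ) :- u := (u :+ con 1ℚ) :+ con 1ℚ) refl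

0≤S-2 : ∀ i → 0ℚ ℚ.≤ S i 2ℚ
0≤S-2 zero = ℚ.≤-refl
0≤S-2 (suc i) = subst (0ℚ ℚ.≤_) (sym (S-2 i)) (ℚ.+-mono-≤ {0ℚ} {S i 2ℚ} {0ℚ} {1ℚ} (0≤S-2 i) (ℚ.<⇒≤ 0<1))

0<S-2 : ∀ i → 0ℚ ℚ.< S (suc i) 2ℚ
0<S-2 i = subst (0ℚ ℚ.<_) (sym (S-2 i)) (ℚ.+-mono-≤-< {0ℚ} {S i 2ℚ} {0ℚ} {1ℚ} (0≤S-2 i) 0<1)

-- Integers inside the rationals

_/1 : ℤ → ℚ
m /1 = m ℚ./ 1

private

  -- Division in ℚ normalises by a gcd that does not compute on a variable numerator, so the laws of
  -- the embedding are checked on unnormalised fractions.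
  toℚᵘ-/1 : ∀ m → ℚ.toℚᵘ (m /1) ℚᵘ.≃ ℚᵘ.mkℚᵘ m 0
  toℚᵘ-/1 m = ℚ.toℚᵘ-fromℚᵘ (ℚᵘ.mkℚᵘ m 0)

/1-+ : ∀ a b → (a ℤ.+ b) /1 ≡ a /1 ℚ.+ b /1
/1-+ a b = ℚ.toℚᵘ-injective (ℚᵘ.≃-trans (toℚᵘ-/1 (a ℤ.+ b)) (ℚᵘ.≃-sym
  (ℚᵘ.≃-trans (ℚ.toℚᵘ-homo-+ (a /1) (b /1)) (ℚᵘ.≃-trans (ℚᵘ.+-cong (toℚᵘ-/1 a) (toℚᵘ-/1 b))
    (ℚᵘ.*≡* (cong (ℤ._* ℤ.1ℤ) (cong₂ ℤ._+_ (ℤ.*-identityʳ a) (ℤ.*-identityʳ b))))))))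

/1-* : ∀ a b → (a ℤ.* b) /1 ≡ a /1 ℚ.* b /1
/1-* a b = ℚ.toℚᵘ-injective (ℚᵘ.≃-trans (toℚᵘ-/1 (a ℤ.* b)) (ℚᵘ.≃-sym
  (ℚᵘ.≃-trans (ℚ.toℚᵘ-homo-* (a /1) (b /1)) (ℚᵘ.*-cong (toℚᵘ-/1 a) (toℚᵘ-/1 b)))))

/1-mono-≤ : ∀ {a b} → a ℤ.≤ b → a /1 ℚ.≤ b /1
/1-mono-≤ {a} {b} a≤b = ℚ.toℚᵘ-cancel-≤
  (ℚᵘ.≤-respˡ-≃ (ℚᵘ.≃-sym (toℚᵘ-/1 a)) (ℚᵘ.≤-respʳ-≃ (ℚᵘ.≃-sym (toℚᵘ-/1 b))
    (ℚᵘ.*≤* (ℤ.*-monoʳ-≤-nonNeg ℤ.1ℤ a≤b))))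

/1-cancel-< : ∀ {a b} → a /1 ℚ.< b /1 → a ℤ.< b
/1-cancel-< {a} {b} a<b = ℤ.≰⇒> λ b≤a → ℚ.<-irrefl refl (ℚ.<-≤-trans a<b (/1-mono-≤ b≤a))

i≤∣i∣ : ∀ i → i ℤ.≤ ℤ.+ ℤ.∣ i ∣
i≤∣i∣ (ℤ.+ n) = ℤ.≤-refl
i≤∣i∣ ℤ.-[1+ n ] = ℤ.-≤+

archimedean : ∀ q → ∃[ n ] (q ℚ.< (ℤ.+ n) /1)
archimedean q@record{} = suc (ℤ.∣ ℚ.↥ q ∣) , ℚ.toℚᵘ-cancel-< (ℚᵘ.<-respʳ-≃ (ℚᵘ.≃-sym (toℚᵘ-/1 (ℤ.+ n)))
    (ℚᵘ.*<* (subst (ℤ._< ℤ.+ n ℤ.* ℚ.↧ q) (sym (ℤ.*-identityʳ (ℚ.↥ q)))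
      (ℤ.≤-<-trans (i≤∣i∣ (ℚ.↥ q)) (ℤ.+<+ (ℕ.m≤m*n n (ℚ.↧ₙ q)))))))
  where
  n : ℕ
  n = suc (ℤ.∣ ℚ.↥ q ∣)

-- Bisection

halve : ℕ → ℚ → ℚ
halve zero w = w
halve (suc t) w = ½ ℚ.* halve t w

0≤halve : ∀ {w} → 0ℚ ℚ.≤ w → ∀ t → 0ℚ ℚ.≤ halve t w
0≤halve 0≤w zero = 0≤w
0≤halve {w} 0≤w (suc t) = 0≤p*q {½} {halve t w} (ℚ.<⇒≤ 0<½) (0≤halve 0≤w t)

halve-≤ : ∀ {w} → 0ℚ ℚ.≤ w → ∀ t → halve t w ℚ.≤ w
halve-≤ 0≤w zero = ℚ.≤-refl
halve-≤ {w} 0≤w (suc t) = ℚ.≤-trans (≤-difference {½ ℚ.* halve t w} {halve t w} (½ ℚ.* halve t w)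
  (0≤halve 0≤w (suc t)) (½p+½p (halve t w))) (halve-≤ 0≤w t)

-- The bound 2^t ≥ t is crude, but with the Archimedean property it suffices to make the widths
-- arbitrarily small.
halve-* : ∀ {w} → 0ℚ ℚ.≤ w → ∀ t → (ℤ.+ t) /1 ℚ.* halve t w ℚ.≤ w
halve-* {w} 0≤w zero = subst (ℚ._≤ w) (sym (ℚ.*-zeroˡ w)) 0≤w
halve-* {w} 0≤w (suc t) = subst (ℚ._≤ w) (sym eq) (subst (½ ℚ.* halve t w ℚ.+ ½ ℚ.* ((ℤ.+ t) /1 ℚ.* halve t w) ℚ.≤_) (½p+½p w)
    (ℚ.+-mono-≤ {½ ℚ.* halve t w} {½ ℚ.* w} {½ ℚ.* ((ℤ.+ t) /1 ℚ.* halve t w)} {½ ℚ.* w}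
      (ℚ.*-monoˡ-≤-nonNeg ½ (halve-≤ 0≤w t))
      (ℚ.*-monoˡ-≤-nonNeg ½ (halve-* 0≤w t))))
  where
  open ℚSolver
  collect : ∀ n h → (1ℚ ℚ.+ n) ℚ.* (½ ℚ.* h) ≡ ½ ℚ.* h ℚ.+ ½ ℚ.* (n ℚ.* h)
  collect = solve 2 (λ n h → (con 1ℚ :+ n) :* (con ½ :* h) := con ½ :* h :+ con ½ :* (n :* h)) refl
  eq : (ℤ.+ suc t) /1 ℚ.* (½ ℚ.* halve t w) ≡ ½ ℚ.* halve t w ℚ.+ ½ ℚ.* ((ℤ.+ t) /1 ℚ.* halve t w)
  eq = trans (cong (ℚ._* (½ ℚ.* halve t w)) (/1-+ ℤ.1ℤ (ℤ.+ t))) (collect ((ℤ.+ t) /1) (halve t w))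

halve-small : ∀ {w ε} → 0ℚ ℚ.≤ w → 0ℚ ℚ.< ε → ∃[ t ] (halve t w ℚ.< ε)
halve-small {w} {ε} 0≤w 0<ε = t , ℚ.≰⇒> λ ε≤h → ℚ.<-irrefl refl (begin-strict
    w                            ≡⟨ sym ε*q≡w ⟩
    ε ℚ.* q                      <⟨ ℚ.*-monoʳ-<-pos ε {{ℚ.positive 0<ε}} (proj₂ (archimedean q)) ⟩
    ε ℚ.* (ℤ.+ t) /1             ≡⟨ ℚ.*-comm ε ((ℤ.+ t) /1) ⟩
    (ℤ.+ t) /1 ℚ.* ε             ≤⟨ ℚ.*-monoˡ-≤-nonNeg ((ℤ.+ t) /1) {{ℚ.nonNegative (/1-mono-≤ {ℤ.0ℤ} {ℤ.+ t} (ℤ.+≤+ ℕ.z≤n))}} ε≤h ⟩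
    (ℤ.+ t) /1 ℚ.* halve t w     ≤⟨ halve-* 0≤w t ⟩
    w                            ∎)
  where
  open ℚ.≤-Reasoning
  ε-nonZero = ℚ.pos⇒nonZero ε {{ℚ.positive 0<ε}}
  q : ℚ
  q = (1/ ε) {{ε-nonZero}} ℚ.* w
  ε*q≡w : ε ℚ.* q ≡ w
  ε*q≡w = trans (sym (ℚ.*-assoc ε _ w)) (trans (cong (ℚ._* w) (ℚ.*-inverseʳ ε {{ε-nonZero}})) (ℚ.*-identityˡ w))
  t : ℕ
  t = proj₁ (archimedean q)

-- The two sign conditions are complementary and decidable at a rational point, so the midpoint
-- always qualifies as one of the new endpoints.
record Bracket (f : ℚ → ℚ) : Set where
  constructor bracket
  field
    low high : ℚ
    low≤high : low ℚ.≤ high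
    f-low    : f low ℚ.≤ 0ℚ
    f-high   : 0ℚ ℚ.< f high

open Bracket

module _ {f : ℚ → ℚ} where

  width : Bracket f → ℚ
  width B = high B ℚ.- low B

  private
    middle : Bracket f → ℚ
    middle B = low B ℚ.+ ½ ℚ.* width B

    low≤middle : ∀ B → low B ℚ.≤ middle B
    low≤middle B = ≤-difference (½ ℚ.* width B)
      (0≤p*q {½} {width B} (ℚ.<⇒≤ 0<½) (p≤q⇒0≤q-p (low≤high B))) refl

    middle-collect : ∀ a b → (a ℚ.+ ½ ℚ.* (b ℚ.- a)) ℚ.+ ½ ℚ.* (b ℚ.- a) ≡ b
    middle-collect = solve 2 (λ a b → (a :+ con ½ :* (b :- a)) :+ con ½ :* (b :- a) := b) refl
      where open ℚSolver

    middle≤high : ∀ B → middle B ℚ.≤ high B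
    middle≤high B = ≤-difference (½ ℚ.* width B)
      (0≤p*q {½} {width B} (ℚ.<⇒≤ 0<½) (p≤q⇒0≤q-p (low≤high B))) (middle-collect (low B) (high B))

    Half : Bracket f → Set
    Half B = ∃[ B′ ] (low B ℚ.≤ low B′ × high B′ ℚ.≤ high B × width B′ ≡ ½ ℚ.* width B)

    half-by : ∀ B → Dec (f (middle B) ℚ.≤ 0ℚ) → Half B
    half-by B (yes f≤0) = bracket (middle B) (high B) (middle≤high B) f≤0 (f-high B)
      , low≤middle B , ℚ.≤-refl , upper (low B) (high B)
      where
      open ℚSolver
      upper : ∀ a b → b ℚ.- (a ℚ.+ ½ ℚ.* (b ℚ.- a)) ≡ ½ ℚ.* (b ℚ.- a)
      upper = solve 2 (λ a b → b :- (a :+ con ½ :* (b :- a)) := con ½ :* (b :- a)) refl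
    half-by B (no f≰0) = bracket (low B) (middle B) (low≤middle B) (f-low B) (ℚ.≰⇒> f≰0)
      , ℚ.≤-refl , middle≤high B , lower (low B) (high B)
      where
      open ℚSolver
      lower : ∀ a b → (a ℚ.+ ½ ℚ.* (b ℚ.- a)) ℚ.- a ≡ ½ ℚ.* (b ℚ.- a)
      lower = solve 2 (λ a b → (a :+ con ½ :* (b :- a)) :- a := con ½ :* (b :- a)) refl

    half : ∀ B → Half B
    half B = half-by B (f (middle B) ℚ.≤? 0ℚ)

  bisect : Bracket f → ℕ → Bracket f
  bisect B zero = B
  bisect B (suc t) = proj₁ (half (bisect B t))

  width-bisect : ∀ B t → width (bisect B t) ≡ halve t (width B)
  width-bisect B zero = refl
  width-bisect B (suc t) = trans (proj₂ (proj₂ (proj₂ (half (bisect B t))))) (cong (½ ℚ.*_) (width-bisect B t))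

  low-bisect : ∀ B s t → low (bisect B t) ℚ.≤ low (bisect B (s ℕ.+ t))
  low-bisect B zero t = ℚ.≤-refl
  low-bisect B (suc s) t = ℚ.≤-trans (low-bisect B s t) (proj₁ (proj₂ (half (bisect B (s ℕ.+ t)))))

  high-bisect : ∀ B s t → high (bisect B (s ℕ.+ t)) ℚ.≤ high (bisect B t)
  high-bisect B zero t = ℚ.≤-refl
  high-bisect B (suc s) t = ℚ.≤-trans (proj₁ (proj₂ (proj₂ (half (bisect B (s ℕ.+ t)))))) (high-bisect B s t)

  Inside : Bracket f → ℚ → Set
  Inside B x = low B ℚ.≤ x × x ℚ.≤ high B

  low-inside : ∀ B {N n} → N ≤ n → Inside (bisect B N) (low (bisect B n))
  low-inside B {N} {n} N≤n = subst (λ n → Inside (bisect B N) (low (bisect B n))) (ℕ.m∸n+n≡m N≤n)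
    (low-bisect B (n ∸ N) N , ℚ.≤-trans (low≤high (bisect B (n ∸ N ℕ.+ N))) (high-bisect B (n ∸ N) N))

  high-inside : ∀ B {N n} → N ≤ n → Inside (bisect B N) (high (bisect B n))
  high-inside B {N} {n} N≤n = subst (λ n → Inside (bisect B N) (high (bisect B n))) (ℕ.m∸n+n≡m N≤n)
    (ℚ.≤-trans (low-bisect B (n ∸ N) N) (low≤high (bisect B (n ∸ N ℕ.+ N))) , high-bisect B (n ∸ N) N)

  inside-close : ∀ B {x y} → Inside B x → Inside B y → ∣ x ℚ.- y ∣ ℚ.≤ width B
  inside-close B {x} {y} (a≤x , x≤b) (a≤y , y≤b) = ∣-∣-bound {x ℚ.- y} {width B}
    (ℚ.+-mono-≤ {x} {high B} {ℚ.- y} {ℚ.- low B} x≤b (ℚ.neg-antimono-≤ a≤y))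
    (subst (ℚ._≤ width B) (swap x y) (ℚ.+-mono-≤ {y} {high B} {ℚ.- x} {ℚ.- low B} y≤b (ℚ.neg-antimono-≤ a≤x)))
    where
    open ℚSolver
    swap : ∀ x y → y ℚ.- x ≡ ℚ.- (x ℚ.- y)
    swap = solve 2 (λ x y → y :- x := :- (x :- y)) refl

  private
    eventually-close : ∀ B ε → 0ℚ ℚ.< ε →
      ∃[ N ] (∀ {x y} → Inside (bisect B N) x → Inside (bisect B N) y → ∣ x ℚ.- y ∣ ℚ.< ε)
    eventually-close B ε 0<ε = N , λ x-in y-in → ℚ.≤-<-trans (inside-close (bisect B N) x-in y-in)
        (subst (ℚ._< ε) (sym (width-bisect B N)) (proj₂ small))
      where
      small : ∃[ t ] (halve t (width B) ℚ.< ε)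
      small = halve-small (p≤q⇒0≤q-p (low≤high B)) 0<ε
      N : ℕ
      N = proj₁ small

  opaque

    low-limit : Bracket f → ℝ
    low-limit B = mkℝ (λ t → low (bisect B t)) λ ε 0<ε → let N , close = eventually-close B ε 0<ε in
      N , λ m n N≤m N≤n → close (low-inside B N≤m) (low-inside B N≤n)

    high-limit : Bracket f → ℝ
    high-limit B = mkℝ (λ t → high (bisect B t)) λ ε 0<ε → let N , close = eventually-close B ε 0<ε in
      N , λ m n N≤m N≤n → close (high-inside B N≤m) (high-inside B N≤n)

    seq-low : ∀ B t → seq (low-limit B) t ≡ low (bisect B t)
    seq-low B t = refl

    seq-high : ∀ B t → seq (high-limit B) t ≡ high (bisect B t)
    seq-high B t = refl

    limits-agree : ∀ B → low-limit B ≈ high-limit B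
    limits-agree B = equal λ ε 0<ε → let N , close = eventually-close B ε 0<ε in
      N , λ n N≤n → close (low-inside B N≤n) (high-inside B N≤n)

-- Chebyshev polynomials on the reals and their largest roots

𝕊 : ℕ → ℝ → ℝ
𝕊 zero x = 𝟘
𝕊 (suc zero) x = 𝟙
𝕊 (suc (suc i)) x = x ⊗ 𝕊 (suc i) x ⊕ ⊖ 𝕊 i x

-- Evaluation is termwise, so identities and inequalities for `S` at rational points carry over to
-- Cauchy sequences.
seq-𝕊 : ∀ i x t → seq (𝕊 i x) t ≡ S i (seq x t)
seq-𝕊 zero x t = seq-𝟘 t
seq-𝕊 (suc zero) x t = seq-𝟙 t
seq-𝕊 (suc (suc i)) x t = trans (seq-⊕ (x ⊗ 𝕊 (suc i) x) (⊖ 𝕊 i x) t)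
  (cong₂ ℚ._+_ (trans (seq-⊗ x (𝕊 (suc i) x) t) (cong (seq x t ℚ.*_) (seq-𝕊 (suc i) x t)))
               (trans (seq-⊖ (𝕊 i x) t) (cong ℚ.-_ (seq-𝕊 i x t))))

𝕊-cong : ∀ i {x y} → x ≈ y → 𝕊 i x ≈ 𝕊 i y
𝕊-cong zero x≈y = ≈-refl
𝕊-cong (suc zero) x≈y = ≈-refl
𝕊-cong (suc (suc i)) x≈y = ⊕-cong (⊗-cong x≈y (𝕊-cong (suc i) x≈y)) (⊖-cong (𝕊-cong i x≈y))

𝕊-product : ∀ a b m x → 𝕊 (b ℕ.+ m) x ⊗ 𝕊 (a ℕ.+ m) x ≈ 𝕊 m x ⊗ 𝕊 (a ℕ.+ (b ℕ.+ m)) x ⊕ 𝕊 b x ⊗ 𝕊 a x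
𝕊-product a b m x = pointwise λ t →
  trans (seq-𝕊-⊗ (b ℕ.+ m) (a ℕ.+ m) t) (trans (S-product a b m (seq x t)) (sym
    (trans (seq-⊕ (𝕊 m x ⊗ 𝕊 (a ℕ.+ (b ℕ.+ m)) x) (𝕊 b x ⊗ 𝕊 a x) t)
      (cong₂ ℚ._+_ (seq-𝕊-⊗ m (a ℕ.+ (b ℕ.+ m)) t) (seq-𝕊-⊗ b a t)))))
  where
  seq-𝕊-⊗ : ∀ i j t → seq (𝕊 i x ⊗ 𝕊 j x) t ≡ S i (seq x t) ℚ.* S j (seq x t)
  seq-𝕊-⊗ i j t = trans (seq-⊗ (𝕊 i x) (𝕊 j x) t) (cong₂ ℚ._*_ (seq-𝕊 i x t) (seq-𝕊 j x t))

module Bisection (n : ℕ) (B : Bracket (S n)) where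

  private
    -- Continuity without a modulus: ring operations respect equality of reals, and both sequences
    -- of endpoints represent the same real.
    S-limits-agree : 𝕊 n (low-limit B) ≈ 𝕊 n (high-limit B)
    S-limits-agree = 𝕊-cong n (limits-agree B)

    S-close : ∀ ε → 0ℚ ℚ.< ε → ∃[ N ] (∀ t → N ≤ t → ∣ S n (low (bisect B t)) ℚ.- S n (high (bisect B t)) ∣ ℚ.< ε)
    S-close ε 0<ε = N , λ t N≤t → subst (ℚ._< ε)
      (cong₂ (λ p q → ∣ p ℚ.- q ∣)
        (trans (seq-𝕊 n (low-limit B) t) (cong (S n) (seq-low B t)))
        (trans (seq-𝕊 n (high-limit B) t) (cong (S n) (seq-high B t))))
      (proj₂ (_≈_.null-difference S-limits-agree ε 0<ε) t N≤t)
      where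
      N : ℕ
      N = proj₁ (_≈_.null-difference S-limits-agree ε 0<ε)

  -- `S n` is nonpositive at the lower endpoints and positive at the upper ones, so its size at a
  -- lower endpoint is at most the gap between the two values, which tends to 0.
  root-limit : 𝕊 n (low-limit B) ≈ 𝟘
  root-limit = equal λ ε 0<ε → proj₁ (S-close ε 0<ε) , λ t N≤t → subst (ℚ._< ε)
      (sym (cong₂ (λ p q → ∣ p ℚ.- q ∣) (trans (seq-𝕊 n (low-limit B) t) (cong (S n) (seq-low B t))) (seq-𝟘 t)))
      (ℚ.≤-<-trans (smaller (S n (low (bisect B t))) (S n (high (bisect B t))) (f-low (bisect B t)) (ℚ.<⇒≤ (f-high (bisect B t))))
        (proj₂ (S-close ε 0<ε) t N≤t))
    where
    open ℚSolver
    swap : ∀ p → ℚ.0ℚ ℚ.- p ≡ ℚ.- (p ℚ.- 0ℚ)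
    swap = solve 1 (λ p → con 0ℚ :- p := :- (p :- con 0ℚ)) refl
    smaller : ∀ p q → p ℚ.≤ 0ℚ → 0ℚ ℚ.≤ q → ∣ p ℚ.- 0ℚ ∣ ℚ.≤ ∣ p ℚ.- q ∣
    smaller p q p≤0 0≤q = ∣-∣-bound {p ℚ.- 0ℚ} {∣ p ℚ.- q ∣}
      (ℚ.≤-trans (subst (ℚ._≤ 0ℚ) (sym (ℚ.+-identityʳ p)) p≤0) (ℚ.0≤∣p∣ (p ℚ.- q)))
      (subst₂ ℚ._≤_ (swap p) (∣p-q∣≡∣q-p∣ q p)
        (ℚ.≤-trans (ℚ.+-monoˡ-≤ (ℚ.- p) 0≤q) (p≤∣p∣ (q ℚ.- p))))

  S-high-small : ∀ δ → 0ℚ ℚ.< δ → ∃[ t ] (S n (high (bisect B t)) ℚ.≤ δ)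
  S-high-small δ 0<δ = N , smaller (S n (low (bisect B N))) (S n (high (bisect B N))) (f-low (bisect B N)) (proj₂ (S-close δ 0<δ) N ℕ.≤-refl)
    where
    open ℚSolver
    N : ℕ
    N = proj₁ (S-close δ 0<δ)
    smaller : ∀ p q → p ℚ.≤ 0ℚ → ∣ p ℚ.- q ∣ ℚ.< δ → q ℚ.≤ δ
    smaller p q p≤0 close = ℚ.<⇒≤ (ℚ.<-≤-trans (∣p-q∣<ε⇒p<q+ε {q} {p} {δ} (subst (ℚ._< δ) (∣p-q∣≡∣q-p∣ p q) close))
      (subst (p ℚ.+ δ ℚ.≤_) (ℚ.+-identityˡ δ) (ℚ.+-monoˡ-≤ δ p≤0)))

-- The point lies in the interval (2 cos (π/(n+1)), 2 cos (π/(n+2))].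
record Isolated (n : ℕ) : Set where
  field
    point          : ℚ
    point≤2        : point ℚ.≤ 2ℚ
    positive-below : ∀ l → l ≤ n → 0ℚ ℚ.< S (suc l) point
    nonpositive    : S (suc (suc n)) point ℚ.≤ 0ℚ

open Isolated

isolating-bracket : ∀ {n} → Isolated n → Bracket (S (suc (suc n)))
isolating-bracket {n} I = bracket (point I) 2ℚ (point≤2 I) (nonpositive I) (0<S-2 (suc n))

-- The next point is an upper endpoint `b` in the bisection for `S (suc (suc n))`. It is chosen so
-- close to the root that b S_{n+2}(b) ≤ 2δ = S_{n+1}(point) ≤ S_{n+1}(b), which makes S_{n+3}(b)
-- nonpositive; the earlier polynomials stay positive at `b` by `S-mono`.
isolate : ∀ n → Isolated n
isolate zero = record
  -- 2 cos (π/2) = 0 is a rational root of `S 2`. The term `0≤S-2 2` is a proof of 0 ≤ 2, because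
  -- `S 2 2ℚ` evaluates to 2.
  { point = 0ℚ ; point≤2 = 0≤S-2 2 ; positive-below = λ { zero ℕ.z≤n → 0<1 }
  ; nonpositive = ℚ.≤-refl }
isolate (suc n) = record
  { point = b
  ; point≤2 = b≤2
  ; positive-below = λ l l≤1+n → positive l (ℕ.m≤n⇒m<n∨m≡n l≤1+n)
  ; nonpositive = ≤-difference {b ℚ.* S (suc (suc n)) b ℚ.- S (suc n) b} {0ℚ} (S (suc n) b ℚ.- b ℚ.* S (suc (suc n)) b)
      (p≤q⇒0≤q-p small′) (cancel (b ℚ.* S (suc (suc n)) b) (S (suc n) b))
  }
  where
  I = isolate n
  B = isolating-bracket I
  δ : ℚ
  δ = ½ ℚ.* S (suc n) (point I)
  open Bisection (suc (suc n)) B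
  small : ∃[ t ] (S (suc (suc n)) (high (bisect B t)) ℚ.≤ δ)
  small = S-high-small δ (0<p*q {½} {S (suc n) (point I)} 0<½ (positive-below I n ℕ.≤-refl))
  t : ℕ
  t = proj₁ small
  b : ℚ
  b = high (bisect B t)
  a≤b : point I ℚ.≤ b
  a≤b = proj₁ (high-inside B {0} {t} ℕ.z≤n)
  b≤2 : b ℚ.≤ 2ℚ
  b≤2 = proj₂ (high-inside B {0} {t} ℕ.z≤n)
  mono : ∀ l → l ≤ n → S (suc l) (point I) ℚ.≤ S (suc l) b
  mono l l≤n = proj₁ (S-mono a≤b l (λ m m≤l → positive-below I m (ℕ.≤-trans m≤l l≤n)))
  positive : ∀ l → l ℕ.< suc n ⊎ l ≡ suc n → 0ℚ ℚ.< S (suc l) b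
  positive l (inj₁ (ℕ.s≤s l≤n)) = ℚ.<-≤-trans (positive-below I l l≤n) (mono l l≤n)
  positive l (inj₂ refl) = f-high (bisect B t)
  double : ∀ p → 2ℚ ℚ.* (½ ℚ.* p) ≡ p
  double = solve 1 (λ p → (con 1ℚ :+ con 1ℚ) :* (con ½ :* p) := p) refl
    where open ℚSolver
  cancel : ∀ p q → (p ℚ.- q) ℚ.+ (q ℚ.- p) ≡ 0ℚ
  cancel = solve 2 (λ p q → (p :- q) :+ (q :- p) := con 0ℚ) refl
    where open ℚSolver
  small′ : b ℚ.* S (suc (suc n)) b ℚ.≤ S (suc n) b
  small′ = ℚ.≤-trans (ℚ.*-monoʳ-≤-nonNeg (S (suc (suc n)) b) {{ℚ.nonNegative (ℚ.<⇒≤ (f-high (bisect B t)))}} b≤2)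
    (ℚ.≤-trans (ℚ.*-monoˡ-≤-nonNeg 2ℚ (proj₂ small))
      (subst (ℚ._≤ S (suc n) b) (sym (double (S (suc n) (point I)))) (mono n ℕ.≤-refl)))

-- x = 2 cos (π/(n+2))
cosine : ∀ n → ∃[ x ] (𝕊 (suc (suc n)) x ≈ 𝟘 × ∀ l → l ≤ n → Pos (𝕊 (suc l) x))
cosine n = low-limit B , root-limit , λ l l≤n → eventually (S (suc l) (point I)) (positive-below I l l≤n) 0 λ t _ →
    subst (S (suc l) (point I) ℚ.≤_) (sym (trans (seq-𝕊 (suc l) (low-limit B) t) (cong (S (suc l)) (seq-low B t))))
      -- Every lower endpoint is at least `point I`, so `S-mono` makes the value at that point a
      -- common lower bound.
      (proj₁ (S-mono (proj₁ (low-inside B {0} {t} ℕ.z≤n)) l (λ m m≤l → positive-below I m (ℕ.≤-trans m≤l l≤n))))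
  where
  I : Isolated n
  I = isolate n
  B : Bracket (S (suc (suc n)))
  B = isolating-bracket I
  open Bisection (suc (suc n)) B

-- Codegrees in the hypercycle

module _ {c ℓ} (M : CommutativeMonoid c ℓ) where

  private module M = CommutativeMonoid M
  open M using (Carrier; ε)
  open Sum M using () renaming (sum to sumᴹ)

  sum-zero : ∀ {n} (f : Vector Carrier n) → (∀ i → f i M.≈ ε) → sumᴹ f M.≈ ε
  sum-zero {zero} f f≈ε = M.refl
  sum-zero {suc n} f f≈ε = M.trans (M.∙-cong (f≈ε Fin.zero) (sum-zero (f ∘ Fin.suc) (f≈ε ∘ Fin.suc))) (M.identityˡ ε)

  sum-single : ∀ {n} (f : Vector Carrier n) i → (∀ j → j ≢ i → f j M.≈ ε) → sumᴹ f M.≈ f i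
  sum-single {suc n} f Fin.zero f≈ε = M.trans
    (M.∙-congˡ (sum-zero (f ∘ Fin.suc) (λ j → f≈ε (Fin.suc j) λ ()))) (M.identityʳ (f Fin.zero))
  sum-single {suc n} f (Fin.suc i) f≈ε = M.trans (M.∙-congʳ (f≈ε Fin.zero λ ()))
    (M.trans (M.identityˡ (sumᴹ (f ∘ Fin.suc)))
      (sum-single (f ∘ Fin.suc) i λ j j≢i → f≈ε (Fin.suc j) (j≢i ∘ Fin.suc-injective)))

open SemiringSum ℕ.+-*-semiring using ()
  renaming (sum to sumℕ; sum-cong-≗ to sumℕ-cong; ∑-comm to sumℕ-comm; *-distribʳ-sum to *-distribʳ-sumℕ)

indicator : ∀ {P : Set} → Dec P → ℕ
indicator (yes _) = 1
indicator (no _)  = 0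

indicator-true : ∀ {P : Set} (P? : Dec P) → P → indicator P? ≡ 1
indicator-true (yes _) p = refl
indicator-true (no ¬p) p = ⊥-elim (¬p p)

indicator-false : ∀ {P : Set} (P? : Dec P) → ¬ P → indicator P? ≡ 0
indicator-false (yes p) ¬p = ⊥-elim (¬p p)
indicator-false (no _)  ¬p = refl

indicator-× : ∀ {P Q : Set} (P? : Dec P) (Q? : Dec Q) → indicator (P? ×-dec Q?) ≡ indicator P? ℕ.* indicator Q?
indicator-× (yes _) (yes _) = refl
indicator-× (yes _) (no _)  = refl
indicator-× (no _)  Q?      = refl

indicator-idem : ∀ {P : Set} (P? : Dec P) → indicator P? ℕ.* indicator P? ≡ indicator P?
indicator-idem (yes _) = refl
indicator-idem (no _)  = refl

sum-indicator : ∀ {k} {P : Fin k → Set} {D : Set} (P? : ∀ t → Dec (P t)) (D? : Dec D) →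
  (D → ∃[ t ] P t) → (∀ t → P t → D) → (∀ s t → P s → P t → s ≡ t) →
  sumℕ (λ t → indicator (P? t)) ≡ indicator D?
sum-indicator P? (yes d) witness sound unique = trans
    (sum-single ℕ.+-0-commutativeMonoid (λ t → indicator (P? t)) (proj₁ (witness d))
      (λ j j≢t → indicator-false (P? j) λ pj → j≢t (unique j (proj₁ (witness d)) pj (proj₂ (witness d)))))
    (indicator-true (P? (proj₁ (witness d))) (proj₂ (witness d)))
sum-indicator P? (no ¬d) witness sound unique =
  sum-zero ℕ.+-0-commutativeMonoid (λ t → indicator (P? t)) (λ t → indicator-false (P? t) (¬d ∘ sound t))

length-filter-tabulate : ∀ {A : Set} {P : A → Set} (P? : ∀ x → Dec (P x)) {n} (h : Fin n → A) →
  length (filter P? (tabulate h)) ≡ sumℕ (λ j → indicator (P? (h j)))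
length-filter-tabulate P? {zero} h = refl
length-filter-tabulate P? {suc n} h with P? (h Fin.zero)
... | yes _ = cong suc (length-filter-tabulate P? (h ∘ Fin.suc))
... | no _  = length-filter-tabulate P? (h ∘ Fin.suc)

deduplicate-unique : ∀ {n} {xs : List (Subset n)} → Unique xs → deduplicate _≟ˢ_ xs ≡ xs
deduplicate-unique [] = refl
deduplicate-unique {xs = x ∷ xs} (x≢xs ∷ unique) = cong (x ∷_)
  (trans (cong (filter (¬? ∘ (x ≟ˢ_))) (deduplicate-unique unique)) (filter-all (¬? ∘ (x ≟ˢ_)) x≢xs))

∈-⋃⁻ : ∀ {n} {x : Fin n} (g : ℕ → Fin n) ts → x ∈ˢ ⋃ (map (λ t → ⁅ g t ⁆) ts) → ∃[ t ] (t ∈ ts × g t ≡ x)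
∈-⋃⁻ g [] x∈ = ⊥-elim (∉⊥ x∈)
∈-⋃⁻ g (t ∷ ts) x∈ with x∈p∪q⁻ ⁅ g t ⁆ (⋃ (map (λ t → ⁅ g t ⁆) ts)) x∈
... | inj₁ x∈⁅t⁆ = t , here refl , sym (x∈⁅y⁆⇒x≡y (g t) x∈⁅t⁆)
... | inj₂ x∈⋃ with ∈-⋃⁻ g ts x∈⋃
...   | s , s∈ts , gs≡x = s , there s∈ts , gs≡x

∈-⋃⁺ : ∀ {n} (g : ℕ → Fin n) {t ts} → t ∈ ts → g t ∈ˢ ⋃ (map (λ t → ⁅ g t ⁆) ts)
∈-⋃⁺ g (here refl) = x∈p∪q⁺ (inj₁ (x∈⁅x⁆ (g _)))
∈-⋃⁺ g (there t∈ts) = x∈p∪q⁺ (inj₂ (∈-⋃⁺ g t∈ts))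

-- The offsets `n ∸ s` stand for -s and decrease with s. Reversing the order of summation turns them
-- into an increasing progression that starts at `n ∸ K`.
∸-opposite : ∀ {K n} (a : Fin (suc K)) → K ≤ n → n ∸ toℕ (Fin.opposite a) ≡ n ∸ K ℕ.+ toℕ a
∸-opposite {K} {n} a K≤n = trans (cong (n ∸_) (Fin.opposite-prop a)) (ℕ.+-cancelʳ-≡ (K ∸ toℕ a) _ _
  (trans (ℕ.m∸n+n≡m (ℕ.≤-trans (ℕ.m∸n≤m K (toℕ a)) K≤n))
    (sym (trans (ℕ.+-assoc (n ∸ K) (toℕ a) (K ∸ toℕ a))
      (trans (cong (n ∸ K ℕ.+_) (ℕ.m+[n∸m]≡n (ℕ.≤-pred (Fin.toℕ<n a)))) (ℕ.m∸n+n≡m K≤n))))))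

module Cyclic (n : ℕ) .{{_ : ℕ.NonZero n}} where

  infixl 6 _⊞_

  -- Spelled exactly as in `interval`, so that the elements of an edge are definitionally of the
  -- form `j ⊞ t`.
  _⊞_ : Fin n → ℕ → Fin n
  j ⊞ t = (toℕ j ℕ.+ t) mod n

  toℕ-⊞ : ∀ j t → toℕ (j ⊞ t) ≡ (toℕ j ℕ.+ t) % n
  toℕ-⊞ j t = Fin.toℕ-fromℕ< (m%n<n (toℕ j ℕ.+ t) n)

  [m%n+t]%n : ∀ m t → (m % n ℕ.+ t) % n ≡ (m ℕ.+ t) % n
  [m%n+t]%n m t = trans (%-distribˡ-+ (m % n) t n)
    (trans (cong (λ u → (u ℕ.+ t % n) % n) (m%n%n≡m%n m n)) (sym (%-distribˡ-+ m t n)))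

  ⊞-⊞ : ∀ j s t → (j ⊞ s) ⊞ t ≡ j ⊞ (s ℕ.+ t)
  ⊞-⊞ j s t = Fin.toℕ-injective (trans (toℕ-⊞ (j ⊞ s) t) (trans (cong (λ u → (u ℕ.+ t) % n) (toℕ-⊞ j s))
    (trans ([m%n+t]%n (toℕ j ℕ.+ s) t) (trans (cong (_% n) (ℕ.+-assoc (toℕ j) s t)) (sym (toℕ-⊞ j (s ℕ.+ t)))))))

  ⊞-0 : ∀ j → j ⊞ 0 ≡ j
  ⊞-0 j = Fin.toℕ-injective (trans (toℕ-⊞ j 0) (trans (cong (_% n) (ℕ.+-identityʳ (toℕ j))) (m<n⇒m%n≡m (Fin.toℕ<n j))))

  ⊞-n : ∀ j → j ⊞ n ≡ j
  ⊞-n j = Fin.toℕ-injective (trans (toℕ-⊞ j n) (trans ([m+n]%n≡m%n (toℕ j) n) (m<n⇒m%n≡m (Fin.toℕ<n j))))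

  ⊞-retract : ∀ j {t} → t ℕ.< n → toℕ ((j ⊞ t) ⊞ (n ∸ toℕ j)) ≡ t
  ⊞-retract j {t} t<n = trans (cong toℕ (⊞-⊞ j t (n ∸ toℕ j))) (trans (toℕ-⊞ j (t ℕ.+ (n ∸ toℕ j)))
    (trans (cong (_% n) rearrange) (trans ([m+n]%n≡m%n t n) (m<n⇒m%n≡m t<n))))
    where
    rearrange : toℕ j ℕ.+ (t ℕ.+ (n ∸ toℕ j)) ≡ t ℕ.+ n
    rearrange = trans (sym (ℕ.+-assoc (toℕ j) t (n ∸ toℕ j))) (trans (cong (ℕ._+ (n ∸ toℕ j)) (ℕ.+-comm (toℕ j) t))
      (trans (ℕ.+-assoc t (toℕ j) (n ∸ toℕ j)) (cong (t ℕ.+_) (ℕ.m+[n∸m]≡n (ℕ.<⇒≤ (Fin.toℕ<n j))))))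

  ⊞-injective : ∀ j {s t} → s ℕ.< n → t ℕ.< n → j ⊞ s ≡ j ⊞ t → s ≡ t
  ⊞-injective j s<n t<n eq = trans (sym (⊞-retract j s<n)) (trans (cong (λ u → toℕ (u ⊞ (n ∸ toℕ j))) eq) (⊞-retract j t<n))

  ⊞-∸ : ∀ j {s} → s ≤ n → (j ⊞ s) ⊞ (n ∸ s) ≡ j
  ⊞-∸ j {s} s≤n = trans (⊞-⊞ j s (n ∸ s)) (trans (cong (j ⊞_) (ℕ.m+[n∸m]≡n s≤n)) (⊞-n j))

  ∸-⊞ : ∀ j {s} → s ≤ n → (j ⊞ (n ∸ s)) ⊞ s ≡ j
  ∸-⊞ j {s} s≤n = trans (⊞-⊞ j (n ∸ s) s) (trans (cong (j ⊞_) (ℕ.m∸n+n≡m s≤n)) (⊞-n j))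

  ∈-interval⁻ : ∀ {k j x} → x ∈ˢ interval k j → ∃[ t ] (t ℕ.< k × j ⊞ t ≡ x)
  ∈-interval⁻ {k} {j} x∈ with ∈-⋃⁻ (j ⊞_) (upTo k) x∈
  ... | t , t∈ , eq = t , ∈-upTo⁻ t∈ , eq

  ∈-interval⁺ : ∀ {k j t} → t ℕ.< k → j ⊞ t ∈ˢ interval k j
  ∈-interval⁺ {k} {j} t<k = ∈-⋃⁺ (j ⊞_) (∈-upTo⁺ t<k)

  module Hypercycle (k : ℕ) (0<k : 0 ℕ.< k) (k<n : k ℕ.< n) where

    private
      t<n : (t : Fin k) → toℕ t ℕ.< n
      t<n t = ℕ.<-trans (Fin.toℕ<n t) k<n

    -- The start of a proper cyclic interval is its only element whose predecessor lies outside. If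
    -- i = j + t + 1 were another element of the interval from j, its predecessor j + t would equal
    -- i + s with s < k, giving s + 1 ≡ 0 modulo n although s + 1 ≤ k < n. Hence `deduplicate`
    -- removes no edge.
    interval-injective : ∀ {i j : Fin n} → interval k i ≡ interval k j → i ≡ j
    interval-injective {i} {j} eq with ∈-interval⁻ {k} (subst (i ∈ˢ_) eq (subst (_∈ˢ interval k i) (⊞-0 i) (∈-interval⁺ {k} 0<k)))
    ... | zero , _ , j≡i = sym (trans (sym (⊞-0 j)) j≡i)
    ... | suc t , t<k , j⊞≡i with ∈-interval⁻ {k} (subst (j ⊞ t ∈ˢ_) (sym eq) (∈-interval⁺ {k} (ℕ.<-trans (ℕ.n<1+n t) t<k)))
    ...   | s , s<k , i⊞s≡ = ⊥-elim (ℕ.1+n≢0 (⊞-injective (j ⊞ t) (ℕ.≤-<-trans s<k k<n) (ℕ.<-trans 0<k k<n)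
        (trans (trans (sym (⊞-⊞ (j ⊞ t) 1 s)) (cong (_⊞ s) (trans (⊞-⊞ j t 1) (trans (cong (j ⊞_) (ℕ.+-comm t 1)) j⊞≡i))))
          (trans i⊞s≡ (sym (⊞-0 (j ⊞ t)))))))

    edges-hypercycle : edges (hypercycle n k) ≡ tabulate (interval k)
    edges-hypercycle = trans (deduplicate-unique (Unique.map⁺ interval-injective (Unique.allFin⁺ n)))
      (map-tabulate (λ j → j) (interval k))

    codegree : Fin n → Fin n → ℕ
    codegree i l = length (filter (λ e → (i ∈? e) ×-dec (l ∈? e)) (edges (hypercycle n k)))

    member : Fin n → Fin n → ℕ
    member i j = indicator (i ∈? interval k j)

    member-sum : ∀ i j → sumℕ (λ (t : Fin k) → indicator (j ⊞ toℕ t Fin.≟ i)) ≡ member i j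
    member-sum i j = sum-indicator (λ t → j ⊞ toℕ t Fin.≟ i) (i ∈? interval k j)
      (λ i∈ → let t , t<k , eq = ∈-interval⁻ {k} i∈ in
        fromℕ< t<k , trans (cong (j ⊞_) (Fin.toℕ-fromℕ< t<k)) eq)
      (λ t eq → subst (_∈ˢ interval k j) eq (∈-interval⁺ {k} (Fin.toℕ<n t)))
      (λ s t eqs eqt → Fin.toℕ-injective (⊞-injective j (t<n s) (t<n t) (trans eqs (sym eqt))))

    codegree-members : ∀ i l → codegree i l ≡ sumℕ (λ j → member i j ℕ.* member l j)
    codegree-members i l = trans (cong (λ es → length (filter (λ e → (i ∈? e) ×-dec (l ∈? e)) es)) edges-hypercycle)
      (trans (length-filter-tabulate (λ e → (i ∈? e) ×-dec (l ∈? e)) (interval k))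
             (sumℕ-cong {n} (λ j → indicator-× (i ∈? interval k j) (l ∈? interval k j))))

    -- The edges through `i` are those starting at i - s for s < k, each occurring once.
    sum-members : ∀ i (g : Fin n → ℕ) →
      sumℕ (λ j → member i j ℕ.* g j) ≡ sumℕ (λ (s : Fin k) → g (i ⊞ (n ∸ toℕ s)))
    sum-members i g = trans (sumℕ-cong {n} λ j → trans (cong (ℕ._* g j) (sym (member-sum i j)))
        (*-distribʳ-sumℕ (g j) (λ (t : Fin k) → indicator (j ⊞ toℕ t Fin.≟ i))))
      (trans (sumℕ-comm (λ (j : Fin n) (s : Fin k) → indicator (j ⊞ toℕ s Fin.≟ i) ℕ.* g j))
        (sumℕ-cong {k} λ s → trans
          (sum-single ℕ.+-0-commutativeMonoid (λ j → indicator (j ⊞ toℕ s Fin.≟ i) ℕ.* g j) (i ⊞ (n ∸ toℕ s))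
            (λ j j≢ → cong (ℕ._* g j) (indicator-false (j ⊞ toℕ s Fin.≟ i)
              λ eq → j≢ (trans (sym (⊞-∸ j (ℕ.<⇒≤ (t<n s)))) (cong (_⊞ (n ∸ toℕ s)) eq)))))
          (trans (cong (ℕ._* g (i ⊞ (n ∸ toℕ s))) (indicator-true (i ⊞ (n ∸ toℕ s) ⊞ toℕ s Fin.≟ i) (∸-⊞ i (ℕ.<⇒≤ (t<n s)))))
                 (ℕ.*-identityˡ (g (i ⊞ (n ∸ toℕ s)))))))

    codegree-sum : ∀ i l → codegree i l ≡
      sumℕ (λ (s : Fin k) → sumℕ (λ (t : Fin k) → indicator (i ⊞ (n ∸ toℕ s) ⊞ toℕ t Fin.≟ l)))
    codegree-sum i l = trans (codegree-members i l) (trans (sum-members i (member l))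
      (sumℕ-cong {k} (λ s → sym (member-sum l (i ⊞ (n ∸ toℕ s))))))

    degree : ∀ i → codegree i i ≡ k
    degree i = trans (codegree-members i i) (trans (sumℕ-cong {n} (λ j →
        trans (indicator-idem (i ∈? interval k j)) (sym (ℕ.*-identityʳ (member i j)))))
      (trans (sum-members i (λ _ → 1)) (sum-ones k)))
      where
      sum-ones : ∀ k → sumℕ (λ (_ : Fin k) → 1) ≡ k
      sum-ones zero = refl
      sum-ones (suc k) = cong suc (sum-ones k)

    adjacency-codegree : ∀ i l → adjacency (hypercycle n k) i l ℕ.+ k ℕ.* indicator (i Fin.≟ l) ≡ codegree i l
    adjacency-codegree i l with i Fin.≟ l
    ... | yes refl = trans (ℕ.*-identityʳ k) (sym (degree i))
    ... | no _     = trans (cong (codegree i l ℕ.+_) (ℕ.*-zeroʳ k)) (ℕ.+-identityʳ (codegree i l))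

-- Integers as reals, and the eigenvalue equation

opaque
  unfolding _⊕_

  ι : ℤ → ℝ
  ι = fromℤ

  ι-+ : ∀ a b → ι (a ℤ.+ b) ≈ ι a ⊕ ι b
  ι-+ a b = pointwise λ _ → /1-+ a b

  ι-* : ∀ a b → ι (a ℤ.* b) ≈ ι a ⊗ ι b
  ι-* a b = pointwise λ _ → /1-* a b

  ι-0 : ι ℤ.0ℤ ≈ 𝟘
  ι-0 = pointwise λ _ → refl

  ι-1 : ι ℤ.1ℤ ≈ 𝟙
  ι-1 = pointwise λ _ → refl

  ι-fromℚ : ∀ m → ι m ≡ fromℚ (m /1)
  ι-fromℚ m = refl

  seq-ι : ∀ m n → seq (ι m) n ≡ m /1
  seq-ι m n = refl

pos-ι-factor : ∀ {m y} → Pos y → Pos (ι m ⊗ y) → ℤ.0ℤ ℤ.< m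
pos-ι-factor {m} {y} pos-y pos-my = /1-cancel-< {ℤ.0ℤ} {m}
  (pos-fromℚ-factor pos-y (subst (λ z → Pos (z ⊗ y)) (ι-fromℚ m) pos-my))

ν : ℕ → ℝ
ν m = ι (ℤ.+ m)

open CommutativeRing ℝ-commutativeRing using (+-commutativeMonoid)

open SemiringSum semiring using ()
  renaming ( sum to sumℝ; ∑-comm to sumℝ-comm; ∑-distrib-+ to sumℝ-⊕
           ; *-distribʳ-sum to ⊗-distribʳ-sumℝ; *-distribˡ-sum to ⊗-distribˡ-sumℝ
           ; ∑-permute to sumℝ-permute )

sumℝ-cong : ∀ n {f g : Fin n → ℝ} → (∀ i → f i ≈ g i) → sumℝ f ≈ sumℝ g
sumℝ-cong zero f≈g = ≈-refl
sumℝ-cong (suc n) f≈g = ⊕-cong (f≈g Fin.zero) (sumℝ-cong n (λ i → f≈g (Fin.suc i)))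

ν-sum : ∀ {n} (f : Fin n → ℕ) → ν (sumℕ f) ≈ sumℝ (λ i → ν (f i))
ν-sum {zero} f = ι-0
ν-sum {suc n} f = ≈-trans (ι-+ (ℤ.+ f Fin.zero) (ℤ.+ sumℕ (f ∘ Fin.suc))) (⊕-congˡ (ν-sum (f ∘ Fin.suc)))

≡⇒≈ : ∀ {x y} → x ≡ y → x ≈ y
≡⇒≈ refl = ≈-refl

sum-indicator-⊗ : ∀ {n} (v : Fin n → ℝ) x → sumℝ (λ l → ν (indicator (x Fin.≟ l)) ⊗ v l) ≈ v x
sum-indicator-⊗ v x = ≈-trans (sum-single +-commutativeMonoid (λ l → ν (indicator (x Fin.≟ l)) ⊗ v l) x
    (λ l l≢x → ≈-trans (⊗-congʳ (≈-trans (≡⇒≈ (cong ν (indicator-false (x Fin.≟ l) (l≢x ∘ sym)))) ι-0)) (⊗-zeroˡ (v l))))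
  (≈-trans (⊗-congʳ (≈-trans (≡⇒≈ (cong ν (indicator-true (x Fin.≟ x) refl))) ι-1)) (⊗-identityˡ (v x)))
-- Bridges the transparent operations inside `IsEigenvalue` and the opaque ones: their representing
-- sequences agree term by term.
seq-sum : ∀ {n} {f g : Fin n → ℝ} → (∀ i t → seq (f i) t ≡ seq (g i) t) → ∀ t → seq (sum f) t ≡ seq (sumℝ g) t
seq-sum {zero} f≗g t = sym (seq-𝟘 t)
seq-sum {suc n} {f} {g} f≗g t = trans
  (cong₂ ℚ._+_ (f≗g Fin.zero t) (seq-sum (λ i → f≗g (Fin.suc i)) t))
  (sym (seq-⊕ (g Fin.zero) (sumℝ (g ∘ Fin.suc)) t))

module _ {n} (A : Fin n → Fin n → ℕ) (v : Fin n → ℝ) where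

  private
    seq-*ᵥ : ∀ i t → seq (((λ i j → fromℕ (A i j)) *ᵥ v) i) t ≡ seq (sumℝ (λ j → ν (A i j) ⊗ v j)) t
    seq-*ᵥ i t = seq-sum {n} {λ j → fromℕ (A i j) * v j} {λ j → ν (A i j) ⊗ v j}
      (λ j t → trans (cong (ℚ._* seq (v j) t) (sym (seq-ι (ℤ.+ A i j) t))) (sym (seq-⊗ (ν (A i j)) (v j) t))) t

    seq-eigen : ∀ μ i t → seq (((λ i j → fromℕ (A i j)) *ᵥ v) i) t ℚ.- seq (μ * v i) t
                        ≡ seq (sumℝ (λ j → ν (A i j) ⊗ v j)) t ℚ.- seq (μ ⊗ v i) t
    seq-eigen μ i t = cong₂ ℚ._-_ (seq-*ᵥ i t) (sym (seq-⊗ μ (v i) t))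

  eigen-equation⁺ : ∀ μ i → sumℝ (λ j → ν (A i j) ⊗ v j) ≈ μ ⊗ v i → ((λ i j → fromℕ (A i j)) *ᵥ v) i ≃ μ * v i
  eigen-equation⁺ μ i (equal eq) = Null-resp (λ t → sym (seq-eigen μ i t)) eq

  eigen-equation⁻ : ∀ μ i → ((λ i j → fromℕ (A i j)) *ᵥ v) i ≃ μ * v i → sumℝ (λ j → ν (A i j) ⊗ v j) ≈ μ ⊗ v i
  eigen-equation⁻ μ i eq = equal (Null-resp (seq-eigen μ i) eq)

  isEigenvalue⁺ : ∀ μ → ¬ (∀ i → v i ≃ 0ℝ) → (∀ i → sumℝ (λ j → ν (A i j) ⊗ v j) ≈ μ ⊗ v i) →
    IsEigenvalue (λ i j → fromℕ (A i j)) μ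
  isEigenvalue⁺ μ v≄0 eq = v , v≄0 , λ i → eigen-equation⁺ μ i (eq i)

opaque
  unfolding _⊕_ ι

  ≈𝟘⇒≃0 : ∀ {x} → x ≈ 𝟘 → x ≃ 0ℝ
  ≈𝟘⇒≃0 (equal x≃0) = x≃0

  ≃0⇒≈𝟘 : ∀ {x} → x ≃ 0ℝ → x ≈ 𝟘
  ≃0⇒≈𝟘 x≃0 = equal x≃0

  ≈ι⇒≃ : ∀ {x} m → x ≈ ι m → x ≃ fromℤ m
  ≈ι⇒≃ m (equal eq) = eq

  ≃⇒≈ι : ∀ {x} m → x ≃ fromℤ m → x ≈ ι m
  ≃⇒≈ι m eq = equal eq

opaque
  unfolding _⊕_

  -- Ring identities over the reals are checked termwise, where the rational solver is available.
  ⊕-⊖-cancel : ∀ x y → (x ⊕ y) ⊕ ⊖ y ≈ x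
  ⊕-⊖-cancel x y = pointwise λ t → cancel (seq x t) (seq y t)
    where
    open ℚSolver
    cancel : ∀ a b → (a ℚ.+ b) ℚ.- b ≡ a
    cancel = solve 2 (λ a b → (a :+ b) :- b := a) refl

  ⊖-⊕-cancel : ∀ x y → (x ⊕ ⊖ y) ⊕ y ≈ x
  ⊖-⊕-cancel x y = pointwise λ t → cancel (seq x t) (seq y t)
    where
    open ℚSolver
    cancel : ∀ a b → (a ℚ.- b) ℚ.+ b ≡ a
    cancel = solve 2 (λ a b → (a :- b) :+ b := a) refl

  ⊖-distribʳ : ∀ x y z → x ⊗ z ⊕ ⊖ (y ⊗ z) ≈ (x ⊕ ⊖ y) ⊗ z
  ⊖-distribʳ x y z = pointwise λ t → factor (seq x t) (seq y t) (seq z t)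
    where
    open ℚSolver
    factor : ∀ a b c → a ℚ.* c ℚ.- b ℚ.* c ≡ (a ℚ.- b) ℚ.* c
    factor = solve 3 (λ a b c → a :* c :- b :* c := (a :- b) :* c) refl

  double-⊖ : ∀ x y → x ⊕ (x ⊕ ⊖ (y ⊗ x)) ≈ ((𝟙 ⊕ 𝟙) ⊕ ⊖ y) ⊗ x
  double-⊖ x y = pointwise λ t → factor (seq x t) (seq y t)
    where
    open ℚSolver
    factor : ∀ a b → a ℚ.+ (a ℚ.- b ℚ.* a) ≡ ((1ℚ ℚ.+ 1ℚ) ℚ.- b) ℚ.* a
    factor = solve 2 (λ a b → a :+ (a :- b :* a) := ((con 1ℚ :+ con 1ℚ) :- b) :* a) refl

ι-⊖ : ∀ a b → ι (a ℤ.- b) ≈ ι a ⊕ ⊖ ι b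
ι-⊖ a b = ≈-trans (≈-sym (⊕-⊖-cancel (ι (a ℤ.- b)) (ι b)))
  (⊕-congʳ (≈-trans (≈-sym (ι-+ (a ℤ.- b) b)) (≡⇒≈ (cong ι (cancel a b)))))
  where
  cancel : ∀ a b → (a ℤ.- b) ℤ.+ b ≡ a
  cancel a b = trans (ℤ.+-assoc a (ℤ.- b) b) (trans (cong (λ c → a ℤ.+ c) (ℤ.+-inverseˡ b)) (ℤ.+-identityʳ a))

ι-2-minus : ∀ q x → x ⊕ (x ⊕ ⊖ (ι q ⊗ x)) ≈ ι (ℤ.+ 2 ℤ.- q) ⊗ x
ι-2-minus q x = ≈-trans (double-⊖ x (ι q)) (⊗-congʳ (≈-sym (≈-trans (ι-⊖ (ℤ.+ 2) q)
  (⊕-congʳ (≈-trans (ι-+ ℤ.1ℤ ℤ.1ℤ) (⊕-cong ι-1 ι-1))))))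

-- The action of A + kI on vectors

module Action (n : ℕ) .{{_ : ℕ.NonZero n}} (k : ℕ) (0<k : 0 ℕ.< k) (k<n : k ℕ.< n) where

  open Cyclic n
  open Hypercycle k 0<k k<n

  -- A + kI, which is ∑ₑ 1ₑ 1ₑᵀ over the edges e because every vertex has degree k.
  window : (Fin n → ℝ) → Fin n → ℝ
  window v i = sumℝ {k} (λ s → sumℝ {k} (λ t → v (i ⊞ (n ∸ toℕ s) ⊞ toℕ t)))

  private
    indicators : Fin n → Fin k → Fin k → Fin n → ℕ
    indicators i s t l = indicator (i ⊞ (n ∸ toℕ s) ⊞ toℕ t Fin.≟ l)

    ν-codegree : ∀ i l → ν (codegree i l) ≈ sumℝ {k} (λ s → sumℝ {k} (λ t → ν (indicators i s t l)))
    ν-codegree i l = ≈-trans (≡⇒≈ (cong ν (codegree-sum i l)))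
      (≈-trans (ν-sum (λ s → sumℕ {k} (λ t → indicators i s t l)))
        (sumℝ-cong k (λ s → ν-sum (λ t → indicators i s t l))))

  codegree-window : ∀ v i → sumℝ {n} (λ l → ν (codegree i l) ⊗ v l) ≈ window v i
  codegree-window v i = begin
      sumℝ {n} (λ l → ν (codegree i l) ⊗ v l)
        ≈⟨ sumℝ-cong n (λ l → ⊗-congʳ (ν-codegree i l)) ⟩
      sumℝ {n} (λ l → sumℝ {k} (λ s → sumℝ {k} (λ t → ν (indicators i s t l))) ⊗ v l)
        ≈⟨ sumℝ-cong n (λ l → ≈-trans (⊗-distribʳ-sumℝ (v l) (λ s → sumℝ {k} (λ t → ν (indicators i s t l))))
             (sumℝ-cong k (λ s → ⊗-distribʳ-sumℝ (v l) (λ t → ν (indicators i s t l))))) ⟩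
      sumℝ {n} (λ l → sumℝ {k} (λ s → sumℝ {k} (λ t → ν (indicators i s t l) ⊗ v l)))
        ≈⟨ sumℝ-comm (λ l s → sumℝ {k} (λ t → ν (indicators i s t l) ⊗ v l)) ⟩
      sumℝ {k} (λ s → sumℝ {n} (λ l → sumℝ {k} (λ t → ν (indicators i s t l) ⊗ v l)))
        ≈⟨ sumℝ-cong k (λ s → sumℝ-comm (λ l t → ν (indicators i s t l) ⊗ v l)) ⟩
      sumℝ {k} (λ s → sumℝ {k} (λ t → sumℝ {n} (λ l → ν (indicators i s t l) ⊗ v l)))
        ≈⟨ sumℝ-cong k (λ s → sumℝ-cong k (λ t → sum-indicator-⊗ v (i ⊞ (n ∸ toℕ s) ⊞ toℕ t))) ⟩
      window v i ∎
    where open SetoidReasoning setoid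

  adjacency-window : ∀ v i →
    sumℝ {n} (λ l → ν (adjacency (hypercycle n k) i l) ⊗ v l) ⊕ ν k ⊗ v i ≈ window v i
  adjacency-window v i = begin
      sumℝ {n} (λ l → ν (a l) ⊗ v l) ⊕ ν k ⊗ v i
        ≈⟨ ⊕-congˡ (⊗-congˡ (≈-sym (sum-indicator-⊗ v i))) ⟩
      sumℝ {n} (λ l → ν (a l) ⊗ v l) ⊕ ν k ⊗ sumℝ {n} (λ l → ν (indicator (i Fin.≟ l)) ⊗ v l)
        ≈⟨ ⊕-congˡ (⊗-distribˡ-sumℝ (ν k) (λ l → ν (indicator (i Fin.≟ l)) ⊗ v l)) ⟩
      sumℝ {n} (λ l → ν (a l) ⊗ v l) ⊕ sumℝ {n} (λ l → ν k ⊗ (ν (indicator (i Fin.≟ l)) ⊗ v l))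
        ≈⟨ ≈-sym (sumℝ-⊕ (λ l → ν (a l) ⊗ v l) (λ l → ν k ⊗ (ν (indicator (i Fin.≟ l)) ⊗ v l))) ⟩
      sumℝ {n} (λ l → ν (a l) ⊗ v l ⊕ ν k ⊗ (ν (indicator (i Fin.≟ l)) ⊗ v l))
        ≈⟨ sumℝ-cong n combine ⟩
      sumℝ {n} (λ l → ν (codegree i l) ⊗ v l)
        ≈⟨ codegree-window v i ⟩
      window v i ∎
    where
    open SetoidReasoning setoid
    open CommutativeRing ℝ-commutativeRing using (distribʳ)
    a : Fin n → ℕ
    a = adjacency (hypercycle n k) i
    combine : ∀ l → ν (a l) ⊗ v l ⊕ ν k ⊗ (ν (indicator (i Fin.≟ l)) ⊗ v l) ≈ ν (codegree i l) ⊗ v l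
    combine l = begin
      ν (a l) ⊗ v l ⊕ ν k ⊗ (ν d ⊗ v l)     ≈⟨ ⊕-congˡ (≈-sym (⊗-assoc (ν k) (ν d) (v l))) ⟩
      ν (a l) ⊗ v l ⊕ (ν k ⊗ ν d) ⊗ v l     ≈⟨ ⊕-congˡ (⊗-congʳ (≈-trans (≈-sym (ι-* (ℤ.+ k) (ℤ.+ d))) (≡⇒≈ (cong ι (sym (ℤ.pos-* k d)))))) ⟩
      ν (a l) ⊗ v l ⊕ ν (k ℕ.* d) ⊗ v l     ≈⟨ ≈-sym (distribʳ (v l) (ν (a l)) (ν (k ℕ.* d))) ⟩
      (ν (a l) ⊕ ν (k ℕ.* d)) ⊗ v l         ≈⟨ ⊗-congʳ (≈-trans (≈-sym (ι-+ (ℤ.+ a l) (ℤ.+ (k ℕ.* d)))) (≡⇒≈ (cong ν (adjacency-codegree i l)))) ⟩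
      ν (codegree i l) ⊗ v l                ∎
      where
      d : ℕ
      d = indicator (i Fin.≟ l)

  -- Integrality stated for A + kI, whose spectrum is that of A shifted by the integer k.
  WindowIntegral : Set
  WindowIntegral = ∀ v w → ¬ (∀ i → v i ≈ 𝟘) → (∀ i → window v i ≈ w ⊗ v i) → ∃[ m ] (w ≈ ι m)

  integral⇒window : Integral (hypercycle n k) → WindowIntegral
  integral⇒window integral v w v≉0 window≈ = m ℤ.+ ℤ.+ k , (begin
      w                        ≈⟨ ≈-sym (⊖-⊕-cancel w (ν k)) ⟩
      (w ⊕ ⊖ ν k) ⊕ ν k        ≈⟨ ⊕-congʳ (≃⇒≈ι m (proj₂ integer)) ⟩
      ι m ⊕ ν k                ≈⟨ ≈-sym (ι-+ m (ℤ.+ k)) ⟩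
      ι (m ℤ.+ ℤ.+ k)          ∎)
    where
    open SetoidReasoning setoid
    row : Fin n → ℝ
    row i = sumℝ (λ l → ν (adjacency (hypercycle n k) i l) ⊗ v l)
    row≈ : ∀ i → row i ≈ (w ⊕ ⊖ ν k) ⊗ v i
    row≈ i = begin
      row i                                  ≈⟨ ≈-sym (⊕-⊖-cancel (row i) (ν k ⊗ v i)) ⟩
      (row i ⊕ ν k ⊗ v i) ⊕ ⊖ (ν k ⊗ v i)    ≈⟨ ⊕-congʳ (≈-trans (adjacency-window v i) (window≈ i)) ⟩
      w ⊗ v i ⊕ ⊖ (ν k ⊗ v i)                ≈⟨ ⊖-distribʳ w (ν k) (v i) ⟩
      (w ⊕ ⊖ ν k) ⊗ v i                      ∎
    integer : ∃[ m ] (w ⊕ ⊖ ν k ≃ fromℤ m)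
    integer = integral (w ⊕ ⊖ ν k) (isEigenvalue⁺ (adjacency (hypercycle n k)) v (w ⊕ ⊖ ν k)
      (λ v≃0 → v≉0 (λ i → ≃0⇒≈𝟘 (v≃0 i))) row≈)
    m : ℤ
    m = proj₁ integer

  window⇒integral : WindowIntegral → Integral (hypercycle n k)
  window⇒integral windowIntegral μ (v , v≄0 , Av≃μv) = m ℤ.- ℤ.+ k , ≈ι⇒≃ (m ℤ.- ℤ.+ k) (begin
      μ                        ≈⟨ ≈-sym (⊕-⊖-cancel μ (ν k)) ⟩
      (μ ⊕ ν k) ⊕ ⊖ ν k        ≈⟨ ⊕-congʳ (proj₂ integer) ⟩
      ι m ⊕ ⊖ ν k              ≈⟨ ≈-sym (ι-⊖ m (ℤ.+ k)) ⟩
      ι (m ℤ.- ℤ.+ k)          ∎)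
    where
    open SetoidReasoning setoid
    open CommutativeRing ℝ-commutativeRing using (distribʳ)
    window≈ : ∀ i → window v i ≈ (μ ⊕ ν k) ⊗ v i
    window≈ i = begin
      window v i                                                                  ≈⟨ ≈-sym (adjacency-window v i) ⟩
      sumℝ (λ l → ν (adjacency (hypercycle n k) i l) ⊗ v l) ⊕ ν k ⊗ v i           ≈⟨ ⊕-congʳ (eigen-equation⁻ (adjacency (hypercycle n k)) v μ i (Av≃μv i)) ⟩
      μ ⊗ v i ⊕ ν k ⊗ v i                                                         ≈⟨ ≈-sym (distribʳ (v i) μ (ν k)) ⟩
      (μ ⊕ ν k) ⊗ v i                                                             ∎
    integer : ∃[ m ] (μ ⊕ ν k ≈ ι m)
    integer = windowIntegral v (μ ⊕ ν k) (λ v≈0 → v≄0 (λ i → ≈𝟘⇒≃0 (v≈0 i))) window≈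
    m : ℤ
    m = proj₁ integer

-- Sines of multiples of π/n

opaque
  unfolding _⊕_

  square-⊗ : ∀ x y → (x ⊗ y) ⊗ (x ⊗ y) ≈ (x ⊗ x) ⊗ (y ⊗ y)
  square-⊗ x y = pointwise λ t → swap (seq x t) (seq y t)
    where
    open ℚSolver
    swap : ∀ a b → (a ℚ.* b) ℚ.* (a ℚ.* b) ≡ (a ℚ.* a) ℚ.* (b ℚ.* b)
    swap = solve 2 (λ a b → (a :* b) :* (a :* b) := (a :* a) :* (b :* b)) refl

  square-⊖ : ∀ x → (⊖ x) ⊗ (⊖ x) ≈ x ⊗ x
  square-⊖ x = pointwise λ t → neg (seq x t)
    where
    open ℚSolver
    neg : ∀ a → (ℚ.- a) ℚ.* (ℚ.- a) ≡ a ℚ.* a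
    neg = solve 1 (λ a → (:- a) :* (:- a) := a :* a) refl

  difference-of-squares : ∀ x y → (x ⊕ y) ⊗ x ≈ (x ⊗ x ⊕ ⊖ (y ⊗ y)) ⊕ (x ⊕ y) ⊗ y
  difference-of-squares x y = pointwise λ t → factor (seq x t) (seq y t)
    where
    open ℚSolver
    factor : ∀ a b → (a ℚ.+ b) ℚ.* a ≡ (a ℚ.* a ℚ.- b ℚ.* b) ℚ.+ (a ℚ.+ b) ℚ.* b
    factor = solve 2 (λ a b → (a :+ b) :* a := (a :* a :- b :* b) :+ (a :+ b) :* b) refl

  regroup-even : ∀ a b c d → ((a ⊕ b) ⊕ ⊖ d) ⊕ ((c ⊕ d) ⊕ ⊖ b) ≈ a ⊕ c
  regroup-even a b c d = pointwise λ t → regroup (seq a t) (seq b t) (seq c t) (seq d t)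
    where
    open ℚSolver
    regroup : ∀ a b c d → ((a ℚ.+ b) ℚ.- d) ℚ.+ ((c ℚ.+ d) ℚ.- b) ≡ a ℚ.+ c
    regroup = solve 4 (λ a b c d → ((a :+ b) :- d) :+ ((c :+ d) :- b) := a :+ c) refl

-- Cancel the positive factor in (x + y) x = (x + y) y.
pos-unique-root : ∀ {x y} → Pos (x ⊕ y) → x ⊗ x ≈ y ⊗ y → x ≈ y
pos-unique-root {x} {y} pos x²≈y² = pos-cancel-≈ pos (begin
    (x ⊕ y) ⊗ x                                ≈⟨ difference-of-squares x y ⟩
    (x ⊗ x ⊕ ⊖ (y ⊗ y)) ⊕ (x ⊕ y) ⊗ y          ≈⟨ ⊕-congʳ (≈-trans (⊕-congʳ x²≈y²) (⊖-inverseʳ (y ⊗ y))) ⟩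
    𝟘 ⊕ (x ⊕ y) ⊗ y                            ≈⟨ ⊕-identityˡ ((x ⊕ y) ⊗ y) ⟩
    (x ⊕ y) ⊗ y                                ∎)
  where
  open SetoidReasoning setoid
  open CommutativeRing ℝ-commutativeRing using () renaming (-‿inverseʳ to ⊖-inverseʳ)

-- For x = 2 cos (π/n), s i = sin (iπ/n) / sin (π/n).
module Sine (n′ : ℕ) (x : ℝ) (root : 𝕊 (suc (suc n′)) x ≈ 𝟘) (positive : ∀ l → l ≤ n′ → Pos (𝕊 (suc l) x)) where

  n : ℕ
  n = suc (suc n′)

  s : ℕ → ℝ
  s i = 𝕊 i x

  sq : ℕ → ℝ
  sq i = s i ⊗ s i

  product : ∀ a b m → s (b ℕ.+ m) ⊗ s (a ℕ.+ m) ≈ s m ⊗ s (a ℕ.+ (b ℕ.+ m)) ⊕ s b ⊗ s a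
  product a b m = 𝕊-product a b m x

  pos-s : ∀ {i} → 0 ℕ.< i → i ℕ.< n → Pos (s i)
  pos-s {suc i} _ (ℕ.s≤s (ℕ.s≤s i≤n′)) = positive i i≤n′

  private
    drop-root : ∀ {m} y z → s m ≈ 𝟘 → s m ⊗ y ⊕ z ≈ z
    drop-root y z sm≈0 = ≈-trans (⊕-congʳ (≈-trans (⊗-congʳ sm≈0) (⊗-zeroˡ y))) (⊕-identityˡ z)

    -- In `product` with m = n the root annihilates the first term on the right.
    shift-product : ∀ a b → s (b ℕ.+ n) ⊗ s (a ℕ.+ n) ≈ s b ⊗ s a
    shift-product a b = ≈-trans (product a b n) (drop-root {n} (s (a ℕ.+ (b ℕ.+ n))) (s b ⊗ s a) root)

    -- Its value is -1, since sin (π + θ) = -sin θ. The relation σ² = 1 already yields the period 2n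
    -- of `s` and the symmetries of its square.
    σ : ℝ
    σ = s (suc n)

    σ² : σ ⊗ σ ≈ 𝟙
    σ² = ≈-trans (shift-product 1 1) (⊗-identityˡ 𝟙)

    shift : ∀ b → s (b ℕ.+ n) ≈ s b ⊗ σ
    shift b = begin
      s (b ℕ.+ n)                ≈⟨ ≈-sym (⊗-identityʳ (s (b ℕ.+ n))) ⟩
      s (b ℕ.+ n) ⊗ 𝟙            ≈⟨ ⊗-congˡ (≈-sym σ²) ⟩
      s (b ℕ.+ n) ⊗ (σ ⊗ σ)      ≈⟨ ≈-sym (⊗-assoc (s (b ℕ.+ n)) σ σ) ⟩
      s (b ℕ.+ n) ⊗ σ ⊗ σ        ≈⟨ ⊗-congʳ (shift-product 1 b) ⟩
      s b ⊗ 𝟙 ⊗ σ                ≈⟨ ⊗-congʳ (⊗-identityʳ (s b)) ⟩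
      s b ⊗ σ                    ∎
      where open SetoidReasoning setoid

  s-periodic : ∀ b q → s (b ℕ.+ q ℕ.* (n ℕ.+ n)) ≈ s b
  s-periodic b zero = ≡⇒≈ (cong s (ℕ.+-identityʳ b))
  s-periodic b (suc q) = begin
      s (b ℕ.+ (n ℕ.+ n ℕ.+ q ℕ.* (n ℕ.+ n)))    ≡⟨ cong s (rearrange b n (q ℕ.* (n ℕ.+ n))) ⟩
      s (b ℕ.+ q ℕ.* (n ℕ.+ n) ℕ.+ n ℕ.+ n)      ≈⟨ shift (b ℕ.+ q ℕ.* (n ℕ.+ n) ℕ.+ n) ⟩
      s (b ℕ.+ q ℕ.* (n ℕ.+ n) ℕ.+ n) ⊗ σ        ≈⟨ ⊗-congʳ (shift (b ℕ.+ q ℕ.* (n ℕ.+ n))) ⟩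
      s (b ℕ.+ q ℕ.* (n ℕ.+ n)) ⊗ σ ⊗ σ          ≈⟨ ⊗-assoc (s (b ℕ.+ q ℕ.* (n ℕ.+ n))) σ σ ⟩
      s (b ℕ.+ q ℕ.* (n ℕ.+ n)) ⊗ (σ ⊗ σ)        ≈⟨ ⊗-cong (s-periodic b q) σ² ⟩
      s b ⊗ 𝟙                                    ≈⟨ ⊗-identityʳ (s b) ⟩
      s b                                        ∎
    where
    open SetoidReasoning setoid
    rearrange : ∀ b n p → b ℕ.+ (n ℕ.+ n ℕ.+ p) ≡ b ℕ.+ p ℕ.+ n ℕ.+ n
    rearrange = solve 3 (λ b n p → b :+ (n :+ n :+ p) := b :+ p :+ n :+ n) refl
      where open ℕSolver

  sq-periodic : ∀ b q → sq (b ℕ.+ q ℕ.* n) ≈ sq b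
  sq-periodic b zero = ≡⇒≈ (cong sq (ℕ.+-identityʳ b))
  sq-periodic b (suc q) = ≈-trans (≡⇒≈ (cong sq (rearrange b n (q ℕ.* n))))
    (≈-trans (shift-product (b ℕ.+ q ℕ.* n) (b ℕ.+ q ℕ.* n)) (sq-periodic b q))
    where
    rearrange : ∀ b n p → b ℕ.+ (n ℕ.+ p) ≡ b ℕ.+ p ℕ.+ n
    rearrange = solve 3 (λ b n p → b :+ (n :+ p) := b :+ p :+ n) refl
      where open ℕSolver

  private
    reflect : ∀ a m → a ℕ.+ m ≡ n → 𝟘 ≈ s m ⊗ σ ⊕ s a
    reflect a m a+m≡n = begin
      𝟘                                        ≈⟨ ≈-sym (⊗-zeroˡ (s (suc m))) ⟩
      𝟘 ⊗ s (suc m)                            ≈⟨ ⊗-congʳ (≈-sym root) ⟩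
      s n ⊗ s (suc m)                          ≡⟨ cong (λ i → s i ⊗ s (suc m)) (sym a+m≡n) ⟩
      s (a ℕ.+ m) ⊗ s (suc m)                  ≈⟨ product 1 a m ⟩
      s m ⊗ s (suc (a ℕ.+ m)) ⊕ s a ⊗ 𝟙        ≈⟨ ⊕-cong (≡⇒≈ (cong (λ i → s m ⊗ s (suc i)) a+m≡n)) (⊗-identityʳ (s a)) ⟩
      s m ⊗ σ ⊕ s a                            ∎
      where open SetoidReasoning setoid

    negative-σ : ∀ a m → a ℕ.+ m ≡ n → s a ≈ ⊖ (s m ⊗ σ)
    negative-σ a m a+m≡n = ≈-sym (begin
      ⊖ (s m ⊗ σ)                          ≈⟨ ≈-sym (⊕-identityˡ (⊖ (s m ⊗ σ))) ⟩
      𝟘 ⊕ ⊖ (s m ⊗ σ)                      ≈⟨ ⊕-congʳ (reflect a m a+m≡n) ⟩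
      (s m ⊗ σ ⊕ s a) ⊕ ⊖ (s m ⊗ σ)        ≈⟨ ⊕-congʳ (⊕-comm (s m ⊗ σ) (s a)) ⟩
      (s a ⊕ s m ⊗ σ) ⊕ ⊖ (s m ⊗ σ)        ≈⟨ ⊕-⊖-cancel (s a) (s m ⊗ σ) ⟩
      s a                                  ∎)
      where open SetoidReasoning setoid

  sq-reflect : ∀ a m → a ℕ.+ m ≡ n → sq a ≈ sq m
  sq-reflect a m a+m≡n = begin
      s a ⊗ s a                            ≈⟨ ⊗-cong (negative-σ a m a+m≡n) (negative-σ a m a+m≡n) ⟩
      (⊖ (s m ⊗ σ)) ⊗ (⊖ (s m ⊗ σ))        ≈⟨ square-⊖ (s m ⊗ σ) ⟩
      (s m ⊗ σ) ⊗ (s m ⊗ σ)                ≈⟨ square-⊗ (s m) σ ⟩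
      sq m ⊗ (σ ⊗ σ)                       ≈⟨ ⊗-congˡ σ² ⟩
      sq m ⊗ 𝟙                             ≈⟨ ⊗-identityʳ (sq m) ⟩
      sq m                                 ∎
    where open SetoidReasoning setoid

  -- This is sin (π - θ) = sin θ. The sign is fixed by positivity of both values rather than by
  -- evaluating `σ`.
  s-reflect : ∀ a m → a ℕ.+ m ≡ n → 0 ℕ.< a → 0 ℕ.< m → s a ≈ s m
  s-reflect a m a+m≡n 0<a 0<m = pos-unique-root
    (pos-+ (pos-s 0<a (subst (a ℕ.<_) a+m≡n (ℕ.m<m+n a 0<m))) (pos-s 0<m (subst (m ℕ.<_) a+m≡n (ℕ.m<n+m m 0<a))))
    (sq-reflect a m a+m≡n)

  sq-residue : ∀ i → sq i ≈ sq (i ℕ.% n)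
  sq-residue i = ≈-trans (≡⇒≈ (cong sq (ℕ.m≡m%n+[m/n]*n i n))) (sq-periodic (i ℕ.% n) (i ℕ./ n))

  pos-sq : ∀ {i} → ¬ (n ∣ i) → Pos (sq i)
  pos-sq {i} n∤i = pos-resp-≈ (≈-sym (sq-residue i)) (pos-* pos-r pos-r)
    where
    pos-r : Pos (s (i ℕ.% n))
    pos-r = pos-s (ℕ.n≢0⇒n>0 (λ r≡0 → n∤i (ℕ.m%n≡0⇒n∣m i n r≡0))) (ℕ.m%n<n i n)

  -- The square of a sine depends only on the distance from the index to the nearest multiple of n:
  -- reduce modulo n, then reflect if the residue exceeds n/2.
  half-residue : ∀ i → ∃[ r ] (r ℕ.+ r ≤ n × sq i ≈ sq r)
  half-residue i with i ℕ.% n ℕ.+ i ℕ.% n ℕ.≤? n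
  ... | yes r+r≤n = i ℕ.% n , r+r≤n , sq-residue i
  ... | no r+r≰n  = n ∸ i ℕ.% n , bound , ≈-trans (sq-residue i) (sq-reflect (i ℕ.% n) (n ∸ i ℕ.% n) (ℕ.m+[n∸m]≡n r≤n))
    where
    r≤n : i ℕ.% n ≤ n
    r≤n = ℕ.<⇒≤ (ℕ.m%n<n i n)
    bound : (n ∸ i ℕ.% n) ℕ.+ (n ∸ i ℕ.% n) ≤ n
    bound = ℕ.+-cancelʳ-≤ n _ _ (ℕ.≤-trans (ℕ.+-monoʳ-≤ ((n ∸ i ℕ.% n) ℕ.+ (n ∸ i ℕ.% n)) (ℕ.<⇒≤ (ℕ.≰⇒> r+r≰n)))
      (ℕ.≤-reflexive (trans (interchange (n ∸ i ℕ.% n) (i ℕ.% n)) (cong₂ ℕ._+_ (ℕ.m∸n+n≡m r≤n) (ℕ.m∸n+n≡m r≤n)))))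
      where
      interchange : ∀ a b → a ℕ.+ a ℕ.+ (b ℕ.+ b) ≡ (a ℕ.+ b) ℕ.+ (a ℕ.+ b)
      interchange = solve 2 (λ a b → a :+ a :+ (b :+ b) := (a :+ b) :+ (a :+ b)) refl
        where open ℕSolver

  -- Equivalently 2 sin² (jπ/n) > sin² (iπ/n) for all i.
  Dominant : ℕ → Set
  Dominant j = ∀ i → Pos (sq j ⊕ (sq j ⊕ ⊖ sq i))

  private
    dominant-by-residue : ∀ j → (∀ r → r ℕ.+ r ≤ n → Pos (sq j ⊕ (sq j ⊕ ⊖ sq r))) → Dominant j
    dominant-by-residue j dominant i with half-residue i
    ... | r , r+r≤n , sqi≈sqr = pos-resp-≈ (⊕-congˡ (⊕-congˡ (⊖-cong (≈-sym sqi≈sqr)))) (dominant r r+r≤n)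

    sq-step : ∀ q r → sq (r ℕ.+ q) ≈ s q ⊗ s (r ℕ.+ (r ℕ.+ q)) ⊕ sq r
    sq-step q r = product r r q

    -- For `q` = 0 the compared index is the maximising one; the product then vanishes and `y` alone
    -- provides positivity.
    pos-or-zero : ∀ q i {y} → Pos y → q ℕ.< n → 0 ℕ.< i → i ℕ.+ q ≤ n → Pos (y ⊕ s q ⊗ s i)
    pos-or-zero zero i {y} pos-y q<n 0<i i≤n = pos-resp-≈ (≈-sym (≈-trans (⊕-congˡ (⊗-zeroˡ (s i))) (⊕-identityʳ y))) pos-y
    pos-or-zero (suc q) i pos-y q<n 0<i i+q≤n = pos-+ pos-y (pos-* (pos-s ℕ.z<s q<n)
      (pos-s 0<i (ℕ.<-≤-trans (ℕ.m<m+n i ℕ.z<s) i+q≤n)))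

    complement : ∀ {r h m} → r ℕ.+ r ≤ m → m ≤ suc (h ℕ.+ h) → ∃[ q ] (r ℕ.+ q ≡ h)
    complement {r} {h} r+r≤m m≤ = h ∸ r , ℕ.m+[n∸m]≡n r≤h
      where
      r≤h : r ≤ h
      r≤h = ℕ.≮⇒≥ λ h<r → ℕ.<-irrefl refl (ℕ.≤-trans (ℕ.+-mono-≤ h<r h<r)
        (ℕ.≤-trans r+r≤m (ℕ.≤-trans m≤ (ℕ.≤-reflexive (sym (ℕ.+-suc h h))))))

  -- Here j is the residue nearest to n/2 from below. For r ≤ j the difference sq j - sq r = s (j -
  -- r) s (j + r) is nonnegative, and a second copy of sq j > 0 is left over.
  dominant-odd : ∀ j → 0 ℕ.< j → suc (j ℕ.+ j) ≡ n → Dominant j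
  dominant-odd j 0<j 1+2j≡n = dominant-by-residue j λ r r+r≤n →
    let q , r+q≡j = complement {r} {j} r+r≤n (ℕ.≤-reflexive (sym 1+2j≡n)) in dominant r q r+q≡j
    where
    j<n : j ℕ.< n
    j<n = subst (j ℕ.<_) 1+2j≡n (ℕ.s≤s (ℕ.m≤m+n j j))
    dominant : ∀ r q → r ℕ.+ q ≡ j → Pos (sq j ⊕ (sq j ⊕ ⊖ sq r))
    dominant r q refl = pos-resp-≈
      (⊕-congˡ (≈-sym (≈-trans (⊕-congʳ (sq-step q r)) (⊕-⊖-cancel (s q ⊗ s (r ℕ.+ (r ℕ.+ q))) (sq r)))))
      (pos-or-zero q (r ℕ.+ (r ℕ.+ q)) (pos-* (pos-s 0<j j<n) (pos-s 0<j j<n))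
        (ℕ.≤-<-trans (ℕ.m≤n+m q r) j<n) (ℕ.<-≤-trans 0<j (ℕ.m≤n+m (r ℕ.+ q) r))
        (subst (r ℕ.+ (r ℕ.+ q) ℕ.+ q ≤_) 1+2j≡n (ℕ.≤-trans (ℕ.≤-reflexive (rearrange r q)) (ℕ.n≤1+n _))))
      where
      rearrange : ∀ r q → r ℕ.+ (r ℕ.+ q) ℕ.+ q ≡ (r ℕ.+ q) ℕ.+ (r ℕ.+ q)
      rearrange = solve 2 (λ r q → r :+ (r :+ q) :+ q := (r :+ q) :+ (r :+ q)) refl
        where open ℕSolver

  -- Here n = 2h with h = 2r + d and j = r + d, so that sq h = sq j + sq r; and sq h is maximal.
  dominant-even : ∀ r d → 0 ℕ.< r → 0 ℕ.< d → (r ℕ.+ (r ℕ.+ d)) ℕ.+ (r ℕ.+ (r ℕ.+ d)) ≡ n → Dominant (r ℕ.+ d)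
  dominant-even r d 0<r 0<d h+h≡n = dominant-by-residue j λ p p+p≤n →
    let q , p+q≡h = complement {p} {h} p+p≤n (ℕ.m≤n⇒m≤1+n (ℕ.≤-reflexive (sym h+h≡n))) in dominant p q p+q≡h
    where
    j h : ℕ
    j = r ℕ.+ d
    h = r ℕ.+ j
    0<j : 0 ℕ.< j
    0<j = ℕ.<-≤-trans 0<r (ℕ.m≤m+n r d)
    0<h : 0 ℕ.< h
    0<h = ℕ.<-≤-trans 0<r (ℕ.m≤m+n r j)
    h<n : h ℕ.< n
    h<n = subst (h ℕ.<_) h+h≡n (ℕ.m<m+n h 0<h)
    d<n : d ℕ.< n
    d<n = ℕ.≤-<-trans (ℕ.≤-trans (ℕ.m≤n+m d r) (ℕ.m≤n+m j r)) h<n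
    sq-h : sq h ≈ sq j ⊕ sq r
    -- The relation sin² + cos² = 1 in disguise: the indices r + h and j add up to n, so reflection
    -- turns the product s j · s (r + h) into sq j.
    sq-h = ≈-trans (sq-step j r) (⊕-congʳ (⊗-congˡ (s-reflect (r ℕ.+ h) j
      (trans (rearrange r j) h+h≡n) (ℕ.<-≤-trans 0<r (ℕ.m≤m+n r h)) 0<j)))
      where
      rearrange : ∀ r j → r ℕ.+ (r ℕ.+ j) ℕ.+ j ≡ (r ℕ.+ j) ℕ.+ (r ℕ.+ j)
      rearrange = solve 2 (λ r j → r :+ (r :+ j) :+ j := (r :+ j) :+ (r :+ j)) refl
        where open ℕSolver
    dominant : ∀ p q → p ℕ.+ q ≡ h → Pos (sq j ⊕ (sq j ⊕ ⊖ sq p))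
    dominant p q p+q≡h = pos-resp-≈ (≈-sym eq)
      (pos-or-zero q (p ℕ.+ h) (pos-* (pos-s 0<d d<n) (pos-s 0<h h<n))
        (ℕ.≤-<-trans (subst (q ≤_) p+q≡h (ℕ.m≤n+m q p)) h<n) (ℕ.<-≤-trans 0<h (ℕ.m≤n+m h p))
        (ℕ.≤-reflexive (trans (trans (rearrange p h q) (cong (ℕ._+ h) p+q≡h)) h+h≡n)))
      where
      open SetoidReasoning setoid
      rearrange : ∀ p h q → p ℕ.+ h ℕ.+ q ≡ (p ℕ.+ q) ℕ.+ h
      rearrange = solve 3 (λ p h q → p :+ h :+ q := (p :+ q) :+ h) refl
        where open ℕSolver
      sq-h′ : sq h ≈ s q ⊗ s (p ℕ.+ h) ⊕ sq p
      sq-h′ = subst (λ i → sq i ≈ s q ⊗ s (p ℕ.+ i) ⊕ sq p) p+q≡h (sq-step q p)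
      -- Split 2 sq j - sq p as (sq h - sq p) + (sq j - sq r). The first difference is s q · s (p +
      -- h) ≥ 0, and the second is s d · s h, strictly positive because d > 0.
      eq : sq j ⊕ (sq j ⊕ ⊖ sq p) ≈ s d ⊗ s h ⊕ s q ⊗ s (p ℕ.+ h)
      eq = begin
        sq j ⊕ (sq j ⊕ ⊖ sq p)
          ≈⟨ ⊕-congʳ (≈-sym (⊕-⊖-cancel (sq j) (sq r))) ⟩
        ((sq j ⊕ sq r) ⊕ ⊖ sq r) ⊕ (sq j ⊕ ⊖ sq p)
          ≈⟨ ⊕-cong (⊕-congʳ (≈-trans (≈-sym sq-h) sq-h′)) (⊕-congʳ (sq-step d r)) ⟩
        ((s q ⊗ s (p ℕ.+ h) ⊕ sq p) ⊕ ⊖ sq r) ⊕ ((s d ⊗ s h ⊕ sq r) ⊕ ⊖ sq p)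
          ≈⟨ regroup-even (s q ⊗ s (p ℕ.+ h)) (sq p) (s d ⊗ s h) (sq r) ⟩
        s q ⊗ s (p ℕ.+ h) ⊕ s d ⊗ s h
          ≈⟨ ⊕-comm (s q ⊗ s (p ℕ.+ h)) (s d ⊗ s h) ⟩
        s d ⊗ s h ⊕ s q ⊗ s (p ℕ.+ h) ∎

-- An eigenvalue that is not an integer

module NonIntegral
  (n′ : ℕ) (x : ℝ) (root : 𝕊 (suc (suc n′)) x ≈ 𝟘) (positive : ∀ l → l ≤ n′ → Pos (𝕊 (suc l) x))
  (j : ℕ) (coprime : ∀ i → suc (suc n′) ∣ j ℕ.* i → suc (suc n′) ∣ i) (dominant : Sine.Dominant n′ x root positive j)
  (K : ℕ) (k<n : suc K ℕ.< suc (suc n′)) where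

  open Sine n′ x root positive

  k : ℕ
  k = suc K

  open Cyclic n
  open Action n k ℕ.z<s k<n

  -- The closed form for a sum of sines in arithmetic progression, multiplied out by s j. Peeling
  -- off the first term leaves exactly one instance of `product`.
  progression : ∀ K y → s j ⊗ sumℝ {suc K} (λ t → s (y ℕ.+ (j ℕ.+ j) ℕ.* toℕ t)) ≈ s (j ℕ.* suc K) ⊗ s (y ℕ.+ j ℕ.* K)
  progression zero y = ⊗-cong (≡⇒≈ (cong s (sym (ℕ.*-identityʳ j))))
    (≈-trans (⊕-identityʳ (s (y ℕ.+ (j ℕ.+ j) ℕ.* 0))) (≡⇒≈ (cong (λ i → s (y ℕ.+ i)) (trans (ℕ.*-zeroʳ (j ℕ.+ j)) (sym (ℕ.*-zeroʳ j))))))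
  progression (suc K) y = begin
      s j ⊗ (s (y ℕ.+ (j ℕ.+ j) ℕ.* 0) ⊕ sumℝ {suc K} (λ t → s (y ℕ.+ (j ℕ.+ j) ℕ.* suc (toℕ t))))
        ≈⟨ ⊗-congˡ (⊕-cong (≡⇒≈ (cong s (first y j))) (sumℝ-cong (suc K) (λ t → ≡⇒≈ (cong s (next y j (toℕ t)))))) ⟩
      s j ⊗ (s y ⊕ sumℝ {suc K} (λ t → s (y ℕ.+ (j ℕ.+ j) ℕ.+ (j ℕ.+ j) ℕ.* toℕ t)))
        ≈⟨ distribˡ (s j) (s y) (sumℝ {suc K} (λ t → s (y ℕ.+ (j ℕ.+ j) ℕ.+ (j ℕ.+ j) ℕ.* toℕ t))) ⟩
      s j ⊗ s y ⊕ s j ⊗ sumℝ {suc K} (λ t → s (y ℕ.+ (j ℕ.+ j) ℕ.+ (j ℕ.+ j) ℕ.* toℕ t))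
        ≈⟨ ⊕-congˡ (progression K (y ℕ.+ (j ℕ.+ j))) ⟩
      s j ⊗ s y ⊕ s (j ℕ.* suc K) ⊗ s (y ℕ.+ (j ℕ.+ j) ℕ.+ j ℕ.* K)
        ≈⟨ ⊕-comm (s j ⊗ s y) (s (j ℕ.* suc K) ⊗ s (y ℕ.+ (j ℕ.+ j) ℕ.+ j ℕ.* K)) ⟩
      s (j ℕ.* suc K) ⊗ s (y ℕ.+ (j ℕ.+ j) ℕ.+ j ℕ.* K) ⊕ s j ⊗ s y
        ≡⟨ cong (λ i → s (j ℕ.* suc K) ⊗ s i ⊕ s j ⊗ s y) (last y j K) ⟩
      s (j ℕ.* suc K) ⊗ s (y ℕ.+ (j ℕ.+ j ℕ.* suc K)) ⊕ s j ⊗ s y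
        ≈⟨ ≈-sym (product y j (j ℕ.* suc K)) ⟩
      s (j ℕ.+ j ℕ.* suc K) ⊗ s (y ℕ.+ j ℕ.* suc K)
        ≡⟨ cong (λ i → s i ⊗ s (y ℕ.+ j ℕ.* suc K)) (sym (ℕ.*-suc j (suc K))) ⟩
      s (j ℕ.* suc (suc K)) ⊗ s (y ℕ.+ j ℕ.* suc K) ∎
    where
    open SetoidReasoning setoid
    open CommutativeRing ℝ-commutativeRing using (distribˡ)
    open ℕSolver
    first : ∀ y j → y ℕ.+ (j ℕ.+ j) ℕ.* 0 ≡ y
    first = solve 2 (λ y j → y :+ (j :+ j) :* con 0 := y) refl
    next : ∀ y j t → y ℕ.+ (j ℕ.+ j) ℕ.* suc t ≡ y ℕ.+ (j ℕ.+ j) ℕ.+ (j ℕ.+ j) ℕ.* t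
    next = solve 3 (λ y j t → y :+ (j :+ j) :* (con 1 :+ t) := y :+ (j :+ j) :+ (j :+ j) :* t) refl
    last : ∀ y j K → y ℕ.+ (j ℕ.+ j) ℕ.+ j ℕ.* K ≡ y ℕ.+ (j ℕ.+ j ℕ.* suc K)
    last = solve 3 (λ y j K → y :+ (j :+ j) :+ j :* K := y :+ (j :+ j :* (con 1 :+ K))) refl

  v : Fin n → ℝ
  v i = s ((j ℕ.+ j) ℕ.* toℕ i)

  -- Reducing a vertex modulo n changes the index of `s` by a multiple of 2n, which is its period.
  v-⊞ : ∀ i t → v (i ⊞ t) ≈ s ((j ℕ.+ j) ℕ.* (toℕ i ℕ.+ t))
  v-⊞ i t = ≈-sym (begin
      s ((j ℕ.+ j) ℕ.* m)                                              ≡⟨ cong (λ i → s ((j ℕ.+ j) ℕ.* i)) (ℕ.m≡m%n+[m/n]*n m n) ⟩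
      s ((j ℕ.+ j) ℕ.* (m ℕ.% n ℕ.+ m ℕ./ n ℕ.* n))                    ≡⟨ cong s (split j (m ℕ.% n) (m ℕ./ n) n) ⟩
      s ((j ℕ.+ j) ℕ.* (m ℕ.% n) ℕ.+ j ℕ.* (m ℕ./ n) ℕ.* (n ℕ.+ n))    ≈⟨ s-periodic ((j ℕ.+ j) ℕ.* (m ℕ.% n)) (j ℕ.* (m ℕ./ n)) ⟩
      s ((j ℕ.+ j) ℕ.* (m ℕ.% n))                                      ≡⟨ cong (λ i → s ((j ℕ.+ j) ℕ.* i)) (sym (toℕ-⊞ i t)) ⟩
      v (i ⊞ t)                                                        ∎)
    where
    open SetoidReasoning setoid
    m : ℕ
    m = toℕ i ℕ.+ t
    split : ∀ j r q n → (j ℕ.+ j) ℕ.* (r ℕ.+ q ℕ.* n) ≡ (j ℕ.+ j) ℕ.* r ℕ.+ j ℕ.* q ℕ.* (n ℕ.+ n)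
    split = solve 4 (λ j r q n → (j :+ j) :* (r :+ q :* n) := (j :+ j) :* r :+ j :* q :* (n :+ n)) refl
      where open ℕSolver

  pos-sj : Pos (sq j)
  pos-sj = pos-sq λ n∣j → n∤1 (coprime 1 (subst (n ∣_) (sym (ℕ.*-identityʳ j)) n∣j))
    where
    n∤1 : ¬ (n ∣ 1)
    n∤1 n∣1 with ℕ.∣1⇒≡1 n∣1
    ... | ()

  -- The Dirichlet kernel sin (jkπ/n) / sin (jπ/n); the summation starts at
  -- an index for which the second factor in the progression formula is s 1.
  U : ℝ
  U = sumℝ {k} (λ t → s (1 ℕ.+ j ℕ.* K ℕ.* (suc n′ ℕ.+ n) ℕ.+ (j ℕ.+ j) ℕ.* toℕ t))

  sj⊗U : s j ⊗ U ≈ s (j ℕ.* k)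
  sj⊗U = begin
      s j ⊗ U                                                              ≈⟨ progression K (1 ℕ.+ j ℕ.* K ℕ.* (suc n′ ℕ.+ n)) ⟩
      s (j ℕ.* k) ⊗ s (1 ℕ.+ j ℕ.* K ℕ.* (suc n′ ℕ.+ n) ℕ.+ j ℕ.* K)       ≡⟨ cong (λ i → s (j ℕ.* k) ⊗ s i) (collect (j ℕ.* K) (suc n′ ℕ.+ n)) ⟩
      s (j ℕ.* k) ⊗ s (1 ℕ.+ j ℕ.* K ℕ.* (n ℕ.+ n))                        ≈⟨ ⊗-congˡ (s-periodic 1 (j ℕ.* K)) ⟩
      s (j ℕ.* k) ⊗ 𝟙                                                      ≈⟨ ⊗-identityʳ (s (j ℕ.* k)) ⟩
      s (j ℕ.* k)                                                          ∎
    where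
    open SetoidReasoning setoid
    collect : ∀ a b → 1 ℕ.+ a ℕ.* b ℕ.+ a ≡ 1 ℕ.+ a ℕ.* (1 ℕ.+ b)
    collect = solve 2 (λ a b → con 1 :+ a :* b :+ a := con 1 :+ a :* (con 1 :+ b)) refl
      where open ℕSolver

  sqj⊗U² : sq j ⊗ (U ⊗ U) ≈ sq (j ℕ.* k)
  sqj⊗U² = ≈-trans (≈-sym (square-⊗ (s j) U)) (⊗-cong sj⊗U sj⊗U)

  K≤n : K ≤ n
  K≤n = ℕ.≤-trans (ℕ.n≤1+n K) (ℕ.<⇒≤ k<n)

  -- One factor s j is spent on the inner sum and one on the outer sum, which becomes a progression
  -- with step 2j after reversal. Each application of `progression` shifts the phase by jK; with the
  -- starting offset 2j (n - K) the total shift is 2jn, a multiple of the period.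
  window-v : ∀ i → sq j ⊗ window v i ≈ sq (j ℕ.* k) ⊗ v i
  window-v i = begin
      s j ⊗ s j ⊗ window v i
        ≈⟨ ⊗-assoc (s j) (s j) (window v i) ⟩
      s j ⊗ (s j ⊗ window v i)
        ≈⟨ ⊗-congˡ (⊗-distribˡ-sumℝ {k} (s j) (λ a → sumℝ {k} (λ t → v (i ⊞ (n ∸ toℕ a) ⊞ toℕ t)))) ⟩
      s j ⊗ sumℝ {k} (λ a → s j ⊗ sumℝ {k} (λ t → v (i ⊞ (n ∸ toℕ a) ⊞ toℕ t)))
        ≈⟨ ⊗-congˡ (sumℝ-cong k inner) ⟩
      s j ⊗ sumℝ {k} (λ a → s (j ℕ.* k) ⊗ s ((j ℕ.+ j) ℕ.* (toℕ i ℕ.+ (n ∸ toℕ a)) ℕ.+ j ℕ.* K))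
        ≈⟨ ⊗-congˡ (≈-sym (⊗-distribˡ-sumℝ {k} (s (j ℕ.* k)) (λ a → outer (toℕ a)))) ⟩
      s j ⊗ (s (j ℕ.* k) ⊗ sumℝ {k} (λ a → outer (toℕ a)))
        ≈⟨ ⊗-swap (s j) (s (j ℕ.* k)) (sumℝ {k} (λ a → outer (toℕ a))) ⟩
      s (j ℕ.* k) ⊗ (s j ⊗ sumℝ {k} (λ a → outer (toℕ a)))
        ≈⟨ ⊗-congˡ (⊗-congˡ (≈-trans (sumℝ-permute {k} {k} (λ a → outer (toℕ a)) Perm.reverse) (sumℝ-cong k (λ a → ≡⇒≈ (cong s (reversed a)))))) ⟩
      s (j ℕ.* k) ⊗ (s j ⊗ sumℝ {k} (λ a → s ((j ℕ.+ j) ℕ.* (toℕ i ℕ.+ (n ∸ K)) ℕ.+ j ℕ.* K ℕ.+ (j ℕ.+ j) ℕ.* toℕ a)))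
        ≈⟨ ⊗-congˡ (progression K ((j ℕ.+ j) ℕ.* (toℕ i ℕ.+ (n ∸ K)) ℕ.+ j ℕ.* K)) ⟩
      s (j ℕ.* k) ⊗ (s (j ℕ.* k) ⊗ s ((j ℕ.+ j) ℕ.* (toℕ i ℕ.+ (n ∸ K)) ℕ.+ j ℕ.* K ℕ.+ j ℕ.* K))
        ≈⟨ ≈-sym (⊗-assoc (s (j ℕ.* k)) (s (j ℕ.* k)) (s ((j ℕ.+ j) ℕ.* (toℕ i ℕ.+ (n ∸ K)) ℕ.+ j ℕ.* K ℕ.+ j ℕ.* K))) ⟩
      sq (j ℕ.* k) ⊗ s ((j ℕ.+ j) ℕ.* (toℕ i ℕ.+ (n ∸ K)) ℕ.+ j ℕ.* K ℕ.+ j ℕ.* K)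
        ≡⟨ cong (λ i → sq (j ℕ.* k) ⊗ s i) (trans (total j (toℕ i) (n ∸ K) K) (cong (λ p → (j ℕ.+ j) ℕ.* toℕ i ℕ.+ (j ℕ.+ j) ℕ.* p) (ℕ.m∸n+n≡m K≤n))) ⟩
      sq (j ℕ.* k) ⊗ s ((j ℕ.+ j) ℕ.* toℕ i ℕ.+ (j ℕ.+ j) ℕ.* n)
        ≡⟨ cong (λ p → sq (j ℕ.* k) ⊗ s ((j ℕ.+ j) ℕ.* toℕ i ℕ.+ p)) (double j n) ⟩
      sq (j ℕ.* k) ⊗ s ((j ℕ.+ j) ℕ.* toℕ i ℕ.+ j ℕ.* (n ℕ.+ n))
        ≈⟨ ⊗-congˡ (s-periodic ((j ℕ.+ j) ℕ.* toℕ i) j) ⟩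
      sq (j ℕ.* k) ⊗ v i ∎
    where
    open SetoidReasoning setoid
    outer : ℕ → ℝ
    outer a = s ((j ℕ.+ j) ℕ.* (toℕ i ℕ.+ (n ∸ a)) ℕ.+ j ℕ.* K)
    total : ∀ j i p K → (j ℕ.+ j) ℕ.* (i ℕ.+ p) ℕ.+ j ℕ.* K ℕ.+ j ℕ.* K ≡ (j ℕ.+ j) ℕ.* i ℕ.+ (j ℕ.+ j) ℕ.* (p ℕ.+ K)
    total = solve 4 (λ j i p K → (j :+ j) :* (i :+ p) :+ j :* K :+ j :* K := (j :+ j) :* i :+ (j :+ j) :* (p :+ K)) refl
      where open ℕSolver
    double : ∀ j n → (j ℕ.+ j) ℕ.* n ≡ j ℕ.* (n ℕ.+ n)
    double = solve 2 (λ j n → (j :+ j) :* n := j :* (n :+ n)) refl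
      where open ℕSolver
    inner : ∀ a → s j ⊗ sumℝ {k} (λ t → v (i ⊞ (n ∸ toℕ a) ⊞ toℕ t)) ≈ s (j ℕ.* k) ⊗ outer (toℕ a)
    inner a = ≈-trans (⊗-congˡ (sumℝ-cong k λ t → ≈-trans (≡⇒≈ (cong v (⊞-⊞ i (n ∸ toℕ a) (toℕ t))))
        (≈-trans (v-⊞ i (n ∸ toℕ a ℕ.+ toℕ t)) (≡⇒≈ (cong s (regroup j (toℕ i) (n ∸ toℕ a) (toℕ t)))))))
      (progression K ((j ℕ.+ j) ℕ.* (toℕ i ℕ.+ (n ∸ toℕ a))))
      where
      regroup : ∀ j i p t → (j ℕ.+ j) ℕ.* (i ℕ.+ (p ℕ.+ t)) ≡ (j ℕ.+ j) ℕ.* (i ℕ.+ p) ℕ.+ (j ℕ.+ j) ℕ.* t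
      regroup = solve 4 (λ j i p t → (j :+ j) :* (i :+ (p :+ t)) := (j :+ j) :* (i :+ p) :+ (j :+ j) :* t) refl
        where open ℕSolver
    reversed : ∀ (a : Fin k) → (j ℕ.+ j) ℕ.* (toℕ i ℕ.+ (n ∸ toℕ (Fin.opposite a))) ℕ.+ j ℕ.* K
                 ≡ (j ℕ.+ j) ℕ.* (toℕ i ℕ.+ (n ∸ K)) ℕ.+ j ℕ.* K ℕ.+ (j ℕ.+ j) ℕ.* toℕ a
    reversed a = trans (cong (λ p → (j ℕ.+ j) ℕ.* (toℕ i ℕ.+ p) ℕ.+ j ℕ.* K) (∸-opposite a K≤n)) (regroup j (toℕ i) (n ∸ K) (toℕ a) K)
      where
      regroup : ∀ j i p t K → (j ℕ.+ j) ℕ.* (i ℕ.+ (p ℕ.+ t)) ℕ.+ j ℕ.* K ≡ (j ℕ.+ j) ℕ.* (i ℕ.+ p) ℕ.+ j ℕ.* K ℕ.+ (j ℕ.+ j) ℕ.* t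
      regroup = solve 5 (λ j i p t K → (j :+ j) :* (i :+ (p :+ t)) :+ j :* K := (j :+ j) :* (i :+ p) :+ j :* K :+ (j :+ j) :* t) refl
        where open ℕSolver

  window-eigen : ∀ i → window v i ≈ (U ⊗ U) ⊗ v i
  window-eigen i = pos-cancel-≈ pos-sj (≈-trans (window-v i)
    (≈-trans (⊗-congʳ (≈-sym sqj⊗U²)) (⊗-assoc (sq j) (U ⊗ U) (v i))))

  private
    0<j-multiple : ∀ i → 0 ℕ.< i → i ℕ.< n → Pos (sq (j ℕ.* i))
    0<j-multiple (suc i) _ i<n = pos-sq λ n∣ji → ℕ.<⇒≱ i<n (ℕ.∣⇒≤ (coprime (suc i) n∣ji))

  -- The entry at vertex 1 is s (2j), whose square is positive because j is coprime to n and n does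
  -- not divide 2.
  eigenvector-nonzero : 0 ℕ.< n′ → ¬ (∀ i → v i ≈ 𝟘)
  eigenvector-nonzero 0<n′ v≈0 = ¬pos-0 (≈-trans (⊗-congʳ s[2j]≈0) (⊗-zeroˡ (s (j ℕ.* 2))))
      (0<j-multiple 2 ℕ.z<s (ℕ.s≤s (ℕ.s≤s 0<n′)))
    where
    1<n : 1 ℕ.< n
    1<n = ℕ.s≤s (ℕ.s≤s ℕ.z≤n)
    double : ∀ j → (j ℕ.+ j) ℕ.* 1 ≡ j ℕ.* 2
    double = solve 1 (λ j → (j :+ j) :* con 1 := j :* con 2) refl
      where open ℕSolver
    s[2j]≈0 : s (j ℕ.* 2) ≈ 𝟘
    s[2j]≈0 = ≈-trans (≡⇒≈ (cong s (trans (sym (double j)) (cong ((j ℕ.+ j) ℕ.*_) (sym (Fin.toℕ-fromℕ< 1<n))))))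
      (v≈0 (fromℕ< 1<n))

  U²-noninteger : 0 ℕ.< K → suc k ℕ.< n → ∀ q → ¬ (U ⊗ U ≈ ι q)
  U²-noninteger 0<K 1+k<n q U²≈q = absurd q sqj⊗q (pos-ι-factor pos-sj pos-q) (pos-ι-factor pos-sj pos-2-q)
    where
    open SetoidReasoning setoid
    sqj⊗q : ι q ⊗ sq j ≈ sq (j ℕ.* k)
    sqj⊗q = ≈-trans (⊗-congʳ (≈-sym U²≈q)) (≈-trans (⊗-comm (U ⊗ U) (sq j)) sqj⊗U²)
    pos-q : Pos (ι q ⊗ sq j)
    pos-q = pos-resp-≈ (≈-sym sqj⊗q) (0<j-multiple k ℕ.z<s k<n)
    pos-2-q : Pos (ι (ℤ.+ 2 ℤ.- q) ⊗ sq j)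
    pos-2-q = pos-resp-≈ (begin
        sq j ⊕ (sq j ⊕ ⊖ sq (j ℕ.* k))               ≈⟨ ⊕-congˡ (⊕-congˡ (⊖-cong (≈-sym sqj⊗q))) ⟩
        sq j ⊕ (sq j ⊕ ⊖ (ι q ⊗ sq j))               ≈⟨ ι-2-minus q (sq j) ⟩
        ι (ℤ.+ 2 ℤ.- q) ⊗ sq j                       ∎)
      (dominant (j ℕ.* k))
    sq-distinct : ¬ (sq j ≈ sq (j ℕ.* k))
    sq-distinct sqj≈sqjk = ¬pos-0 zero-product (pos-* (0<j-multiple K 0<K (ℕ.<-trans (ℕ.n<1+n K) k<n)) (0<j-multiple (suc k) ℕ.z<s 1+k<n))
      where
      eq : s (j ℕ.* K) ⊗ s (j ℕ.* suc k) ≈ 𝟘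
      eq = begin
        s (j ℕ.* K) ⊗ s (j ℕ.* suc k)
          ≡⟨ cong (λ i → s (j ℕ.* K) ⊗ s i) (trans (ℕ.*-suc j k) (cong (j ℕ.+_) (ℕ.*-suc j K))) ⟩
        s (j ℕ.* K) ⊗ s (j ℕ.+ (j ℕ.+ j ℕ.* K))
          ≈⟨ ≈-sym (⊕-⊖-cancel (s (j ℕ.* K) ⊗ s (j ℕ.+ (j ℕ.+ j ℕ.* K))) (sq j)) ⟩
        (s (j ℕ.* K) ⊗ s (j ℕ.+ (j ℕ.+ j ℕ.* K)) ⊕ sq j) ⊕ ⊖ sq j
          ≈⟨ ⊕-congʳ (≈-sym (product j j (j ℕ.* K))) ⟩
        sq (j ℕ.+ j ℕ.* K) ⊕ ⊖ sq j
          ≈⟨ ⊕-congʳ (≈-trans (≡⇒≈ (cong sq (sym (ℕ.*-suc j K)))) (≈-sym sqj≈sqjk)) ⟩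
        sq j ⊕ ⊖ sq j
          ≈⟨ CommutativeRing.-‿inverseʳ ℝ-commutativeRing (sq j) ⟩
        𝟘 ∎
      zero-product : sq (j ℕ.* K) ⊗ sq (j ℕ.* suc k) ≈ 𝟘
      zero-product = ≈-trans (≈-sym (square-⊗ (s (j ℕ.* K)) (s (j ℕ.* suc k)))) (≈-trans (⊗-congʳ eq) (⊗-zeroˡ (s (j ℕ.* K) ⊗ s (j ℕ.* suc k))))
    absurd : ∀ q → ι q ⊗ sq j ≈ sq (j ℕ.* k) → ℤ.0ℤ ℤ.< q → ℤ.0ℤ ℤ.< ℤ.+ 2 ℤ.- q → ⊥
    absurd (ℤ.+ 0) _ (ℤ.+<+ ()) _
    absurd (ℤ.+ 1) eq _ _ = sq-distinct (≈-trans (≈-sym (≈-trans (⊗-congʳ ι-1) (⊗-identityˡ (sq j)))) eq)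
    absurd (ℤ.+ suc (suc c)) _ _ 0<2-q = ℤ.<⇒≱ 0<2-q (ℤ.i≤j⇒i-j≤0 {ℤ.+ 2} {ℤ.+ suc (suc c)} (ℤ.+≤+ (ℕ.s≤s (ℕ.s≤s ℕ.z≤n))))
    absurd ℤ.-[1+ c ] _ () _

  ¬windowIntegral : 0 ℕ.< n′ → 0 ℕ.< K → suc k ℕ.< n → ¬ WindowIntegral
  ¬windowIntegral 0<n′ 0<K 1+k<n integral = let m , U²≈m = integral v (U ⊗ U) (eigenvector-nonzero 0<n′) window-eigen in
    U²-noninteger 0<K 1+k<n m U²≈m

-- Separating a real from the integers

opaque
  unfolding _⊕_ ι

  private
    pos-⊖-ι : ∀ w m p N → m /1 ℚ.+ ½ ℚ.* ½ ℚ.≤ p → (∀ n → N ≤ n → p ℚ.≤ seq w n) → Pos (w ⊕ ⊖ ι m)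
    pos-⊖-ι w m p N m+¼≤p p≤w = eventually (½ ℚ.* ½) (0<p*q {½} {½} 0<½ 0<½) N λ n N≤n →
      subst (ℚ._≤ seq w n ℚ.- m /1) (cancel (m /1) (½ ℚ.* ½)) (ℚ.+-monoˡ-≤ (ℚ.- (m /1)) (ℚ.≤-trans m+¼≤p (p≤w n N≤n)))
      where
      open ℚSolver
      cancel : ∀ a b → (a ℚ.+ b) ℚ.- a ≡ b
      cancel = solve 2 (λ a b → (a :+ b) :- a := b) refl

    pos-ι-⊖ : ∀ w m p N → p ℚ.≤ m /1 ℚ.- ½ ℚ.* ½ → (∀ n → N ≤ n → seq w n ℚ.≤ p) → Pos (ι m ⊕ ⊖ w)
    pos-ι-⊖ w m p N p≤m-¼ w≤p = eventually (½ ℚ.* ½) (0<p*q {½} {½} 0<½ 0<½) N λ n N≤n →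
      subst (ℚ._≤ m /1 ℚ.- seq w n) (cancel (m /1) (½ ℚ.* ½))
        (ℚ.+-monoʳ-≤ (m /1) (ℚ.neg-antimono-≤ (ℚ.≤-trans (w≤p n N≤n) p≤m-¼)))
      where
      open ℚSolver
      cancel : ∀ a b → a ℚ.- (a ℚ.- b) ≡ b
      cancel = solve 2 (λ a b → a :- (a :- b) := b) refl

  -- A term of `w` that is accurate to 1/4 is compared with a + 1/2. In either case a margin of 1/4
  -- to `a` or to `b` remains, because b ≥ a + 1.
  pos-separate : ∀ w a b → a ℤ.< b → Pos (w ⊕ ⊖ ι a) ⊎ Pos (ι b ⊕ ⊖ w)
  pos-separate w a b a<b = decide (seq w N ℚ.≤? a /1 ℚ.+ ½)
    where
    ¼ : ℚ
    ¼ = ½ ℚ.* ½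
    0<¼ : 0ℚ ℚ.< ¼
    0<¼ = 0<p*q {½} {½} 0<½ 0<½
    N : ℕ
    N = proj₁ (cauchy w ¼ 0<¼)
    close : ∀ m n → N ≤ m → N ≤ n → ∣ seq w m ℚ.- seq w n ∣ ℚ.< ¼
    close = proj₂ (cauchy w ¼ 0<¼)
    a+1≤b : 1ℚ ℚ.+ a /1 ℚ.≤ b /1
    a+1≤b = subst (ℚ._≤ b /1) (/1-+ ℤ.1ℤ a) (/1-mono-≤ {ℤ.1ℤ ℤ.+ a} {b} (ℤ.i<j⇒suc[i]≤j a<b))
    upper : ∀ a b w → w ℚ.≤ a ℚ.+ ½ → 1ℚ ℚ.+ a ℚ.≤ b → w ℚ.+ ¼ ℚ.≤ b ℚ.- ¼
    upper a b w w≤ a+1≤b = ≤-difference ((b ℚ.- (1ℚ ℚ.+ a)) ℚ.+ ((a ℚ.+ ½) ℚ.- w))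
      (ℚ.+-mono-≤ {0ℚ} {b ℚ.- (1ℚ ℚ.+ a)} {0ℚ} {(a ℚ.+ ½) ℚ.- w} (p≤q⇒0≤q-p a+1≤b) (p≤q⇒0≤q-p w≤)) (collect a b w)
      where
      open ℚSolver
      collect : ∀ a b w → (w ℚ.+ ¼) ℚ.+ ((b ℚ.- (1ℚ ℚ.+ a)) ℚ.+ ((a ℚ.+ ½) ℚ.- w)) ≡ b ℚ.- ¼
      collect = solve 3 (λ a b w → (w :+ con ¼) :+ ((b :- (con 1ℚ :+ a)) :+ ((a :+ con ½) :- w)) := b :- con ¼) refl
    lower : ∀ a w → a ℚ.+ ½ ℚ.< w → a ℚ.+ ¼ ℚ.≤ w ℚ.- ¼
    lower a w <w = ≤-difference (w ℚ.- (a ℚ.+ ½)) (ℚ.<⇒≤ (p<q⇒0<q-p <w)) (collect a w)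
      where
      open ℚSolver
      collect : ∀ a w → (a ℚ.+ ¼) ℚ.+ (w ℚ.- (a ℚ.+ ½)) ≡ w ℚ.- ¼
      collect = solve 2 (λ a w → (a :+ con ¼) :+ (w :- (a :+ con ½)) := w :- con ¼) refl
    decide : Dec (seq w N ℚ.≤ a /1 ℚ.+ ½) → Pos (w ⊕ ⊖ ι a) ⊎ Pos (ι b ⊕ ⊖ w)
    decide (yes w≤) = inj₂ (pos-ι-⊖ w b (seq w N ℚ.+ ¼) N (upper (a /1) (b /1) (seq w N) w≤ a+1≤b)
      λ n N≤n → ℚ.<⇒≤ (∣p-q∣<ε⇒p<q+ε {seq w n} {seq w N} {¼} (close n N N≤n ℕ.≤-refl)))
    decide (no w≰) = inj₁ (pos-⊖-ι w a (seq w N ℚ.- ¼) N (lower (a /1) (seq w N) (ℚ.≰⇒> w≰))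
      λ n N≤n → ℚ.<⇒≤ (∣p-q∣<ε⇒q-ε<p {seq w n} {seq w N} {¼} (close n N N≤n ℕ.≤-refl)))

  square-swap : ∀ x y → (x ⊕ ⊖ y) ⊗ (x ⊕ ⊖ y) ≈ (y ⊕ ⊖ x) ⊗ (y ⊕ ⊖ x)
  square-swap x y = pointwise λ t → swap (seq x t) (seq y t)
    where
    open ℚSolver
    swap : ∀ a b → (a ℚ.- b) ℚ.* (a ℚ.- b) ≡ (b ℚ.- a) ℚ.* (b ℚ.- a)
    swap = solve 2 (λ a b → (a :- b) :* (a :- b) := (b :- a) :* (b :- a)) refl

-- Integer eigenvalues

-- The square makes the relation independent of the sign of the difference and matches the form used
-- by `tight` and `pos-cancel`.
Apart : ℝ → ℝ → Set
Apart x y = Pos ((x ⊕ ⊖ y) ⊗ (x ⊕ ⊖ y))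

separate : ∀ w a b → a ≢ b → Apart w (ι a) ⊎ Apart w (ι b)
separate w a b a≢b with ℤ.<-cmp a b
... | tri≈ _ a≡b _ = ⊥-elim (a≢b a≡b)
... | tri< a<b _ _ with pos-separate w a b a<b
...   | inj₁ pos = inj₁ (pos-* pos pos)
...   | inj₂ pos = inj₂ (pos-resp-≈ (square-swap (ι b) w) (pos-* pos pos))
separate w a b a≢b | tri> _ _ b<a with pos-separate w b a b<a
...   | inj₁ pos = inj₂ (pos-* pos pos)
...   | inj₂ pos = inj₁ (pos-resp-≈ (square-swap (ι a) w) (pos-* pos pos))

annihilator : List ℤ → ℝ → ℝ → ℝ
annihilator [] w y = y
annihilator (m ∷ ms) w y = (w ⊕ ⊖ ι m) ⊗ annihilator ms w y

-- A real cannot be close to two distinct integers, so each new entry eliminates either itself or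
-- the current candidate. The value 0 for the empty list is arbitrary.
candidate : ∀ w ms → ∃[ m ] (All (λ m′ → m′ ≡ m ⊎ Apart w (ι m′)) ms)
candidate w [] = ℤ.0ℤ , []
candidate w (m ∷ ms) with candidate w ms
... | m₀ , all with m ℤ.≟ m₀
...   | yes m≡m₀ = m₀ , inj₁ m≡m₀ ∷ all
...   | no m≢m₀ with separate w m m₀ m≢m₀
...     | inj₁ apart  = m₀ , inj₂ apart ∷ all
...     | inj₂ apart₀ = m , inj₁ refl ∷ All.map (λ { (inj₁ refl) → inj₂ apart₀ ; (inj₂ apart) → inj₂ apart }) all

apart-cancel : ∀ {x y z} → Apart x y → (x ⊕ ⊖ y) ⊗ z ≈ 𝟘 → z ≈ 𝟘
apart-cancel {x} {y} {z} apart eq = pos-cancel apart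
  (≈-trans (⊗-assoc (x ⊕ ⊖ y) (x ⊕ ⊖ y) z) (≈-trans (⊗-congˡ eq) (⊗-zeroʳ (x ⊕ ⊖ y))))

annihilator-cancel : ∀ {w y} ms → All (λ m → Apart w (ι m)) ms → annihilator ms w y ≈ 𝟘 → y ≈ 𝟘
annihilator-cancel [] [] eq = eq
annihilator-cancel (m ∷ ms) (apart ∷ aparts) eq = annihilator-cancel ms aparts (apart-cancel apart eq)

-- That `v` is nonzero is only a negation and names no nonvanishing entry to divide by. It can still
-- refute apartness of `w` from the candidate, since apartness would make all entries vanish at
-- once.
integer-root : ∀ {n} (v : Fin n → ℝ) w ms → ¬ (∀ i → v i ≈ 𝟘) → (∀ i → annihilator ms w (v i) ≈ 𝟘) → ∃[ m ] (w ≈ ι m)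
integer-root v w ms v≉0 eq with candidate w ms
... | m , all = m , ≈-trans (≈-sym (⊖-⊕-cancel w (ι m))) (≈-trans (⊕-congʳ (tight λ apart → v≉0 λ i →
        annihilator-cancel ms (All.map (λ { (inj₁ refl) → apart ; (inj₂ apart′) → apart′ }) all) (eq i)))
      (⊕-identityˡ (ι m)))

open SemiringSum ℤ.+-*-semiring using () renaming (sum to sumℤ)

ι-sum : ∀ {n} (f : Fin n → ℤ) → ι (sumℤ f) ≈ sumℝ (λ i → ι (f i))
ι-sum {zero} f = ι-0
ι-sum {suc n} f = ≈-trans (ι-+ (f Fin.zero) (sumℤ (f ∘ Fin.suc))) (⊕-congˡ (ι-sum (f ∘ Fin.suc)))

module _ {n : ℕ} where

  act : Matrix ℤ n → (Fin n → ℝ) → Fin n → ℝ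
  act M v i = sumℝ (λ l → ι (M i l) ⊗ v l)

  shifted : Matrix ℤ n → ℤ → Matrix ℤ n
  shifted M m i l = M i l ℤ.- m ℤ.* ℤ.+ indicator (i Fin.≟ l)

  -- The polynomial ∏ (X − m) evaluated at the matrix M.
  evaluate : Matrix ℤ n → List ℤ → Matrix ℤ n
  evaluate M [] i l = ℤ.+ indicator (i Fin.≟ l)
  evaluate M (m ∷ ms) i l = sumℤ (λ h → evaluate M ms i h ℤ.* shifted M m h l)

  act-cong : ∀ M {u v} → (∀ l → u l ≈ v l) → ∀ i → act M u i ≈ act M v i
  act-cong M u≈v i = sumℝ-cong n (λ l → ⊗-congˡ (u≈v l))

  act-scale : ∀ M c v i → act M (λ l → c ⊗ v l) i ≈ c ⊗ act M v i
  act-scale M c v i = ≈-trans (sumℝ-cong n λ l → ⊗-swap (ι (M i l)) c (v l))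
      (≈-sym (⊗-distribˡ-sumℝ c (λ l → ι (M i l) ⊗ v l)))

  act-product : ∀ P Q v i → act (λ i l → sumℤ (λ h → P i h ℤ.* Q h l)) v i ≈ act P (act Q v) i
  act-product P Q v i = begin
      sumℝ (λ l → ι (sumℤ (λ h → P i h ℤ.* Q h l)) ⊗ v l)
        ≈⟨ sumℝ-cong n (λ l → ≈-trans (⊗-congʳ (ι-sum (λ h → P i h ℤ.* Q h l))) (⊗-distribʳ-sumℝ {n} (v l) (λ h → ι (P i h ℤ.* Q h l)))) ⟩
      sumℝ {n} (λ l → sumℝ {n} (λ h → ι (P i h ℤ.* Q h l) ⊗ v l))
        ≈⟨ sumℝ-cong n (λ l → sumℝ-cong n (λ h → ≈-trans (⊗-congʳ (ι-* (P i h) (Q h l))) (⊗-assoc (ι (P i h)) (ι (Q h l)) (v l)))) ⟩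
      sumℝ {n} (λ l → sumℝ {n} (λ h → ι (P i h) ⊗ (ι (Q h l) ⊗ v l)))
        ≈⟨ sumℝ-comm (λ (l h : Fin n) → ι (P i h) ⊗ (ι (Q h l) ⊗ v l)) ⟩
      sumℝ {n} (λ h → sumℝ {n} (λ l → ι (P i h) ⊗ (ι (Q h l) ⊗ v l)))
        ≈⟨ sumℝ-cong n (λ h → ≈-sym (⊗-distribˡ-sumℝ {n} (ι (P i h)) (λ l → ι (Q h l) ⊗ v l))) ⟩
      act P (act Q v) i ∎
    where open SetoidReasoning setoid

  act-shifted : ∀ M m v i → act (shifted M m) v i ≈ act M v i ⊕ ⊖ (ι m ⊗ v i)
  act-shifted M m v i = begin
      act (shifted M m) v i
        ≈⟨ ≈-sym (⊕-⊖-cancel (act (shifted M m) v i) (ι m ⊗ v i)) ⟩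
      (act (shifted M m) v i ⊕ ι m ⊗ v i) ⊕ ⊖ (ι m ⊗ v i)
        ≈⟨ ⊕-congʳ (⊕-congˡ (≈-trans (⊗-congˡ (≈-sym (sum-indicator-⊗ v i))) (⊗-distribˡ-sumℝ {n} (ι m) (λ l → ν (δ l) ⊗ v l)))) ⟩
      (act (shifted M m) v i ⊕ sumℝ {n} (λ l → ι m ⊗ (ν (δ l) ⊗ v l))) ⊕ ⊖ (ι m ⊗ v i)
        ≈⟨ ⊕-congʳ (≈-sym (sumℝ-⊕ {n} (λ l → ι (shifted M m i l) ⊗ v l) (λ l → ι m ⊗ (ν (δ l) ⊗ v l)))) ⟩
      sumℝ {n} (λ l → ι (shifted M m i l) ⊗ v l ⊕ ι m ⊗ (ν (δ l) ⊗ v l)) ⊕ ⊖ (ι m ⊗ v i)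
        ≈⟨ ⊕-congʳ (sumℝ-cong n combine) ⟩
      act M v i ⊕ ⊖ (ι m ⊗ v i) ∎
    where
    open SetoidReasoning setoid
    open CommutativeRing ℝ-commutativeRing using (distribʳ)
    δ : Fin n → ℕ
    δ l = indicator (i Fin.≟ l)
    combine : ∀ l → ι (shifted M m i l) ⊗ v l ⊕ ι m ⊗ (ν (δ l) ⊗ v l) ≈ ι (M i l) ⊗ v l
    combine l = begin
      ι (shifted M m i l) ⊗ v l ⊕ ι m ⊗ (ν (δ l) ⊗ v l)
        ≈⟨ ⊕-cong (⊗-congʳ (≈-trans (ι-⊖ (M i l) (m ℤ.* ℤ.+ δ l)) (⊕-congˡ (⊖-cong (ι-* m (ℤ.+ δ l))))))
                  (≈-sym (⊗-assoc (ι m) (ν (δ l)) (v l))) ⟩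
      (ι (M i l) ⊕ ⊖ (ι m ⊗ ν (δ l))) ⊗ v l ⊕ (ι m ⊗ ν (δ l)) ⊗ v l
        ≈⟨ ≈-sym (distribʳ (v l) (ι (M i l) ⊕ ⊖ (ι m ⊗ ν (δ l))) (ι m ⊗ ν (δ l))) ⟩
      ((ι (M i l) ⊕ ⊖ (ι m ⊗ ν (δ l))) ⊕ ι m ⊗ ν (δ l)) ⊗ v l
        ≈⟨ ⊗-congʳ (⊖-⊕-cancel (ι (M i l)) (ι m ⊗ ν (δ l))) ⟩
      ι (M i l) ⊗ v l ∎

  act-evaluate : ∀ M v w → (∀ i → act M v i ≈ w ⊗ v i) → ∀ ms i → act (evaluate M ms) v i ≈ annihilator ms w (v i)
  act-evaluate M v w eigen [] i = sum-indicator-⊗ v i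
  act-evaluate M v w eigen (m ∷ ms) i = begin
      act (evaluate M (m ∷ ms)) v i
        ≈⟨ act-product (evaluate M ms) (shifted M m) v i ⟩
      act (evaluate M ms) (act (shifted M m) v) i
        ≈⟨ act-cong (evaluate M ms) (λ l → ≈-trans (act-shifted M m v l) (≈-trans (⊕-congʳ (eigen l)) (⊖-distribʳ w (ι m) (v l)))) i ⟩
      act (evaluate M ms) (λ l → (w ⊕ ⊖ ι m) ⊗ v l) i
        ≈⟨ act-scale (evaluate M ms) (w ⊕ ⊖ ι m) v i ⟩
      (w ⊕ ⊖ ι m) ⊗ act (evaluate M ms) v i
        ≈⟨ ⊗-congˡ (act-evaluate M v w eigen ms i) ⟩
      annihilator (m ∷ ms) w (v i) ∎
    where open SetoidReasoning setoid

module Spectrum (n : ℕ) .{{_ : ℕ.NonZero n}} (k : ℕ) (0<k : 0 ℕ.< k) (k<n : k ℕ.< n) where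

  open Cyclic n
  open Hypercycle k 0<k k<n
  open Action n k 0<k k<n

  spectrum⇒integral : ∀ M ms → (∀ i l → ℤ.+ codegree i l ≡ M i l) → (∀ i l → evaluate M ms i l ≡ ℤ.0ℤ) →
    Integral (hypercycle n k)
  spectrum⇒integral M ms codegree≡M evaluate≡0 = window⇒integral λ v w v≉0 window≈ →
    let eigen : ∀ i → act M v i ≈ w ⊗ v i
        eigen i = ≈-trans (sumℝ-cong n λ l → ⊗-congʳ (≡⇒≈ (cong ι (sym (codegree≡M i l)))))
                    (≈-trans (codegree-window v i) (window≈ i))
    in integer-root v w ms v≉0 λ i → ≈-trans (≈-sym (act-evaluate M v w eigen ms i))
         (sum-zero +-commutativeMonoid (λ l → ι (evaluate M ms i l) ⊗ v l)
           (λ l → ≈-trans (⊗-congʳ (≈-trans (≡⇒≈ (cong ι (evaluate≡0 i l))) ι-0)) (⊗-zeroˡ (v l))))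

-- The four exceptional pairs

circulant : ∀ {n} .{{_ : ℕ.NonZero n}} → Vec ℤ n → Matrix ℤ n
circulant {n} row i l = lookup row ((toℕ l ℕ.+ (n ∸ toℕ i)) mod n)

_≟ᴹ_ : ∀ {n} (M N : Matrix ℤ n) → Dec (∀ i l → M i l ≡ N i l)
M ≟ᴹ N = Fin.all? λ i → Fin.all? λ l → M i l ℤ.≟ N i l

module _ (n : ℕ) .{{_ : ℕ.NonZero n}} (k : ℕ) (0<k : 0 ℕ.< k) (k<n : k ℕ.< n) where

  open Cyclic n
  open Hypercycle k 0<k k<n

  -- Both hypotheses are decided by evaluation. With a circulant in place of the codegrees, the
  -- matrix products run on table lookups instead of filtered edge lists.
  circulant⇒integral : ∀ row ms → {True ((λ i l → ℤ.+ codegree i l) ≟ᴹ circulant row)} →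
    {True (evaluate (circulant row) ms ≟ᴹ λ _ _ → ℤ.0ℤ)} → Integral (hypercycle n k)
  circulant⇒integral row ms {codegrees} {annihilates} =
    Spectrum.spectrum⇒integral n k 0<k k<n (circulant row) ms (toWitness codegrees) (toWitness annihilates)

-- Here and in the next three cases the first list holds the codegrees of vertex 0 with every
-- vertex. The second lists the distinct eigenvalues of A + kI: k² for j = 0, and sin² (πjk/n) /
-- sin² (πj/n) for the other j.
integral-4-2 : Integral (hypercycle 4 2)
integral-4-2 = circulant⇒integral 4 2 ℕ.z<s (from-yes (2 ℕ.<? 4))
  (ℤ.+ 2 ∷ ℤ.+ 1 ∷ ℤ.+ 0 ∷ ℤ.+ 1 ∷ []) (ℤ.+ 4 ∷ ℤ.+ 2 ∷ ℤ.+ 0 ∷ [])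

integral-6-2 : Integral (hypercycle 6 2)
integral-6-2 = circulant⇒integral 6 2 ℕ.z<s (from-yes (2 ℕ.<? 6))
  (ℤ.+ 2 ∷ ℤ.+ 1 ∷ ℤ.+ 0 ∷ ℤ.+ 0 ∷ ℤ.+ 0 ∷ ℤ.+ 1 ∷ []) (ℤ.+ 4 ∷ ℤ.+ 3 ∷ ℤ.+ 1 ∷ ℤ.+ 0 ∷ [])

integral-6-3 : Integral (hypercycle 6 3)
integral-6-3 = circulant⇒integral 6 3 ℕ.z<s (from-yes (3 ℕ.<? 6))
  (ℤ.+ 3 ∷ ℤ.+ 2 ∷ ℤ.+ 1 ∷ ℤ.+ 0 ∷ ℤ.+ 1 ∷ ℤ.+ 2 ∷ []) (ℤ.+ 9 ∷ ℤ.+ 4 ∷ ℤ.+ 1 ∷ ℤ.+ 0 ∷ [])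

integral-6-4 : Integral (hypercycle 6 4)
integral-6-4 = circulant⇒integral 6 4 ℕ.z<s (from-yes (4 ℕ.<? 6))
  (ℤ.+ 4 ∷ ℤ.+ 3 ∷ ℤ.+ 2 ∷ ℤ.+ 2 ∷ ℤ.+ 2 ∷ ℤ.+ 3 ∷ []) (ℤ.+ 16 ∷ ℤ.+ 3 ∷ ℤ.+ 1 ∷ ℤ.+ 0 ∷ [])

-- The case k = n - 1

opaque
  unfolding _⊕_

  private
    subtract-one : ∀ w v T → (w ⊕ ⊖ 𝟙) ⊗ v ≈ ((w ⊗ v ⊕ T) ⊕ ⊖ T) ⊕ ⊖ v
    subtract-one w v T = pointwise λ t → expand (seq w t) (seq v t) (seq T t)
      where
      open ℚSolver
      expand : ∀ w v T → (w ℚ.- 1ℚ) ℚ.* v ≡ ((w ℚ.* v ℚ.+ T) ℚ.- T) ℚ.- v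
      expand = solve 3 (λ w v T → (w :- con 1ℚ) :* v := ((w :* v :+ T) :- T) :- v) refl

    collect-one : ∀ κ v T → ((κ ⊗ T ⊕ v) ⊕ ⊖ T) ⊕ ⊖ v ≈ (κ ⊕ ⊖ 𝟙) ⊗ T
    collect-one κ v T = pointwise λ t → collect (seq κ t) (seq v t) (seq T t)
      where
      open ℚSolver
      collect : ∀ κ v T → ((κ ℚ.* T ℚ.+ v) ℚ.- T) ℚ.- v ≡ (κ ℚ.- 1ℚ) ℚ.* T
      collect = solve 3 (λ κ v T → ((κ :* T :+ v) :- T) :- v := (κ :- con 1ℚ) :* T) refl

    subtract-square : ∀ w κ T → (w ⊕ ⊖ (κ ⊗ κ)) ⊗ T ≈ (w ⊕ ⊖ 𝟙) ⊗ T ⊕ ⊖ ((𝟙 ⊕ κ) ⊗ ((κ ⊕ ⊖ 𝟙) ⊗ T))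
    subtract-square w κ T = pointwise λ t → expand (seq w t) (seq κ t) (seq T t)
      where
      open ℚSolver
      expand : ∀ w κ T → (w ℚ.- κ ℚ.* κ) ℚ.* T ≡ (w ℚ.- 1ℚ) ℚ.* T ℚ.- (1ℚ ℚ.+ κ) ℚ.* ((κ ℚ.- 1ℚ) ℚ.* T)
      expand = solve 3 (λ w κ T → (w :- κ :* κ) :* T := (w :- con 1ℚ) :* T :- (con 1ℚ :+ κ) :* ((κ :- con 1ℚ) :* T)) refl

sumℝ-const : ∀ n c → sumℝ {n} (λ _ → c) ≈ ν n ⊗ c
sumℝ-const zero c = ≈-sym (≈-trans (⊗-congʳ ι-0) (⊗-zeroˡ c))
sumℝ-const (suc n) c = begin
    c ⊕ sumℝ {n} (λ _ → c)     ≈⟨ ⊕-cong (≈-sym (⊗-identityˡ c)) (sumℝ-const n c) ⟩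
    𝟙 ⊗ c ⊕ ν n ⊗ c            ≈⟨ ≈-sym (distribʳ c 𝟙 (ν n)) ⟩
    (𝟙 ⊕ ν n) ⊗ c              ≈⟨ ⊗-congʳ (≈-sym (ν-suc n)) ⟩
    ν (suc n) ⊗ c              ∎
  where
  open SetoidReasoning setoid
  open CommutativeRing ℝ-commutativeRing using (distribʳ)
  ν-suc : ∀ n → ν (suc n) ≈ 𝟙 ⊕ ν n
  ν-suc n = ≈-trans (ι-+ ℤ.1ℤ (ℤ.+ n)) (⊕-congʳ ι-1)

sumℝ-last : ∀ k (g : ℕ → ℝ) → sumℝ {suc k} (λ t → g (toℕ t)) ≈ sumℝ {k} (λ t → g (toℕ t)) ⊕ g k
sumℝ-last zero g = ⊕-comm (g 0) 𝟘
sumℝ-last (suc k) g = ≈-trans (⊕-congˡ (sumℝ-last k (λ t → g (suc t))))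
  (≈-sym (⊕-assoc (g 0) (sumℝ {k} (λ t → g (suc (toℕ t)))) (g (suc k))))

module _ (n : ℕ) .{{_ : ℕ.NonZero n}} where

  open Cyclic n

  sumℝ-cyclic : ∀ (f : Fin n → ℝ) j → sumℝ {n} (λ t → f (j ⊞ toℕ t)) ≈ sumℝ f
  sumℝ-cyclic f j = ≈-sym (sumℝ-permute {n} {n} f (Perm.permutation (λ t → j ⊞ toℕ t) (λ l → l ⊞ (n ∸ toℕ j))
    (λ l → trans (cong (_mod n) (ℕ.+-comm (toℕ j) (toℕ (l ⊞ (n ∸ toℕ j))))) (∸-⊞ l (ℕ.<⇒≤ (Fin.toℕ<n j))))
    (λ t → Fin.toℕ-injective (⊞-retract j (Fin.toℕ<n t)))))

-- A = (k − 1)(J − I), so A + kI has eigenvalues 1 and k².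
module AllButOne (K : ℕ) where

  k n : ℕ
  k = suc K
  n = suc k

  open Cyclic n
  open Action n k ℕ.z<s (ℕ.n<1+n k)

  module _ (v : Fin n → ℝ) where

    private
      T : ℝ
      T = sumℝ v

      F : Fin n → ℝ
      F j = sumℝ {k} (λ t → v (j ⊞ toℕ t))

      F-total : ∀ j → F j ⊕ v (j ⊞ k) ≈ T
      F-total j = ≈-trans (≈-sym (sumℝ-last k (λ t → v (j ⊞ t)))) (sumℝ-cyclic n v j)

      F-reversed : ∀ i → sumℝ {k} (λ s → v (i ⊞ (n ∸ toℕ s) ⊞ k)) ≈ F (i ⊞ 1)
      F-reversed i = ≈-trans (sumℝ-permute {k} {k} (λ s → v (i ⊞ (n ∸ toℕ s) ⊞ k)) Perm.reverse)
        (sumℝ-cong k (λ s → ≡⇒≈ (cong v (index s))))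
        where
        n∸K≡2 : n ∸ K ≡ 2
        n∸K≡2 = ℕ.m+n∸n≡m 2 K
        index : ∀ (s : Fin k) → i ⊞ (n ∸ toℕ (Fin.opposite s)) ⊞ k ≡ i ⊞ 1 ⊞ toℕ s
        -- After reversal the offset is 2 + s + k = (1 + s) + n, that is, 1 + s and one full turn.
        index s = trans (cong (λ u → i ⊞ u ⊞ k) (trans (∸-opposite s (ℕ.m≤n+m K 2)) (cong (ℕ._+ toℕ s) n∸K≡2)))
          (trans (⊞-⊞ i (2 ℕ.+ toℕ s) k) (trans (cong (i ⊞_) (sym (ℕ.+-suc (suc (toℕ s)) k)))
            (trans (sym (⊞-⊞ i (suc (toℕ s)) n)) (trans (⊞-n (i ⊞ suc (toℕ s))) (sym (⊞-⊞ i 1 (toℕ s)))))))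

      F-wrap : ∀ i → F (i ⊞ 1) ⊕ v i ≈ T
      F-wrap i = ≈-trans (⊕-congˡ (≡⇒≈ (cong v (sym (trans (⊞-⊞ i 1 k) (⊞-n i)))))) (F-total (i ⊞ 1))

    -- Each of the k inner sums `F (i − s)` misses a single vertex, i - s + k = i - s - 1, and for s
    -- < k these run through all vertices except i. So the window is k T minus T - v i.
    window-total : ∀ i → window v i ⊕ T ≈ ν k ⊗ T ⊕ v i
    window-total i = begin
      window v i ⊕ T
        ≈⟨ ⊕-congˡ (≈-sym (F-wrap i)) ⟩
      window v i ⊕ (F (i ⊞ 1) ⊕ v i)
        ≈⟨ ≈-sym (⊕-assoc (window v i) (F (i ⊞ 1)) (v i)) ⟩
      (window v i ⊕ F (i ⊞ 1)) ⊕ v i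
        ≈⟨ ⊕-congʳ (⊕-congˡ (≈-sym (F-reversed i))) ⟩
      (window v i ⊕ sumℝ {k} (λ s → v (i ⊞ (n ∸ toℕ s) ⊞ k))) ⊕ v i
        ≈⟨ ⊕-congʳ (≈-sym (sumℝ-⊕ {k} (λ s → F (i ⊞ (n ∸ toℕ s))) (λ s → v (i ⊞ (n ∸ toℕ s) ⊞ k)))) ⟩
      sumℝ {k} (λ s → F (i ⊞ (n ∸ toℕ s)) ⊕ v (i ⊞ (n ∸ toℕ s) ⊞ k)) ⊕ v i
        ≈⟨ ⊕-congʳ (≈-trans (sumℝ-cong k (λ s → F-total (i ⊞ (n ∸ toℕ s)))) (sumℝ-const k T)) ⟩
      ν k ⊗ T ⊕ v i ∎
      where open SetoidReasoning setoid

    module _ (w : ℝ) (eigen : ∀ i → window v i ≈ w ⊗ v i) where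

      private
        κ : ℝ
        κ = ν k

        deviation : ∀ i → (w ⊕ ⊖ 𝟙) ⊗ v i ≈ (κ ⊕ ⊖ 𝟙) ⊗ T
        deviation i = ≈-trans (subtract-one w (v i) T) (≈-trans (⊕-congʳ (⊕-congʳ
          (≈-trans (⊕-congʳ (≈-sym (eigen i))) (window-total i)))) (collect-one κ (v i) T))

        ν-n : ν n ≈ 𝟙 ⊕ κ
        ν-n = ≈-trans (ι-+ ℤ.1ℤ (ℤ.+ k)) (⊕-congʳ ι-1)

        -- Summing `deviation` over the n = 1 + k vertices gives (w - 1) T = (k + 1)(k - 1) T, hence
        -- (w - k²) T = 0. Multiplying `deviation` by w - k² then annihilates every entry of `v`.
        total : (w ⊕ ⊖ 𝟙) ⊗ T ≈ (𝟙 ⊕ κ) ⊗ ((κ ⊕ ⊖ 𝟙) ⊗ T)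
        total = ≈-trans (⊗-distribˡ-sumℝ {n} (w ⊕ ⊖ 𝟙) v) (≈-trans (sumℝ-cong n deviation)
          (≈-trans (sumℝ-const n ((κ ⊕ ⊖ 𝟙) ⊗ T)) (⊗-congʳ ν-n)))

        total-annihilated : (w ⊕ ⊖ (κ ⊗ κ)) ⊗ T ≈ 𝟘
        total-annihilated = ≈-trans (subtract-square w κ T) (≈-trans (⊕-congʳ total)
          (CommutativeRing.-‿inverseʳ ℝ-commutativeRing ((𝟙 ⊕ κ) ⊗ ((κ ⊕ ⊖ 𝟙) ⊗ T))))

      annihilated : ∀ i → annihilator (ℤ.+ k ℤ.* ℤ.+ k ∷ ℤ.1ℤ ∷ []) w (v i) ≈ 𝟘
      annihilated i = begin
        (w ⊕ ⊖ ι (ℤ.+ k ℤ.* ℤ.+ k)) ⊗ ((w ⊕ ⊖ ι ℤ.1ℤ) ⊗ v i)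
          ≈⟨ ⊗-cong (⊕-congˡ (⊖-cong (ι-* (ℤ.+ k) (ℤ.+ k)))) (⊗-congʳ (⊕-congˡ (⊖-cong ι-1))) ⟩
        (w ⊕ ⊖ (κ ⊗ κ)) ⊗ ((w ⊕ ⊖ 𝟙) ⊗ v i)
          ≈⟨ ⊗-congˡ (deviation i) ⟩
        (w ⊕ ⊖ (κ ⊗ κ)) ⊗ ((κ ⊕ ⊖ 𝟙) ⊗ T)
          ≈⟨ ≈-sym (⊗-assoc (w ⊕ ⊖ (κ ⊗ κ)) (κ ⊕ ⊖ 𝟙) T) ⟩
        (w ⊕ ⊖ (κ ⊗ κ)) ⊗ (κ ⊕ ⊖ 𝟙) ⊗ T
          ≈⟨ ⊗-congʳ (⊗-comm (w ⊕ ⊖ (κ ⊗ κ)) (κ ⊕ ⊖ 𝟙)) ⟩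
        (κ ⊕ ⊖ 𝟙) ⊗ (w ⊕ ⊖ (κ ⊗ κ)) ⊗ T
          ≈⟨ ⊗-assoc (κ ⊕ ⊖ 𝟙) (w ⊕ ⊖ (κ ⊗ κ)) T ⟩
        (κ ⊕ ⊖ 𝟙) ⊗ ((w ⊕ ⊖ (κ ⊗ κ)) ⊗ T)
          ≈⟨ ≈-trans (⊗-congˡ total-annihilated) (⊗-zeroʳ (κ ⊕ ⊖ 𝟙)) ⟩
        𝟘 ∎
        where open SetoidReasoning setoid

  windowIntegral : WindowIntegral
  windowIntegral v w v≉0 eigen = integer-root v w (ℤ.+ k ℤ.* ℤ.+ k ∷ ℤ.1ℤ ∷ []) v≉0 (annihilated v w eigen)

WindowIntegral : (n : ℕ) .{{_ : ℕ.NonZero n}} (k : ℕ) → 0 ℕ.< k → k ℕ.< n → Set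
WindowIntegral n k 0<k k<n = Action.WindowIntegral n k 0<k k<n

integral-all-but-one : ∀ k → 0 ℕ.< k → Integral (hypercycle (suc k) k)
integral-all-but-one k 0<k = Action.window⇒integral (suc k) k 0<k (ℕ.n<1+n k) (windowIntegral k 0<k)
  where
  windowIntegral : ∀ k (0<k : 0 ℕ.< k) → WindowIntegral (suc k) k 0<k (ℕ.n<1+n k)
  windowIntegral (suc K) (ℕ.s≤s ℕ.z≤n) = AllButOne.windowIntegral K

-- An index j coprime to n with jπ/n close to π/2.
data Central : ℕ → ℕ → Set where
  odd  : ∀ j → 0 ℕ.< j → Central (suc (j ℕ.+ j)) j
  even : ∀ r d → 0 ℕ.< r → 0 ℕ.< d → Coprimality.Coprime ((r ℕ.+ (r ℕ.+ d)) ℕ.+ (r ℕ.+ (r ℕ.+ d))) (r ℕ.+ d) →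
         Central ((r ℕ.+ (r ℕ.+ d)) ℕ.+ (r ℕ.+ (r ℕ.+ d))) (r ℕ.+ d)

central-coprime : ∀ {n j} → Central n j → Coprimality.Coprime n j
central-coprime (odd j _) {d} (d∣1+2j , d∣j) = ℕ.∣1⇒≡1 (ℕ.∣m+n∣m⇒∣n {m = j ℕ.+ j} {n = 1}
  (subst (d ∣_) (ℕ.+-comm 1 (j ℕ.+ j)) d∣1+2j) (ℕ.∣m∣n⇒∣m+n d∣j d∣j))
central-coprime (even r d _ _ coprime) = coprime

-- A common divisor of n and j divides n - 2j = 2r. With r equal to 1 or 2 it divides 4, and j is
-- chosen odd.
coprime-to-odd : ∀ m {d} → d ∣ 4 → d ∣ suc (m ℕ.+ m) → d ≡ 1
coprime-to-odd m {d} d∣4 d∣odd = by-cases d (ℕ.∣⇒≤ d∣4) d∣4 d∣odd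
  where
  not-even : ¬ (2 ∣ suc (m ℕ.+ m))
  not-even 2∣odd with ℕ.∣1⇒≡1 (ℕ.∣m+n∣m⇒∣n {m = m ℕ.+ m} {n = 1} (subst (2 ∣_) (ℕ.+-comm 1 (m ℕ.+ m)) 2∣odd)
    (ℕ.divides m (trans (cong (m ℕ.+_) (sym (ℕ.+-identityʳ m))) (ℕ.*-comm 2 m))))
  ... | ()
  by-cases : ∀ d → d ≤ 4 → d ∣ 4 → d ∣ suc (m ℕ.+ m) → d ≡ 1
  by-cases 0 _ 0∣4 _ with ℕ.0∣⇒≡0 0∣4
  ... | ()
  by-cases 1 _ _ _ = refl
  by-cases 2 _ _ 2∣odd = ⊥-elim (not-even 2∣odd)
  by-cases 3 _ 3∣4 _ = ⊥-elim (from-no (3 ℕ.∣? 4) 3∣4)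
  by-cases 4 _ _ 4∣odd = ⊥-elim (not-even (ℕ.∣-trans (ℕ.divides 2 refl) 4∣odd))
  by-cases (suc (suc (suc (suc (suc _))))) (ℕ.s≤s (ℕ.s≤s (ℕ.s≤s (ℕ.s≤s ())))) _ _

-- For odd n take j = (n - 1)/2. For even n put j = n/2 - r, with r = 1 if 4 divides n and r = 2
-- otherwise, because then n/2 - 1 is even and shares a factor 2 with n. The requirement d = n/2 -
-- 2r > 0 means n > 4 in the first case and n > 8 in the second, which leaves out exactly 4 and 6
-- among the even n ≥ 3.
central-index : ∀ n → 3 ≤ n → n ≢ 4 → n ≢ 6 → ∃[ j ] Central n j
central-index n 3≤n n≢4 n≢6 = subst (λ n → ∃[ j ] Central n j) (sym n≡)
    (by-residue (n ℕ.% 4) (n ℕ./ 4) (ℕ.m%n<n n 4) (subst (3 ≤_) n≡ 3≤n) (n≢4 ∘ trans n≡) (n≢6 ∘ trans n≡))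
  where
  n≡ : n ≡ n ℕ.% 4 ℕ.+ n ℕ./ 4 ℕ.* 4
  n≡ = ℕ.m≡m%n+[m/n]*n n 4
  difference : ∀ {d} a {b c} → d ∣ c → c ≡ b ℕ.+ a → d ∣ b → d ∣ a
  difference a {b} d∣c refl d∣b = ℕ.∣m+n∣m⇒∣n {m = b} {n = a} d∣c d∣b
  by-residue : ∀ r q → r ℕ.< 4 → 3 ≤ r ℕ.+ q ℕ.* 4 → r ℕ.+ q ℕ.* 4 ≢ 4 → r ℕ.+ q ℕ.* 4 ≢ 6 → ∃[ j ] Central (r ℕ.+ q ℕ.* 4) j
  by-residue 0 0 _ () _ _
  by-residue 0 1 _ _ n≢4 _ = ⊥-elim (n≢4 refl)
  by-residue 0 (suc (suc m)) _ _ _ _ = j , subst (λ n → Central n j) (shape m)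
      (even 1 d ℕ.z<s ℕ.z<s λ {p} (p∣n , p∣j) → coprime-to-odd (suc m)
        (ℕ.∣-trans (difference 2 p∣n (gap m) (ℕ.∣m∣n⇒∣m+n p∣j p∣j)) (ℕ.divides 2 refl)) (subst (p ∣_) (odd-j m) p∣j))
    where
    d j : ℕ
    d = suc (suc (m ℕ.+ m))
    j = suc d
    open ℕSolver
    shape : ∀ m → (1 ℕ.+ (1 ℕ.+ (2 ℕ.+ (m ℕ.+ m)))) ℕ.+ (1 ℕ.+ (1 ℕ.+ (2 ℕ.+ (m ℕ.+ m)))) ≡ (2 ℕ.+ m) ℕ.* 4
    shape = solve 1 (λ m → (con 1 :+ (con 1 :+ (con 2 :+ (m :+ m)))) :+ (con 1 :+ (con 1 :+ (con 2 :+ (m :+ m)))) := (con 2 :+ m) :* con 4) refl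
    gap : ∀ m → (1 ℕ.+ (1 ℕ.+ (2 ℕ.+ (m ℕ.+ m)))) ℕ.+ (1 ℕ.+ (1 ℕ.+ (2 ℕ.+ (m ℕ.+ m)))) ≡ (1 ℕ.+ (2 ℕ.+ (m ℕ.+ m))) ℕ.+ (1 ℕ.+ (2 ℕ.+ (m ℕ.+ m))) ℕ.+ 2
    gap = solve 1 (λ m → (con 1 :+ (con 1 :+ (con 2 :+ (m :+ m)))) :+ (con 1 :+ (con 1 :+ (con 2 :+ (m :+ m)))) := (con 1 :+ (con 2 :+ (m :+ m))) :+ (con 1 :+ (con 2 :+ (m :+ m))) :+ con 2) refl
    odd-j : ∀ m → 3 ℕ.+ (m ℕ.+ m) ≡ 1 ℕ.+ ((1 ℕ.+ m) ℕ.+ (1 ℕ.+ m))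
    odd-j = solve 1 (λ m → con 3 :+ (m :+ m) := con 1 :+ ((con 1 :+ m) :+ (con 1 :+ m))) refl
  by-residue 1 0 _ (ℕ.s≤s ()) _ _
  by-residue 1 (suc q) _ _ _ _ = suc (suc (q ℕ.+ q)) , subst (λ n → Central n (suc (suc (q ℕ.+ q)))) (shape q) (odd (suc (suc (q ℕ.+ q))) ℕ.z<s)
    where
    open ℕSolver
    shape : ∀ q → 1 ℕ.+ ((2 ℕ.+ (q ℕ.+ q)) ℕ.+ (2 ℕ.+ (q ℕ.+ q))) ≡ 1 ℕ.+ (1 ℕ.+ q) ℕ.* 4
    shape = solve 1 (λ q → con 1 :+ ((con 2 :+ (q :+ q)) :+ (con 2 :+ (q :+ q))) := con 1 :+ (con 1 :+ q) :* con 4) refl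
  by-residue 2 0 _ (ℕ.s≤s (ℕ.s≤s ())) _ _
  by-residue 2 1 _ _ _ n≢6 = ⊥-elim (n≢6 refl)
  by-residue 2 (suc (suc m)) _ _ _ _ = j , subst (λ n → Central n j) (shape m)
      (even 2 d ℕ.z<s ℕ.z<s λ {p} (p∣n , p∣j) → coprime-to-odd (suc m)
        (difference 4 p∣n (gap m) (ℕ.∣m∣n⇒∣m+n p∣j p∣j)) (subst (p ∣_) (odd-j m) p∣j))
    where
    d j : ℕ
    d = suc (m ℕ.+ m)
    j = 2 ℕ.+ d
    open ℕSolver
    shape : ∀ m → (2 ℕ.+ (2 ℕ.+ (1 ℕ.+ (m ℕ.+ m)))) ℕ.+ (2 ℕ.+ (2 ℕ.+ (1 ℕ.+ (m ℕ.+ m)))) ≡ 2 ℕ.+ (2 ℕ.+ m) ℕ.* 4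
    shape = solve 1 (λ m → (con 2 :+ (con 2 :+ (con 1 :+ (m :+ m)))) :+ (con 2 :+ (con 2 :+ (con 1 :+ (m :+ m)))) := con 2 :+ (con 2 :+ m) :* con 4) refl
    gap : ∀ m → (2 ℕ.+ (2 ℕ.+ (1 ℕ.+ (m ℕ.+ m)))) ℕ.+ (2 ℕ.+ (2 ℕ.+ (1 ℕ.+ (m ℕ.+ m)))) ≡ (2 ℕ.+ (1 ℕ.+ (m ℕ.+ m))) ℕ.+ (2 ℕ.+ (1 ℕ.+ (m ℕ.+ m))) ℕ.+ 4
    gap = solve 1 (λ m → (con 2 :+ (con 2 :+ (con 1 :+ (m :+ m)))) :+ (con 2 :+ (con 2 :+ (con 1 :+ (m :+ m)))) := (con 2 :+ (con 1 :+ (m :+ m))) :+ (con 2 :+ (con 1 :+ (m :+ m))) :+ con 4) refl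
    odd-j : ∀ m → 3 ℕ.+ (m ℕ.+ m) ≡ 1 ℕ.+ ((1 ℕ.+ m) ℕ.+ (1 ℕ.+ m))
    odd-j = solve 1 (λ m → con 3 :+ (m :+ m) := con 1 :+ ((con 1 :+ m) :+ (con 1 :+ m))) refl
  by-residue 3 q _ _ _ _ = suc (q ℕ.+ q) , subst (λ n → Central n (suc (q ℕ.+ q))) (shape q) (odd (suc (q ℕ.+ q)) ℕ.z<s)
    where
    open ℕSolver
    shape : ∀ q → 1 ℕ.+ ((1 ℕ.+ (q ℕ.+ q)) ℕ.+ (1 ℕ.+ (q ℕ.+ q))) ≡ 3 ℕ.+ q ℕ.* 4
    shape = solve 1 (λ q → con 1 :+ ((con 1 :+ (q :+ q)) :+ (con 1 :+ (q :+ q))) := con 3 :+ q :* con 4) refl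
  by-residue (suc (suc (suc (suc _)))) _ (ℕ.s≤s (ℕ.s≤s (ℕ.s≤s (ℕ.s≤s ())))) _ _ _

central-dominant : ∀ {n j n′ x} root positive → Central n j → n ≡ suc (suc n′) → Sine.Dominant n′ x root positive j
central-dominant {n′ = n′} {x} root positive (odd j 0<j) n≡ = Sine.dominant-odd n′ x root positive j 0<j n≡
central-dominant {n′ = n′} {x} root positive (even r d 0<r 0<d _) n≡ = Sine.dominant-even n′ x root positive r d 0<r 0<d n≡

¬windowIntegral : ∀ n .{{_ : ℕ.NonZero n}} k (0<k : 0 ℕ.< k) (k<n : k ℕ.< n) →
  3 ≤ n → n ≢ 4 → n ≢ 6 → 2 ≤ k → suc k ℕ.< n → ¬ WindowIntegral n k 0<k k<n
¬windowIntegral (suc (suc n′)) (suc K) (ℕ.s≤s ℕ.z≤n) k<n 3≤n@(ℕ.s≤s (ℕ.s≤s 0<n′)) n≢4 n≢6 (ℕ.s≤s 0<K) 1+k<n =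
  NonIntegral.¬windowIntegral n′ x root positive j coprime (central-dominant root positive central refl) K k<n 0<n′ 0<K 1+k<n
  where
  x : ℝ
  x = proj₁ (cosine n′)
  root : 𝕊 (suc (suc n′)) x ≈ 𝟘
  root = proj₁ (proj₂ (cosine n′))
  positive : ∀ l → l ≤ n′ → Pos (𝕊 (suc l) x)
  positive = proj₂ (proj₂ (cosine n′))
  j : ℕ
  j = proj₁ (central-index (suc (suc n′)) 3≤n n≢4 n≢6)
  central : Central (suc (suc n′)) j
  central = proj₂ (central-index (suc (suc n′)) 3≤n n≢4 n≢6)
  coprime : ∀ i → suc (suc n′) ∣ j ℕ.* i → suc (suc n′) ∣ i
  coprime i = Coprimality.coprime-divisor (central-coprime central)

¬integral : ∀ n .{{_ : ℕ.NonZero n}} k → 3 ≤ n → n ≢ 4 → n ≢ 6 → 2 ≤ k → suc k ℕ.< n → ¬ Integral (hypercycle n k)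
¬integral n k 3≤n n≢4 n≢6 2≤k 1+k<n integral = ¬windowIntegral n k 0<k k<n 3≤n n≢4 n≢6 2≤k 1+k<n
    (Action.integral⇒window n k 0<k k<n integral)
  where
  0<k : 0 ℕ.< k
  0<k = ℕ.<-trans ℕ.z<s 2≤k
  k<n : k ℕ.< n
  k<n = ℕ.<-trans (ℕ.n<1+n k) 1+k<n

-- The classification

Exceptional : ℕ → ℕ → Set
Exceptional n k = k ≡ n ∸ 1 ⊎ (n , k) ∈ ((4 , 2) ∷ (6 , 2) ∷ (6 , 3) ∷ (6 , 4) ∷ [])

classify : ∀ n k → 3 ≤ n → 2 ≤ k → k ≤ n ∸ 1 → Exceptional n k ⊎ (n ≢ 4 × n ≢ 6 × suc k ℕ.< n)
classify n@(suc m) k 3≤n 2≤k k≤m with k ℕ.≟ m | n ℕ.≟ 4 | n ℕ.≟ 6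
... | yes k≡m | _ | _ = inj₁ (inj₁ k≡m)
... | no k≢m | no n≢4 | no n≢6 = inj₂ (n≢4 , n≢6 , ℕ.s≤s (ℕ.≤∧≢⇒< k≤m k≢m))
... | no k≢m | yes refl | _ = inj₁ (inj₂ (case-4 k 2≤k (ℕ.≤∧≢⇒< k≤m k≢m)))
  where
  case-4 : ∀ k → 2 ≤ k → k ℕ.< 3 → (4 , k) ∈ ((4 , 2) ∷ (6 , 2) ∷ (6 , 3) ∷ (6 , 4) ∷ [])
  case-4 0 () _
  case-4 1 (ℕ.s≤s ()) _
  case-4 2 _ _ = here refl
  case-4 (suc (suc (suc _))) _ (ℕ.s≤s (ℕ.s≤s (ℕ.s≤s ())))
... | no k≢m | no _ | yes refl = inj₁ (inj₂ (case-6 k 2≤k (ℕ.≤∧≢⇒< k≤m k≢m)))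
  where
  case-6 : ∀ k → 2 ≤ k → k ℕ.< 5 → (6 , k) ∈ ((4 , 2) ∷ (6 , 2) ∷ (6 , 3) ∷ (6 , 4) ∷ [])
  case-6 0 () _
  case-6 1 (ℕ.s≤s ()) _
  case-6 2 _ _ = there (here refl)
  case-6 3 _ _ = there (there (here refl))
  case-6 4 _ _ = there (there (there (here refl)))
  case-6 (suc (suc (suc (suc (suc _))))) _ (ℕ.s≤s (ℕ.s≤s (ℕ.s≤s (ℕ.s≤s (ℕ.s≤s ())))))

integral-resp-≡ : ∀ {n k n′ k′} → (n , k) ≡ (n′ , k′) → Integral (hypercycle n′ k′) → Integral (hypercycle n k)
integral-resp-≡ refl integral = integral

exceptional⇒integral : ∀ n k → 3 ≤ n → 2 ≤ k → Exceptional n k → Integral (hypercycle n k)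
exceptional⇒integral n k 3≤n 2≤k (inj₁ k≡n-1) =
  integral-resp-≡ (cong (_, k) n≡1+k) (integral-all-but-one k (ℕ.<-trans ℕ.z<s 2≤k))
  where
  n≡1+k : n ≡ suc k
  n≡1+k = trans (sym (ℕ.suc-pred n {{ℕ.>-nonZero (ℕ.<-trans ℕ.z<s 3≤n)}})) (cong suc (sym k≡n-1))
exceptional⇒integral n k _ _ (inj₂ (here eq)) = integral-resp-≡ eq integral-4-2
exceptional⇒integral n k _ _ (inj₂ (there (here eq))) = integral-resp-≡ eq integral-6-2
exceptional⇒integral n k _ _ (inj₂ (there (there (here eq)))) = integral-resp-≡ eq integral-6-3
exceptional⇒integral n k _ _ (inj₂ (there (there (there (here eq))))) = integral-resp-≡ eq integral-6-4

theorem2 : (n k : ℕ) → 3 ≤ n → 2 ≤ k → k ≤ n ∸ 1 →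
    Integral (hypercycle n k) ⇔
    (k ≡ n ∸ 1 ⊎ (n , k) ∈ ((4 , 2) ∷ (6 , 2) ∷ (6 , 3) ∷ (6 , 4) ∷ []))
theorem2 n k 3≤n 2≤k k≤n-1 = mk⇔ only-if (exceptional⇒integral n k 3≤n 2≤k)
  where
  only-if : Integral (hypercycle n k) → Exceptional n k
  only-if integral = ⊎.[ (λ exceptional → exceptional) , (λ (n≢4 , n≢6 , 1+k<n) →
      ⊥-elim (¬integral n {{ℕ.>-nonZero (ℕ.<-trans ℕ.z<s 3≤n)}} k 3≤n n≢4 n≢6 2≤k 1+k<n integral)) ]
    (classify n k 3≤n 2≤k k≤n-1)
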